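{- For all $n \geq 9$, \[\text{ex}_o(n,I_0) = \begin{cases} n(n-3) + \frac{n}{3} & n \equiv 0 \pmod 3,\\ n(n-3) + \frac{n-4}{3} & n \equiv 1 \pmod 3, \\ n(n-3) + \frac{n-5}{3} & n \equiv 2 \pmod 3.\end{cases}\] Moreover, up to isomorphism, the number of $I_0$-free oriented $(2\to1)$-graphs on $n$ vertices with exactly $\text{ex}_o(n,I_0)$ edges is exactly $1$ when $n\equiv 0 \pmod 3$, exactly $18$ when $n \equiv 1 \pmod 3$, and exactly $32$ when $n \equiv 2 \pmod 3$.
   Context: A $(2\to 1)$-graph (directed hypergraph) is a pair $H=(V,E)$ with $V$ a finite set and $E$ a set of pointed $3$-subsets of $V$: an edge, written $ab\to c$ (same as $ba\to c$), consists of three distinct vertices with head $c$ and tail set $\{a,b\}$. $H$ is oriented if every $3$-subset of $V$ carries at most one edge (in general it may carry up to three). $H$ is $F$-free if there is no injective map $\phi:V(F)\to V(H)$ such that $ab\to c\in E(F)$ implies $\phi(a)\phi(b)\to\phi(c)\in E(H)$. $\text{ex}_o(n,F)$ is the maximum number of edges of an $F$-free oriented $(2\to1)$-graph on $n$ vertices. $I_0$ is the $(2\to1)$-graph with vertex set $\{a,b,c,d,x\}$ (five distinct vertices) and edges $ab\to x$, $cd\to x$. Isomorphism means a bijection of vertex sets that preserves edges in both directions. -}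

module Defs where

open import Data.Bool using (Bool; true; false; T)
import Data.Bool.Properties as Bool
open import Data.Fin using (Fin; _<?_)
open import Data.Fin.Patterns using (0F; 1F; 2F; 3F; 4F)
open import Data.Fin.Permutation using (Permutation′; _⟨$⟩ʳ_)
open import Data.Fin.Properties using (all?; _≟_)
open import Data.List using (List; allFin; cartesianProduct; filter; length)
open import Data.Nat using (ℕ; _≤_)
open import Data.Product using (_×_; _,_; Σ-syntax; ∃-syntax)
open import Function using (_⇔_)
open import Function.Definitions using (Injective)
open import Relation.Binary.PropositionalEquality using (_≡_; _≢_)
open import Relation.Nullary using (¬_)
open import Relation.Nullary.Decidable using (T?; _×-dec_; _→-dec_; ¬?; from-yes)

-- A (2→1)-graph with vertex set Fin n.  `edge a b c` decides whether ab → c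
-- is an edge; `tail-sym` makes the tail {a, b} unordered.
record Graph (n : ℕ) : Set where
  field
    edge     : Fin n → Fin n → Fin n → Bool
    tail-sym : ∀ a b c → edge a b c ≡ edge b a c
    distinct : ∀ a b c → T (edge a b c) → a ≢ b × a ≢ c × b ≢ c

open Graph public

infix 4 _∋_∙_⟶_ _≅_

_∋_∙_⟶_ : ∀ {n} → Graph n → Fin n → Fin n → Fin n → Set
H ∋ a ∙ b ⟶ c = T (edge H a b c)

-- Tails are listed in increasing order so that ab → c and ba → c count once.
edges : ∀ {n} → Graph n → List (Fin n × Fin n × Fin n)
edges {n} H =
  filter (λ (a , b , c) → (a <? b) ×-dec T? (edge H a b c))
         (cartesianProduct (allFin n) (cartesianProduct (allFin n) (allFin n)))

edgeCount : ∀ {n} → Graph n → ℕ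
edgeCount H = length (edges H)

-- Two different edges on the same 3-subset are always of the form ab → c and
-- ac → b, where a is the vertex that is the head of neither.
Oriented : ∀ {n} → Graph n → Set
Oriented H = ∀ a b c → ¬ (H ∋ a ∙ b ⟶ c × H ∋ a ∙ c ⟶ b)

Free : ∀ {m n} → Graph m → Graph n → Set
Free {m} {n} F H =
  ¬ (Σ[ φ ∈ (Fin m → Fin n) ] Injective _≡_ _≡_ φ ×
      (∀ a b c → F ∋ a ∙ b ⟶ c → H ∋ φ a ∙ φ b ⟶ φ c))

-- IsExₒ n F k says that exₒ(n, F) = k.
record IsExₒ {m} (n : ℕ) (F : Graph m) (k : ℕ) : Set where
  field
    attained : ∃[ H ] Oriented {n} H × Free F H × edgeCount H ≡ k
    bound    : ∀ (H : Graph n) → Oriented H → Free F H → edgeCount H ≤ k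

Extremal : ∀ {m n} → Graph m → Graph n → Set
Extremal {n = n} F H = Oriented H × Free F H × IsExₒ n F (edgeCount H)

_≅_ : ∀ {n} → Graph n → Graph n → Set
_≅_ {n} G H = Σ[ π ∈ Permutation′ n ] ∀ a b c →
  G ∋ a ∙ b ⟶ c ⇔ H ∋ (π ⟨$⟩ʳ a) ∙ (π ⟨$⟩ʳ b) ⟶ (π ⟨$⟩ʳ c)

-- Up to isomorphism there are exactly k graphs on n vertices satisfying P:
-- rep is a system of representatives indexed without repetition by Fin k.
record CountUpToIso {n} (P : Graph n → Set) (k : ℕ) : Set where
  field
    rep        : Fin k → Graph n
    satisfies  : ∀ i → P (rep i)
    distinct-≅ : ∀ i j → rep i ≅ rep j → i ≡ j
    complete   : ∀ H → P H → ∃[ i ] H ≅ rep i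

-- The vertices a, b, c, d, x are 0, 1, 2, 3, 4.
I₀ : Graph 5
I₀ = record
  { edge     = e
  ; tail-sym = from-yes (all? λ a → all? λ b → all? λ c → e a b c Bool.≟ e b a c)
  ; distinct = from-yes (all? λ a → all? λ b → all? λ c →
      T? (e a b c) →-dec (¬? (a ≟ b) ×-dec (¬? (a ≟ c) ×-dec ¬? (b ≟ c))))
  }
  where
  e : Fin 5 → Fin 5 → Fin 5 → Bool
  e 0F 1F 4F = true
  e 1F 0F 4F = true
  e 2F 3F 4F = true
  e 3F 2F 4F = true
  e _  _  _  = false

{-# OPTIONS --safe #-}
module Submission where

-- A vertex x of an I₀-free graph has pairwise meeting tails, so they form a star
-- with a centre f x, or a triangle (which costs far too many edges). Call (x , b)
-- missing if f x ∙ b ⟶ x is not an edge although it could be; then the number of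
-- edges is n (n - 2) minus the number of missing pairs. As the graph is oriented,
-- the triple {x, f x, f (f x)} can be used by only one of x and f x, so every
-- vertex x off the 3-cycles of f accounts for a missing pair of its own, and every
-- 3-cycle accounts for two. Two-cycles of f are again too expensive. Hence about
-- 2n/3 pairs are missing, with equality when f consists of 3-cycles. If 3 ∤ n, one
-- needs a remainder: a 4- or 5-cycle of f, or a path of one or two vertices
-- entering a 3-cycle, where a further triple is contested by two vertices with the
-- same centre. What remains to be chosen is who receives each contested triple:
-- 6 + 12 ways up to isomorphism on 4 vertices, and 8 + 24 ways on 5 vertices.

open import Defs
import Algebra.Properties.CommutativeMonoid.Sum as CommutativeMonoidSum
open import Data.Bool using (Bool; true; false; T; _∧_; _∨_; not; if_then_else_)
import Data.Bool.Properties as Boolₚ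
open import Data.Empty using (⊥; ⊥-elim)
open import Data.Fin using (Fin; zero; suc; toℕ; _↑ˡ_; _↑ʳ_; combine; remQuot; splitAt; join)
import Data.Fin as Fin
open import Data.Fin.Patterns using (0F; 1F; 2F; 3F; 4F)
open import Data.Fin.Permutation
  using (Permutation; Permutation′; permutation; _⟨$⟩ʳ_; _⟨$⟩ˡ_; inverseˡ; ↔⇒≡)
open import Data.Fin.Properties
  using (_≟_; all?; any?; join-splitAt; splitAt-↑ˡ; splitAt-↑ʳ; remQuot-combine; combine-remQuot)
import Data.Fin.Properties as Finₚ
open import Data.List
  using (List; []; _∷_; _++_; allFin; cartesianProduct; filter; length; lookup; map)
import Data.List as List
import Data.List.Membership.DecPropositional as DecMembership
open import Data.List.Membership.Propositional using (_∈_; _∉_)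
open import Data.List.Membership.Propositional.Properties using (∈-filter⁺; ∈-filter⁻; ∈-allFin; ∈-lookup)
open import Data.List.Properties using (filter-++; length-++)
open import Data.List.Relation.Unary.All using (All; []; _∷_)
import Data.List.Relation.Unary.All as All
open import Data.List.Relation.Unary.All.Properties using (¬Any⇒All¬)
open import Data.List.Relation.Unary.AllPairs using ([]; _∷_)
open import Data.List.Relation.Unary.Any using (here; there; index)
open import Data.List.Relation.Unary.Any.Properties using (lookup-index)
open import Data.List.Relation.Unary.Unique.Propositional using (Unique)
open import Data.List.Relation.Unary.Unique.Propositional.Properties using (filter⁺; allFin⁺)
open import Data.Nat using (ℕ; zero; suc; _+_; _*_; _∸_; _/_; _%_; _≤_; _<_; z≤n; s≤s)
  renaming (_≟_ to _≟ℕ_)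
open import Data.Nat.DivMod using ([m+kn]%n≡m%n; m*n/n≡m; m≡m%n+[m/n]*n; /-monoˡ-≤)
open import Data.Nat.Properties hiding (_≟_; _<?_)
open import Data.Nat.Tactic.RingSolver using (solve-∀)
open import Data.Product using (_×_; _,_; proj₁; proj₂; uncurry; Σ-syntax; ∃-syntax)
import Data.Product.Properties as Productₚ
open import Data.Sum using (_⊎_; inj₁; inj₂)
import Data.Sum as Sum⊎
open import Data.Sum.Properties using (inj₁-injective)
open import Data.Vec using (Vec; []; _∷_; tabulate)
import Data.Vec as Vec
open import Data.Vec.Properties using (lookup∘tabulate)
import Data.Vec.Properties as Vecₚ
open import Function using (_∘_; id; mk⇔)
open import Function.Bundles using (module Equivalence)
open import Level using (0ℓ)
open import Relation.Binary.Definitions using (DecidableEquality; tri<; tri≈; tri>)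
open import Relation.Binary.PropositionalEquality
open import Relation.Nullary using (¬_; Dec; yes; no; does)
open import Relation.Nullary.Decidable
  using (T?; _×-dec_; _⊎-dec_; _→-dec_; ¬?; from-yes; dec-true; dec-false; does-⇔)
open import Relation.Unary using (Pred; Decidable)

-- Write n = σ + 3K with σ = 0, 4 or 5. The extremal value is n(n - 3) + K, which means 2K + σ
-- missing pairs: two for each of K isolated 3-cycles and σ among the remaining σ vertices. Counted
-- in thirds, 3 · loss is at least 2n + `#S` + 3`Γ`, where `#S` counts the vertices off the 3-cycles
-- and `Γ` the missing pairs not charged to a triple {x, f x, f (f x)}; so `#S` + 3`Γ` has to be
-- least. As `#S` is congruent to n modulo 3, the values 1 and 2 look best when 3 does not divide n,
-- but then some vertex off the 3-cycles has its centre on one, which forces `Γ` ≥ 1. The least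
-- values are thus 0, 4 and 5, which is where σ comes from; 4 and 5 are reached both with `Γ` = 1
-- (lassos) and with `Γ` = 0 (rings). Triangles and 2-cycles leave at most n(n - 3) + 1 edges, too
-- few because n ≥ 9 gives K ≥ 2. Two isolated 3-cycles also allow the centres to be recovered from
-- the edges, so isomorphisms respect f and the classification becomes a finite check on σ vertices.

private
  module Sum = CommutativeMonoidSum +-0-commutativeMonoid

-- Finite sums

𝟙 : Bool → ℕ
𝟙 b = if b then 1 else 0

[_≡ᶠ_] : ∀ {n} → Fin n → Fin n → ℕ
[ i ≡ᶠ j ] = 𝟙 (does (i ≟ j))

-- A linear inequality is certified by a single identity between semiring
-- expressions, in which d is the slack.
by-identity : ∀ {a b l r} d → l ≤ r → a + r + d ≡ b + l → a ≤ b
by-identity {a} {b} {l} {r} d l≤r eq = +-cancelʳ-≤ l a b (begin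
  a + l      ≤⟨ +-monoʳ-≤ a l≤r ⟩
  a + r      ≤⟨ m≤m+n (a + r) d ⟩
  a + r + d  ≡⟨ eq ⟩
  b + l      ∎)
  where open ≤-Reasoning

-- Opaque, so that unification does not unfold the fold underlying sums.
opaque
  sum : ∀ {n} → (Fin n → ℕ) → ℕ
  sum = Sum.sum

  sum≡ : ∀ {n} (f : Fin n → ℕ) → sum f ≡ Sum.sum f
  sum≡ f = refl

  sum-cong : ∀ {n} {f g : Fin n → ℕ} → f ≗ g → sum f ≡ sum g
  sum-cong = Sum.sum-cong-≗

  sum-+ : ∀ {n} (f g : Fin n → ℕ) → sum (λ i → f i + g i) ≡ sum f + sum g
  sum-+ = Sum.∑-distrib-+

  sum-swap : ∀ {m n} (f : Fin m → Fin n → ℕ) →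
    (sum λ i → sum λ j → f i j) ≡ sum λ j → sum λ i → f i j
  sum-swap = Sum.∑-comm

  sum-permute : ∀ {n} (f : Fin n → ℕ) (π : Permutation′ n) → sum f ≡ sum λ i → f (π ⟨$⟩ʳ i)
  sum-permute f π = Sum.sum-permute f π

  sum-mono : ∀ {n} {f g : Fin n → ℕ} → (∀ i → f i ≤ g i) → sum f ≤ sum g
  sum-mono {zero}  f≤g = z≤n
  sum-mono {suc n} f≤g = +-mono-≤ (f≤g zero) (sum-mono (f≤g ∘ suc))

  sum-tight : ∀ {n} {f g : Fin n → ℕ} → (∀ i → f i ≤ g i) → sum g ≤ sum f →
              ∀ i → f i ≡ g i
  sum-tight {suc n} {f} {g} f≤g Σg≤Σf zero = ≤-antisym (f≤g zero)
    (+-cancelʳ-≤ _ _ _ (≤-trans Σg≤Σf (+-monoʳ-≤ (f zero) (sum-mono (f≤g ∘ suc)))))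
  sum-tight {suc n} {f} {g} f≤g Σg≤Σf (suc i) = sum-tight (f≤g ∘ suc)
    (+-cancelˡ-≤ _ _ _ (≤-trans Σg≤Σf (+-monoˡ-≤ _ (f≤g zero)))) i

  sum-const : ∀ n c → sum {n} (λ _ → c) ≡ n * c
  sum-const zero    c = refl
  sum-const (suc n) c = cong (c +_) (sum-const n c)

  sum-*ˡ : ∀ {n} c (f : Fin n → ℕ) → sum (λ i → c * f i) ≡ c * sum f
  sum-*ˡ {zero}  c f = sym (*-zeroʳ c)
  sum-*ˡ {suc n} c f =
    trans (cong (c * f zero +_) (sum-*ˡ c (f ∘ suc))) (sym (*-distribˡ-+ c (f zero) _))

  sum-pick : ∀ {n} (z : Fin n) (g : Fin n → ℕ) → sum (λ i → [ i ≡ᶠ z ] * g i) ≡ g z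
  sum-pick {suc n} zero    g =
    trans (cong₂ _+_ (+-identityʳ (g zero)) (Sum.sum-replicate-zero n)) (+-identityʳ (g zero))
  sum-pick {suc n} (suc z) g = sum-pick z (g ∘ suc)

  term≤sum : ∀ {n} (f : Fin n → ℕ) i → f i ≤ sum f
  term≤sum f zero    = m≤m+n _ _
  term≤sum f (suc i) = ≤-trans (term≤sum (f ∘ suc) i) (m≤n+m _ _)

  sum-++ : ∀ m {n} (f : Fin (m + n) → ℕ) → sum f ≡ sum (f ∘ (_↑ˡ n)) + sum (f ∘ (m ↑ʳ_))
  sum-++ zero    f = refl
  sum-++ (suc m) f =
    trans (cong (f zero +_) (sum-++ m (f ∘ suc))) (sym (+-assoc (f zero) _ _))

  sum-combine : ∀ m {n} (f : Fin (m * n) → ℕ) → sum f ≡ sum λ i → sum λ j → f (combine {m} i j)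
  sum-combine zero        f = refl
  sum-combine (suc m) {n} f =
    trans (sum-++ n f) (cong (sum (f ∘ (_↑ˡ (m * n))) +_) (sum-combine m (f ∘ (n ↑ʳ_))))

sum-indicator : ∀ {n} (z : Fin n) → sum (λ i → [ i ≡ᶠ z ]) ≡ 1
sum-indicator z = trans (sum-cong λ i → sym (*-identityʳ [ i ≡ᶠ z ])) (sum-pick z λ _ → 1)

sum-zero : ∀ {n} {f : Fin n → ℕ} → (∀ i → f i ≡ 0) → sum f ≡ 0
sum-zero {n} f≡0 = trans (sum-cong f≡0) (trans (sum-const n 0) (*-zeroʳ n))

-- Counting edges by their heads

length-filter-map : ∀ {A B : Set} {P : Pred B 0ℓ} (P? : Decidable P) (f : A → B) xs →
  length (filter P? (map f xs)) ≡ length (filter (P? ∘ f) xs)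
length-filter-map P? f []       = refl
length-filter-map P? f (x ∷ xs) with does (P? (f x))
... | true  = cong suc (length-filter-map P? f xs)
... | false = length-filter-map P? f xs

opaque
  unfolding sum

  length-filter-tabulate : ∀ {A : Set} {n} {P : Pred A 0ℓ} (P? : Decidable P) (g : Fin n → A) →
    length (filter P? (List.tabulate g)) ≡ sum λ i → 𝟙 (does (P? (g i)))
  length-filter-tabulate {n = zero}  P? g = refl
  length-filter-tabulate {n = suc n} P? g with does (P? (g zero))
  ... | true  = cong suc (length-filter-tabulate P? (g ∘ suc))
  ... | false = length-filter-tabulate P? (g ∘ suc)

  length-filter-cartesianProduct : ∀ {A B : Set} {n} {P : Pred (A × B) 0ℓ} (P? : Decidable P) (g : Fin n → A) ys →
    length (filter P? (cartesianProduct (List.tabulate g) ys)) ≡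
    sum λ i → length (filter (λ y → P? (g i , y)) ys)
  length-filter-cartesianProduct {n = zero}  P? g ys = refl
  length-filter-cartesianProduct {A} {B} {n = suc n} P? g ys = begin
    length (filter P? (firsts ++ rest))                         ≡⟨ cong length (filter-++ P? firsts rest) ⟩
    length (filter P? firsts ++ filter P? rest)                 ≡⟨ length-++ (filter P? firsts) ⟩
    length (filter P? firsts) + length (filter P? rest)         ≡⟨ cong₂ _+_ (length-filter-map P? (g zero ,_) ys)
                                                                   (length-filter-cartesianProduct P? (g ∘ suc) ys) ⟩
    sum (λ i → length (filter (λ y → P? (g i , y)) ys))         ∎
    where
    open ≡-Reasoning
    firsts rest : List (A × B)
    firsts = map (g zero ,_) ys
    rest   = cartesianProduct (List.tabulate (g ∘ suc)) ys

-- Every tail at x is counted twice.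
tails : ∀ {n} → Graph n → Fin n → ℕ
tails H x = sum λ a → sum λ b → 𝟙 (edge H a b x)

edgeCount-sum : ∀ {n} (H : Graph n) →
  edgeCount H ≡ sum λ a → sum λ b → sum λ c → 𝟙 (does (a Fin.<? b) ∧ edge H a b c)
edgeCount-sum H =
  trans (length-filter-cartesianProduct _ id _) (sum-cong λ a →
  trans (length-filter-cartesianProduct _ id _) (sum-cong λ b →
  length-filter-tabulate _ id))

∑-rotate : ∀ {l m n} (f : Fin l → Fin m → Fin n → ℕ) →
  (sum λ a → sum λ b → sum λ c → f a b c) ≡ sum λ c → sum λ a → sum λ b → f a b c
∑-rotate f = trans (sum-cong λ a → sum-swap (f a)) (sum-swap λ a c → sum λ b → f a b c)

-- A tail is increasing in exactly one of its two orders, since its ends differ by `distinct`.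
tails-ordered : ∀ {n} (H : Graph n) x →
  tails H x ≡ 2 * sum λ a → sum λ b → 𝟙 (does (a Fin.<? b) ∧ edge H a b x)
tails-ordered H x = begin
  tails H x
    ≡⟨ sum-cong (λ a → trans (sum-cong (split a)) (sum-+ (up a) λ b → up b a)) ⟩
  sum (λ a → sum (up a) + sum λ b → up b a)
    ≡⟨ sum-+ (λ a → sum (up a)) (λ a → sum λ b → up b a) ⟩
  U + sum (λ a → sum λ b → up b a)
    ≡⟨ cong (U +_) (sum-swap λ a b → up b a) ⟩
  U + U
    ≡⟨ cong (U +_) (+-identityʳ U) ⟨
  2 * U ∎
  where
  open ≡-Reasoning
  up : Fin _ → Fin _ → ℕ
  up a b = 𝟙 (does (a Fin.<? b) ∧ edge H a b x)
  U = sum λ a → sum (up a)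
  split : ∀ a b → 𝟙 (edge H a b x) ≡ up a b + up b a
  split a b = by-order (a Fin.<? b) (b Fin.<? a)
    where
    by-order : (d : Dec (a Fin.< b)) (d′ : Dec (b Fin.< a)) →
      𝟙 (edge H a b x) ≡ 𝟙 (does d ∧ edge H a b x) + 𝟙 (does d′ ∧ edge H b a x)
    by-order (yes a<b) (yes b<a) = ⊥-elim (<-asym a<b b<a)
    by-order (yes a<b) (no  _)   = sym (+-identityʳ _)
    by-order (no  _)   (yes b<a) = cong 𝟙 (tail-sym H a b x)
    by-order (no a≮b)  (no b≮a)  with edge H a b x in eq
    ... | false = refl
    ... | true  with Finₚ.<-cmp a b
    ...   | tri< a<b _ _ = ⊥-elim (a≮b a<b)
    ...   | tri> _ _ b<a = ⊥-elim (b≮a b<a)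
    ...   | tri≈ _ a≡b _ = ⊥-elim (proj₁ (distinct H a b x (subst T (sym eq) _)) a≡b)

2*edgeCount : ∀ {n} (H : Graph n) → 2 * edgeCount H ≡ sum (tails H)
2*edgeCount {n} H = begin
  2 * edgeCount H                 ≡⟨ cong (2 *_) (trans (edgeCount-sum H) (∑-rotate up)) ⟩
  2 * sum (λ x → sum λ a → sum λ b → up a b x)      ≡⟨ sum-*ˡ 2 _ ⟨
  sum (λ x → 2 * sum λ a → sum λ b → up a b x)      ≡⟨ sum-cong (λ x → tails-ordered H x) ⟨
  sum (tails H)                                      ∎
  where
  open ≡-Reasoning
  up : Fin n → Fin n → Fin n → ℕ
  up a b c = 𝟙 (does (a Fin.<? b) ∧ edge H a b c)

sum₂ : ∀ {n} → (Fin n → Fin n → ℕ) → ℕ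
sum₂ F = sum λ a → sum λ b → F a b

sum₂-mono : ∀ {n} {F G : Fin n → Fin n → ℕ} → (∀ a b → F a b ≤ G a b) → sum₂ F ≤ sum₂ G
sum₂-mono F≤G = sum-mono λ a → sum-mono (F≤G a)

sum₂-+ : ∀ {n} (F G : Fin n → Fin n → ℕ) → sum₂ (λ a b → F a b + G a b) ≡ sum₂ F + sum₂ G
sum₂-+ F G = trans (sum-cong λ a → sum-+ (F a) (G a)) (sum-+ (λ a → sum (F a)) (λ a → sum (G a)))

sum₂-cong : ∀ {n} {F G : Fin n → Fin n → ℕ} → (∀ a b → F a b ≡ G a b) → sum₂ F ≡ sum₂ G
sum₂-cong F≡G = sum-cong λ a → sum-cong (F≡G a)

sum₂-tight : ∀ {n} {F G : Fin n → Fin n → ℕ} → (∀ a b → F a b ≤ G a b) → sum₂ G ≤ sum₂ F →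
             ∀ a b → F a b ≡ G a b
sum₂-tight F≤G ΣG≤ΣF a =
  sum-tight (F≤G a) (≤-reflexive (sym (sum-tight (λ a → sum-mono (F≤G a)) ΣG≤ΣF a)))

sum₂-pick : ∀ {n} (y z : Fin n) c → sum₂ (λ a b → [ a ≡ᶠ y ] * ([ b ≡ᶠ z ] * c)) ≡ c
sum₂-pick y z c =
  trans (sum-cong λ a → trans (sum-*ˡ [ a ≡ᶠ y ] _) (cong ([ a ≡ᶠ y ] *_) (sum-pick z λ _ → c)))
        (sum-pick y λ _ → c)

≡ᶠ-refl : ∀ {n} (i : Fin n) → [ i ≡ᶠ i ] ≡ 1
≡ᶠ-refl i = cong 𝟙 (dec-true (i ≟ i) refl)

≡ᶠ-≢ : ∀ {n} {i j : Fin n} → i ≢ j → [ i ≡ᶠ j ] ≡ 0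
≡ᶠ-≢ {i = i} {j} i≢j = cong 𝟙 (dec-false (i ≟ j) i≢j)

𝟙-true : ∀ {b} → T b → 𝟙 b ≡ 1
𝟙-true {true} _ = refl

𝟙-false : ∀ {b} → ¬ T b → 𝟙 b ≡ 0
𝟙-false {true}  ¬b = ⊥-elim (¬b _)
𝟙-false {false} _  = refl

-- Counting along lists without repetition

count : ∀ {n} → List (Fin n) → Fin n → ℕ
count []       x = 0
count (y ∷ ys) x = [ x ≡ᶠ y ] + count ys x

sum-count : ∀ {n} (ys : List (Fin n)) → sum (count ys) ≡ length ys
sum-count {n} [] = trans (sum-const n 0) (*-zeroʳ n)
sum-count (y ∷ ys) = trans (sum-+ (λ x → [ x ≡ᶠ y ]) (count ys)) (cong₂ _+_ (sum-indicator y) (sum-count ys))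

count-∉ : ∀ {n} {x : Fin n} ys → x ∉ ys → count ys x ≡ 0
count-∉ []       x∉ = refl
count-∉ (y ∷ ys) x∉ = cong₂ _+_ (≡ᶠ-≢ (x∉ ∘ here)) (count-∉ ys (x∉ ∘ there))

count-∈ : ∀ {n} {x : Fin n} {ys} → x ∈ ys → 1 ≤ count ys x
count-∈ {x = x} (here refl) = ≤-trans (≤-reflexive (sym (≡ᶠ-refl x))) (m≤m+n _ _)
count-∈         (there x∈)  = ≤-trans (count-∈ x∈) (m≤n+m _ _)

module _ {n} (P : Fin n → Bool) where

  private
    _∈?_ : (x : Fin n) (ys : List (Fin n)) → Dec (x ∈ ys)
    _∈?_ = DecMembership._∈?_ _≟_

  count≤ : ∀ {ys} → Unique ys → All (T ∘ P) ys → ∀ x → count ys x ≤ 𝟙 (P x)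
  count≤ []          []          x = z≤n
  count≤ {y ∷ ys} (y∉ ∷ uniq) (Py ∷ Pys) x with x ≟ y
  ... | yes refl = ≤-reflexive (trans (cong suc (count-∉ ys λ y∈ → All.lookup y∉ y∈ refl)) (sym (𝟙-true Py)))
  ... | no  _    = count≤ uniq Pys x

  unique-length≤ : ∀ {ys} → Unique ys → All (T ∘ P) ys → length ys ≤ sum (𝟙 ∘ P)
  unique-length≤ {ys} uniq Pys =
    ≤-trans (≤-reflexive (sym (sum-count ys))) (sum-mono (count≤ uniq Pys))

  -- An element outside the list could be prepended to it, and the longer list would violate
  -- `unique-length≤`.
  unique-covers : ∀ {ys} → Unique ys → All (T ∘ P) ys → sum (𝟙 ∘ P) ≤ length ys →
                  ∀ {x} → T (P x) → x ∈ ys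
  unique-covers {ys} uniq Pys ΣP≤ {x} Px with x ∈? ys
  ... | yes x∈ = x∈
  ... | no  x∉ = ⊥-elim (1+n≰n (≤-trans
    (unique-length≤ (¬Any⇒All¬ ys x∉ ∷ uniq) (Px ∷ Pys)) ΣP≤))

  find-outside : ∀ ys → length ys < sum (𝟙 ∘ P) → ∃[ x ] T (P x) × x ∉ ys
  find-outside ys l<ΣP with any? (λ x → T? (P x) ×-dec ¬? (x ∈? ys))
  ... | yes found = found
  ... | no  none  = ⊥-elim (<⇒≱ l<ΣP (≤-trans (sum-mono covered) (≤-reflexive (sum-count ys))))
    where
    covered : ∀ x → 𝟙 (P x) ≤ count ys x
    covered x with P x in eq
    ... | false = z≤n
    ... | true  with x ∈? ys
    ...   | yes x∈ = count-∈ x∈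
    ...   | no  x∉ = ⊥-elim (none (x , subst T (sym eq) _ , x∉))

fresh : ∀ {n} (ys : List (Fin n)) → length ys < n → ∃[ x ] x ∉ ys
fresh {n} ys l<n =
  let x , _ , x∉ = find-outside (λ _ → true) ys
        (subst (length ys <_) (sym (trans (sum-const n 1) (*-identityʳ n))) l<n)
  in x , x∉

-- Meeting tails

module _ {n} (H : Graph n) where

  flip-tail : ∀ {a b c} → H ∋ a ∙ b ⟶ c → H ∋ b ∙ a ⟶ c
  flip-tail {a} {b} {c} = subst T (tail-sym H a b c)

  countPair : List (Fin n × Fin n) → Fin n → Fin n → ℕ
  countPair []             a b = 0
  countPair ((y , z) ∷ ps) a b = [ a ≡ᶠ y ] * ([ b ≡ᶠ z ] * 1) + countPair ps a b

  sum-countPair : ∀ ps → sum₂ (countPair ps) ≡ length ps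
  sum-countPair [] = sum-zero λ _ → sum-zero λ _ → refl
  sum-countPair ((y , z) ∷ ps) =
    trans (sum₂-+ _ (countPair ps)) (cong₂ _+_ (sum₂-pick y z 1) (sum-countPair ps))

  countPair-∈ : ∀ {a b ps} → (a , b) ∈ ps → 1 ≤ countPair ps a b
  countPair-∈ {a} {b} (here refl) rewrite ≡ᶠ-refl a | ≡ᶠ-refl b = s≤s z≤n
  countPair-∈ (there ab∈) = ≤-trans (countPair-∈ ab∈) (m≤n+m _ _)

  tails≤ : ∀ {x} ps → (∀ a b → H ∋ a ∙ b ⟶ x → (a , b) ∈ ps) → tails H x ≤ length ps
  tails≤ {x} ps edge⇒∈ = ≤-trans (sum₂-mono pointwise) (≤-reflexive (sum-countPair ps))
    where
    pointwise : ∀ a b → 𝟙 (edge H a b x) ≤ countPair ps a b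
    pointwise a b with edge H a b x | edge⇒∈ a b
    ... | false | _   = z≤n
    ... | true  | ab∈ = countPair-∈ (ab∈ _)

  -- A vertex without tails has every other vertex as a centre, so centres need not be unique.
  -- Requiring `z ≢ x` keeps a choice of centres free of fixed points.
  Centre : Fin n → Fin n → Set
  Centre z x = z ≢ x × (∀ a b → H ∋ a ∙ b ⟶ x → a ≡ z ⊎ b ≡ z)

I₀-edges : ∀ a b c → I₀ ∋ a ∙ b ⟶ c → c ≡ 4F ×
  ((a ≡ 0F × b ≡ 1F) ⊎ (a ≡ 1F × b ≡ 0F) ⊎ (a ≡ 2F × b ≡ 3F) ⊎ (a ≡ 3F × b ≡ 2F))
I₀-edges = from-yes (all? λ a → all? λ b → all? λ c → T? (edge I₀ a b c) →-dec
  ((c ≟ 4F) ×-dec (((a ≟ 0F) ×-dec (b ≟ 1F)) ⊎-dec (((a ≟ 1F) ×-dec (b ≟ 0F)) ⊎-dec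
  (((a ≟ 2F) ×-dec (b ≟ 3F)) ⊎-dec ((a ≟ 3F) ×-dec (b ≟ 2F)))))))

lookup-injective : ∀ {A : Set} {xs : List A} → Unique xs → ∀ {i j} → lookup xs i ≡ lookup xs j → i ≡ j
lookup-injective (x∉ ∷ uniq) {zero}  {zero}  eq = refl
lookup-injective (x∉ ∷ uniq) {zero}  {suc j} eq = ⊥-elim (All.lookup x∉ (∈-lookup j) eq)
lookup-injective (x∉ ∷ uniq) {suc i} {zero}  eq = ⊥-elim (All.lookup x∉ (∈-lookup i) (sym eq))
lookup-injective (x∉ ∷ uniq) {suc i} {suc j} eq = cong suc (lookup-injective uniq eq)

module _ {n} {H : Graph n} (free : Free I₀ H) where

  -- Five distinct vertices listed in the order of `I₀` would embed it. Three excluded coincidences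
  -- yielding the fourth is the form in which the case analysis of a triangle uses it.
  tails-meet : ∀ {a b c d x} → H ∋ a ∙ b ⟶ x → H ∋ c ∙ d ⟶ x → a ≢ c → a ≢ d → b ≢ c → b ≡ d
  tails-meet {a} {b} {c} {d} {x} abx cdx a≢c a≢d b≢c with b ≟ d
  ... | yes b≡d = b≡d
  ... | no  b≢d = ⊥-elim (free (φ , lookup-injective uniq , edge-map))
    where
    φ = lookup (a ∷ b ∷ c ∷ d ∷ x ∷ [])
    abx-distinct = distinct H a b x abx
    cdx-distinct = distinct H c d x cdx
    uniq : Unique (a ∷ b ∷ c ∷ d ∷ x ∷ [])
    uniq = (proj₁ abx-distinct ∷ a≢c ∷ a≢d ∷ proj₁ (proj₂ abx-distinct) ∷ [])
         ∷ (b≢c ∷ b≢d ∷ proj₂ (proj₂ abx-distinct) ∷ [])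
         ∷ (proj₁ cdx-distinct ∷ proj₁ (proj₂ cdx-distinct) ∷ [])
         ∷ (proj₂ (proj₂ cdx-distinct) ∷ []) ∷ [] ∷ []
    edge-map : ∀ a b c → I₀ ∋ a ∙ b ⟶ c → H ∋ φ a ∙ φ b ⟶ φ c
    edge-map a b c e with I₀-edges a b c e
    ... | refl , inj₁ (refl , refl)               = abx
    ... | refl , inj₂ (inj₁ (refl , refl))        = flip-tail H abx
    ... | refl , inj₂ (inj₂ (inj₁ (refl , refl))) = cdx
    ... | refl , inj₂ (inj₂ (inj₂ (refl , refl))) = flip-tail H cdx

  avoiding? : ∀ x u → Dec (∃[ a ] ∃[ b ] (H ∋ a ∙ b ⟶ x × a ≢ u × b ≢ u))
  avoiding? x u = any? λ a → any? λ b → T? (edge H a b x) ×-dec (¬? (a ≟ u) ×-dec ¬? (b ≟ u))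

  centre : ∀ x u → u ≢ x → ¬ (∃[ a ] ∃[ b ] (H ∋ a ∙ b ⟶ x × a ≢ u × b ≢ u)) → Centre H u x
  centre x u u≢x none = u≢x , λ a b abx → by-cases a b abx (a ≟ u) (b ≟ u)
    where
    by-cases : ∀ a b → H ∋ a ∙ b ⟶ x → Dec (a ≡ u) → Dec (b ≡ u) → a ≡ u ⊎ b ≡ u
    by-cases a b abx (yes p) _       = inj₁ p
    by-cases a b abx (no _)  (yes p) = inj₂ p
    by-cases a b abx (no p)  (no q)  = ⊥-elim (none (a , b , abx , p , q))

  -- An intersecting family of pairs is a star or a triangle.
  star-or-few : 2 ≤ n → ∀ x → (∃[ z ] Centre H z x) ⊎ tails H x ≤ 6
  star-or-few 2≤n x with any? (λ a → any? λ b → T? (edge H a b x))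
  ... | no  none = inj₁ (let z , z∉ = fresh (x ∷ []) 2≤n in
    z , z∉ ∘ here , λ a b abx → ⊥-elim (none (a , b , abx)))
  ... | yes (u , v , uvx) with avoiding? x u
  ...   | no  none = inj₁ (u , centre x u (proj₁ (proj₂ (distinct H u v x uvx))) none)
  ...   | yes (a , b , abx , a≢u , b≢u) with avoiding? x v
  ...     | no  none = inj₁ (v , centre x v (proj₂ (proj₂ (distinct H u v x uvx))) none)
  -- A tail avoiding u passes through v and a tail avoiding v passes through u, because both meet
  -- {u, v}. These two tails meet each other, so their other ends coincide.
  ...     | yes (c , d , cdx , c≢v , d≢v) = inj₂ (triangle (third abx a≢u b≢u) (third′ cdx c≢v d≢v))
    where
    third : ∀ {a b} → H ∋ a ∙ b ⟶ x → a ≢ u → b ≢ u → ∃[ w ] (w ≢ u × w ≢ v × H ∋ v ∙ w ⟶ x)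
    third {a} {b} abx a≢u b≢u with a ≟ v
    ... | yes refl = b , b≢u , (proj₁ (distinct H a b x abx) ∘ sym) , abx
    ... | no  a≢v with b ≟ v
    ...   | yes refl = a , a≢u , a≢v , flip-tail H abx
    ...   | no  b≢v  = ⊥-elim (b≢v (tails-meet abx uvx a≢u a≢v b≢u))
    third′ : ∀ {a b} → H ∋ a ∙ b ⟶ x → a ≢ v → b ≢ v → ∃[ w ] (w ≢ u × w ≢ v × H ∋ u ∙ w ⟶ x)
    third′ {a} {b} abx a≢v b≢v with a ≟ u
    ... | yes refl = b , (proj₁ (distinct H a b x abx) ∘ sym) , b≢v , abx
    ... | no  a≢u with b ≟ u
    ...   | yes refl = a , a≢u , a≢v , flip-tail H abx
    ...   | no  b≢u  = ⊥-elim (b≢v (tails-meet abx uvx a≢u a≢v b≢u))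
    triangle : ∃[ w ] (w ≢ u × w ≢ v × H ∋ v ∙ w ⟶ x) →
               ∃[ w ] (w ≢ u × w ≢ v × H ∋ u ∙ w ⟶ x) → tails H x ≤ 6
    triangle (w , w≢u , w≢v , vwx) (w′ , w′≢u , w′≢v , uw′x)
      with tails-meet vwx uw′x v≢u (w′≢v ∘ sym) w≢u
      where
      v≢u : v ≢ u
      v≢u = proj₁ (distinct H u v x uvx) ∘ sym
    -- Three tails, each in both orders, give the 6.
    ... | refl = tails≤ H pairs within
      where
      pairs = (u , v) ∷ (v , u) ∷ (v , w) ∷ (w , v) ∷ (u , w) ∷ (w , u) ∷ []
      ends : ∀ {a b} → H ∋ a ∙ b ⟶ x → Dec (a ≡ u) → Dec (a ≡ v) → Dec (a ≡ w) → (a , b) ∈ pairs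
      ends {a} {b} abx (yes refl) _ _ with b ≟ v
      ... | yes refl = here refl
      ... | no  b≢v  = there (there (there (there (here (cong (a ,_)
        (tails-meet abx vwx (proj₁ (distinct H u v x uvx)) (w≢u ∘ sym) b≢v))))))
      ends {a} {b} abx (no a≢u) (yes refl) _ with b ≟ u
      ... | yes refl = there (here refl)
      ... | no  b≢u  = there (there (here (cong (a ,_)
        (tails-meet abx uw′x a≢u (w≢v ∘ sym) b≢u))))
      ends {a} {b} abx (no a≢u) (no a≢v) (yes refl) with b ≟ u
      ... | yes refl = there (there (there (there (there (here refl)))))
      ... | no  b≢u  = there (there (there (here (cong (a ,_)
        (tails-meet abx uvx a≢u a≢v b≢u)))))
      -- A tail with one end off the triangle would have to meet all three sides with its other end
      -- alone.
      ends {a} {b} abx (no a≢u) (no a≢v) (no a≢w) with b ≟ u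
      ... | yes refl = ⊥-elim (w≢u (sym (tails-meet abx vwx a≢v a≢w λ { refl → proj₁ (distinct H u v x uvx) refl})))
      ... | no  b≢u  = ⊥-elim (w≢v (trans (sym (tails-meet abx uw′x a≢u a≢w b≢u)) (tails-meet abx uvx a≢u a≢v b≢u)))
      within : ∀ a b → H ∋ a ∙ b ⟶ x → (a , b) ∈ pairs
      within a b abx = ends abx (a ≟ u) (a ≟ v) (a ≟ w)

-- Missing pairs

module Missing {n} (H : Graph n) (f : Fin n → Fin n) where

  -- missing x b says that f x ∙ b ⟶ x could be an edge but is not.
  missing : Fin n → Fin n → Bool
  missing x b = not (does (b ≟ x)) ∧ (not (does (b ≟ f x)) ∧ not (edge H (f x) b x))

  μ : Fin n → Fin n → ℕ
  μ x b = 𝟙 (missing x b)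

  loss : Fin n → ℕ
  loss x = sum (μ x)

  missing-self : ∀ {x b} → b ≡ x → missing x b ≡ false
  missing-self {x} {b} b≡x rewrite dec-true (b ≟ x) b≡x = refl

  missing-centre : ∀ {x b} → b ≡ f x → missing x b ≡ false
  missing-centre {x} {b} b≡fx rewrite dec-true (b ≟ f x) b≡fx = Boolₚ.∧-zeroʳ (not (does (b ≟ x)))

  missing-edge : ∀ {x b} → b ≢ x → b ≢ f x → missing x b ≡ not (edge H (f x) b x)
  missing-edge {x} {b} b≢x b≢fx rewrite dec-false (b ≟ x) b≢x | dec-false (b ≟ f x) b≢fx = refl

  -- Each vertex `b` gives an edge, gives a missing pair, or is one of `x` and `f x`; the last two
  -- make the 2.
  row-total : ∀ x → f x ≢ x → sum (λ b → 𝟙 (edge H (f x) b x)) + loss x + 2 ≡ n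
  row-total x fx≢x = sym (begin
    n                                                       ≡⟨ trans (sum-const n 1) (*-identityʳ n) ⟨
    sum {n} (λ _ → 1)                                       ≡⟨ sum-cong slot ⟩
    sum (λ b → (e b + μ x b) + ([ b ≡ᶠ x ] + [ b ≡ᶠ f x ])) ≡⟨ trans (sum-+ _ _) (cong₂ _+_ (sum-+ e (μ x)) (sum-+ _ _)) ⟩
    (sum e + loss x) + (sum (λ b → [ b ≡ᶠ x ]) + sum λ b → [ b ≡ᶠ f x ])
      ≡⟨ cong (sum e + loss x +_) (cong₂ _+_ (sum-indicator x) (sum-indicator (f x))) ⟩
    sum e + loss x + 2 ∎)
    where
    open ≡-Reasoning
    e : Fin n → ℕ
    e b = 𝟙 (edge H (f x) b x)
    slot : ∀ b → 1 ≡ (e b + μ x b) + ([ b ≡ᶠ x ] + [ b ≡ᶠ f x ])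
    slot b = by-cases (b ≟ x) (b ≟ f x) refl
      where
      by-cases : (d : Dec (b ≡ x)) (d′ : Dec (b ≡ f x)) → ∀ {eb} → edge H (f x) b x ≡ eb →
        1 ≡ (𝟙 eb + 𝟙 (not (does d) ∧ (not (does d′) ∧ not eb))) + (𝟙 (does d) + 𝟙 (does d′))
      by-cases (yes refl) (yes b≡fb) _ = ⊥-elim (fx≢x (sym b≡fb))
      by-cases (yes refl) (no _) {true} eq = ⊥-elim (proj₂ (proj₂ (distinct H _ _ _ (subst T (sym eq) _))) refl)
      by-cases (yes refl) (no _) {false} eq = refl
      by-cases (no _) (yes refl) {true} eq = ⊥-elim (proj₁ (distinct H _ _ _ (subst T (sym eq) _)) refl)
      by-cases (no _) (yes refl) {false} eq = refl
      by-cases (no _) (no _) {true} eq = refl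
      by-cases (no _) (no _) {false} eq = refl

  tails-centre : ∀ x → Centre H (f x) x → tails H x ≡ 2 * sum (λ b → 𝟙 (edge H (f x) b x))
  tails-centre x (_ , star) = begin
    tails H x
      ≡⟨ sum₂-cong pointwise ⟩
    sum₂ (λ a b → [ a ≡ᶠ f x ] * e b + [ b ≡ᶠ f x ] * e a)
      ≡⟨ sum₂-+ _ _ ⟩
    sum₂ (λ a b → [ a ≡ᶠ f x ] * e b) + sum₂ (λ a b → [ b ≡ᶠ f x ] * e a)
      ≡⟨ cong₂ _+_ (trans (sum-cong λ a → sum-*ˡ [ a ≡ᶠ f x ] e) (sum-pick (f x) λ _ → sum e))
                   (sum-cong λ a → sum-pick (f x) λ _ → e a) ⟩
    sum e + sum e
      ≡⟨ cong (sum e +_) (+-identityʳ _) ⟨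
    2 * sum e ∎
    where
    open ≡-Reasoning
    e : Fin n → ℕ
    e b = 𝟙 (edge H (f x) b x)
    no-loop : edge H (f x) (f x) x ≡ false
    no-loop with edge H (f x) (f x) x in eq
    ... | false = refl
    ... | true  = ⊥-elim (proj₁ (distinct H _ _ _ (subst T (sym eq) _)) refl)
    pointwise : ∀ a b → 𝟙 (edge H a b x) ≡ [ a ≡ᶠ f x ] * e b + [ b ≡ᶠ f x ] * e a
    pointwise a b with a ≟ f x | b ≟ f x
    ... | yes refl | yes refl rewrite no-loop = refl
    ... | yes refl | no _     = sym (trans (+-identityʳ _) (+-identityʳ _))
    ... | no _     | yes refl = trans (cong 𝟙 (tail-sym H a b x)) (sym (+-identityʳ _))
    ... | no a≢fx  | no b≢fx  = 𝟙-false λ abx → case-⊎ (star a b abx)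
      where
      case-⊎ : a ≡ f x ⊎ b ≡ f x → ⊥
      case-⊎ (inj₁ p) = a≢fx p
      case-⊎ (inj₂ q) = b≢fx q

  -- Twice `row-total`, since each tail contains the centre exactly once and is counted in two
  -- orders. The sum form avoids truncated subtraction.
  tails-loss : ∀ x → Centre H (f x) x → tails H x + 4 + 2 * loss x ≡ 2 * n
  tails-loss x c@(fx≢x , _) = begin
    tails H x + 4 + 2 * loss x     ≡⟨ cong (λ t → t + 4 + 2 * loss x) (tails-centre x c) ⟩
    2 * E + 4 + 2 * loss x         ≡⟨ arith E (loss x) ⟩
    2 * (E + loss x + 2)           ≡⟨ cong (2 *_) (row-total x fx≢x) ⟩
    2 * n                          ∎
    where
    open ≡-Reasoning
    E = sum λ b → 𝟙 (edge H (f x) b x)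
    arith : ∀ e l → 2 * e + 4 + 2 * l ≡ 2 * (e + l + 2)
    arith = solve-∀

  edgeCount-loss : (∀ x → Centre H (f x) x) → edgeCount H + sum loss + 2 * n ≡ n * n
  edgeCount-loss star = *-cancelˡ-≡ _ _ 2 (begin
    2 * (edgeCount H + sum loss + 2 * n)
      ≡⟨ arith (edgeCount H) (sum loss) n ⟩
    (2 * edgeCount H + n * 4) + 2 * sum loss
      ≡⟨ cong₂ _+_ (cong₂ _+_ (2*edgeCount H) (sym (sum-const n 4))) (sym (sum-*ˡ 2 loss)) ⟩
    (sum (tails H) + sum {n} (λ _ → 4)) + sum (λ x → 2 * loss x)
      ≡⟨ trans (sum-+ _ _) (cong (_+ sum (λ x → 2 * loss x)) (sum-+ (tails H) _)) ⟨
    sum (λ x → tails H x + 4 + 2 * loss x)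
      ≡⟨ sum-cong (λ x → tails-loss x (star x)) ⟩
    sum {n} (λ _ → 2 * n)
      ≡⟨ trans (sum-const n _) (arith′ n) ⟩
    2 * (n * n) ∎)
    where
    open ≡-Reasoning
    arith : ∀ e l n → 2 * (e + l + 2 * n) ≡ (2 * e + n * 4) + 2 * l
    arith = solve-∀
    arith′ : ∀ n → n * (2 * n) ≡ 2 * (n * n)
    arith′ = solve-∀

  -- The common core of `same-centre`, `consecutive` and `two-cycle`: each supplies two possible
  -- edges on one and the same triple.
  contested : ∀ {x b y c} → b ≢ x → b ≢ f x → c ≢ y → c ≢ f y →
    ¬ (H ∋ f x ∙ b ⟶ x × H ∋ f y ∙ c ⟶ y) → 1 ≤ μ x b + μ y c
  contested {x} {b} {y} {c} b≢x b≢fx c≢y c≢fy conflict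
    rewrite missing-edge b≢x b≢fx | missing-edge c≢y c≢fy
    with edge H (f x) b x | edge H (f y) c y
  ... | true  | true  = ⊥-elim (conflict _)
  ... | true  | false = s≤s z≤n
  ... | false | true  = s≤s z≤n
  ... | false | false = s≤s z≤n

  module Contests (oriented : Oriented H) where

    same-centre : ∀ {x y} → f x ≢ x → f y ≢ y → f x ≡ f y → x ≢ y → 1 ≤ μ x y + μ y x
    same-centre {x} {y} fx≢x fy≢y fx≡fy x≢y =
      contested (x≢y ∘ sym) (λ y≡fx → fy≢y (trans (sym fx≡fy) (sym y≡fx))) x≢y
        (λ x≡fy → fx≢x (trans fx≡fy (sym x≡fy)))
        λ (p , q) → oriented (f x) y x (p , subst (λ z → H ∋ z ∙ x ⟶ y) (sym fx≡fy) q)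

    consecutive : ∀ {x} → f x ≢ x → f (f x) ≢ f x → f (f x) ≢ x → 1 ≤ μ x (f (f x)) + μ (f x) x
    consecutive {x} fx≢x ffx≢fx ffx≢x =
      contested ffx≢x ffx≢fx (fx≢x ∘ sym) (ffx≢x ∘ sym)
        λ (p , q) → oriented (f (f x)) x (f x) (q , flip-tail H p)

    two-cycle : ∀ {x b} → f (f x) ≡ x → b ≢ x → b ≢ f x → 1 ≤ μ x b + μ (f x) b
    two-cycle {x} {b} ffx≡x b≢x b≢fx =
      contested b≢x b≢fx b≢fx (λ b≡ffx → b≢x (trans b≡ffx ffx≡x))
        λ (p , q) → oriented b (f x) x (flip-tail H p , flip-tail H (subst (λ z → H ∋ z ∙ b ⟶ f x) ffx≡x q))

    -- Each of the n - 2 triples {x, f x, b} is contested by `x` and `f x`.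
    two-cycle-loss : ∀ {x} → f (f x) ≡ x → n ≤ loss x + loss (f x) + 2
    two-cycle-loss {x} ffx≡x = begin
      n                                                       ≡⟨ trans (sum-const n 1) (*-identityʳ n) ⟨
      sum {n} (λ _ → 1)                                       ≤⟨ sum-mono slot ⟩
      sum (λ b → (μ x b + μ (f x) b) + ([ b ≡ᶠ x ] + [ b ≡ᶠ f x ])) ≡⟨ trans (sum-+ _ _) (cong₂ _+_ (sum-+ (μ x) (μ (f x))) (sum-+ _ _)) ⟩
      (loss x + loss (f x)) + (sum (λ b → [ b ≡ᶠ x ]) + sum λ b → [ b ≡ᶠ f x ])
        ≡⟨ cong (loss x + loss (f x) +_) (cong₂ _+_ (sum-indicator x) (sum-indicator (f x))) ⟩
      loss x + loss (f x) + 2 ∎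
      where
      open ≤-Reasoning
      slot : ∀ b → 1 ≤ (μ x b + μ (f x) b) + ([ b ≡ᶠ x ] + [ b ≡ᶠ f x ])
      slot b = by-cases (b ≟ x) (b ≟ f x)
        where
        by-cases : (d : Dec (b ≡ x)) (d′ : Dec (b ≡ f x)) →
          1 ≤ (μ x b + μ (f x) b) + (𝟙 (does d) + 𝟙 (does d′))
        by-cases (yes _) _       = ≤-trans (s≤s z≤n) (m≤n+m _ (μ x b + μ (f x) b))
        by-cases (no _)  (yes _) = m≤n+m _ _
        by-cases (no p)  (no q)  = ≤-trans (two-cycle ffx≡x p q) (m≤m+n _ _)

-- Triangles and 2-cycles

indicator-split : ∀ {n} {P : Fin n → Set} (v : Fin n) →
  (P v) → (∀ x → x ≢ v → P x) → ∀ x → P x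
indicator-split v Pv P≢ x with x ≟ v
... | yes refl = Pv
... | no  x≢v  = P≢ x x≢v

module _ {n} {H : Graph n} (9≤n : 9 ≤ n) where

  -- A star without loss has n - 2 tails, so a row with at most 3 of them (6 when ordered) saves n -
  -- 5 edges. A loss of 4 in the other rows raises the saving to n - 1, and n(n - 2) - (n - 1) is
  -- the stated bound. The function `r` is either the true loss off `v` or a loss of 4 credited to a
  -- second low row.
  low-row : ∀ {v} (r : Fin n → ℕ) → tails H v ≤ 6 → r v ≡ 0 →
    (∀ x → x ≢ v → tails H x + 4 + 2 * r x ≤ 2 * n) → 4 ≤ sum r →
    edgeCount H + 3 * n ≤ n * n + 1
  low-row {v} r few rv≡0 rows 4≤R = *-cancelˡ-≤ 2 (by-identity 0
    (+-mono-≤ total (*-monoʳ-≤ 2 4≤R)) (arith (edgeCount H) n (sum r)))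
    where
    arith : ∀ e n R → 2 * (e + 3 * n) + (n * (2 * n) + 10 + 2 * R) + 0 ≡
                      2 * (n * n + 1) + (2 * e + n * 4 + 2 * R + 2 * n + 2 * 4)
    arith = solve-∀
    pointwise : ∀ x → tails H x + 4 + 2 * r x + [ x ≡ᶠ v ] * (2 * n) ≤ 2 * n + [ x ≡ᶠ v ] * 10
    pointwise = indicator-split v
      (begin
        tails H v + 4 + 2 * r v + [ v ≡ᶠ v ] * (2 * n)
          ≡⟨ cong₂ (λ i j → tails H v + 4 + 2 * i + j * (2 * n)) rv≡0 (≡ᶠ-refl v) ⟩
        tails H v + 4 + 0 + 1 * (2 * n)
          ≤⟨ by-identity 0 few (arith′ (tails H v) n) ⟩
        2 * n + 1 * 10
          ≡⟨ cong (λ j → 2 * n + j * 10) (≡ᶠ-refl v) ⟨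
        2 * n + [ v ≡ᶠ v ] * 10 ∎)
      (λ x x≢v → subst (λ i → tails H x + 4 + 2 * r x + i * (2 * n) ≤ 2 * n + i * 10)
        (sym (≡ᶠ-≢ x≢v)) (+-monoˡ-≤ 0 (rows x x≢v)))
      where
      open ≤-Reasoning
      arith′ : ∀ t n → t + 4 + 0 + 1 * (2 * n) + 6 + 0 ≡ 2 * n + 1 * 10 + t
      arith′ = solve-∀
    total : 2 * edgeCount H + n * 4 + 2 * sum r + 2 * n ≤ n * (2 * n) + 10
    total = begin
      2 * edgeCount H + n * 4 + 2 * sum r + 2 * n
        ≡⟨ cong₂ _+_ (cong₂ _+_ (cong₂ _+_ (2*edgeCount H) (sym (sum-const n 4))) (sym (sum-*ˡ 2 r)))
                     (sym (sum-pick v λ _ → 2 * n)) ⟩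
      sum (tails H) + sum {n} (λ _ → 4) + sum (λ x → 2 * r x) + sum (λ x → [ x ≡ᶠ v ] * (2 * n))
        ≡⟨ trans (sum-+ (λ x → tails H x + 4 + 2 * r x) _) (cong (_+ sum (λ x → [ x ≡ᶠ v ] * (2 * n)))
             (trans (sum-+ (λ x → tails H x + 4) _) (cong (_+ sum (λ x → 2 * r x)) (sum-+ (tails H) _)))) ⟨
      sum (λ x → tails H x + 4 + 2 * r x + [ x ≡ᶠ v ] * (2 * n))
        ≤⟨ sum-mono pointwise ⟩
      sum (λ x → 2 * n + [ x ≡ᶠ v ] * 10)
        ≡⟨ trans (sum-+ {n} (λ _ → 2 * n) _) (cong₂ _+_ (sum-const n (2 * n)) (sum-pick v λ _ → 10)) ⟩
      n * (2 * n) + 10 ∎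
      where open ≤-Reasoning

  18≤2n : 18 ≤ 2 * n
  18≤2n = *-monoʳ-≤ 2 9≤n

-- Every vertex other than v and y₀ accounts for a triple that two rows other
-- than v contest; a missing pair is charged at most twice.
module Discount {n} (H : Graph n) (oriented : Oriented H) (9≤n : 9 ≤ n)
         (f : Fin n → Fin n) (v : Fin n) (star : ∀ x → x ≢ v → Centre H (f x) x) where

  open Missing H f
  open Contests oriented

  private
    off : Fin n → ℕ
    off x = 𝟙 (not (does (x ≟ v)))

    off-≢ : ∀ {x} → x ≢ v → off x ≡ 1
    off-≢ {x} x≢v = cong (𝟙 ∘ not) (dec-false (x ≟ v) x≢v)

  loss-off : Fin n → ℕ
  loss-off x = off x * loss x

  loss-off-at : loss-off v ≡ 0
  loss-off-at = cong (λ b → 𝟙 (not b) * loss v) (dec-true (v ≟ v) refl)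

  loss-off-≢ : ∀ {x} → x ≢ v → loss-off x ≡ loss x
  loss-off-≢ {x} x≢v = trans (cong (_* loss x) (off-≢ x≢v)) (+-identityʳ (loss x))

  private
    R = sum loss-off

    two-cycle-case : ∀ {x} → x ≢ v → f x ≢ v → f (f x) ≡ x → 4 ≤ R
    two-cycle-case {x} x≢v fx≢v ffx≡x = +-cancelʳ-≤ 2 _ _ (begin
      6                             ≤⟨ ≤-trans (s≤s (s≤s (s≤s (s≤s (s≤s (s≤s z≤n)))))) 9≤n ⟩
      n                             ≤⟨ two-cycle-loss ffx≡x ⟩
      loss x + loss (f x) + 2       ≡⟨ cong (_+ 2) (cong₂ _+_ (sum-pick x loss) (sum-pick (f x) loss)) ⟨
      sum (λ i → [ i ≡ᶠ x ] * loss i) + sum (λ i → [ i ≡ᶠ f x ] * loss i) + 2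
                                    ≡⟨ cong (_+ 2) (sum-+ _ _) ⟨
      sum (λ i → [ i ≡ᶠ x ] * loss i + [ i ≡ᶠ f x ] * loss i) + 2
                                    ≤⟨ +-monoˡ-≤ 2 (sum-mono pointwise) ⟩
      R + 2                         ∎)
      where
      open ≤-Reasoning
      pointwise : ∀ i → [ i ≡ᶠ x ] * loss i + [ i ≡ᶠ f x ] * loss i ≤ loss-off i
      pointwise i with i ≟ x | i ≟ f x
      ... | yes refl | yes x≡fx = ⊥-elim (proj₁ (star x x≢v) (sym x≡fx))
      ... | yes refl | no _     rewrite off-≢ x≢v = ≤-reflexive (+-identityʳ _)
      ... | no _     | yes refl rewrite off-≢ fx≢v = ≤-refl
      ... | no _     | no _     = z≤n

    module _ (no-two-cycle : ¬ (∃[ x ] (x ≢ v × f x ≢ v × f (f x) ≡ x)))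
             {y₀} (y₀≢v : y₀ ≢ v) (into-v : ∀ {x} → x ≢ v → f x ≡ v → f y₀ ≡ v) where

      first second : Fin n → Fin n
      first  x = if does (f x ≟ v) then y₀ else f (f x)
      second x = if does (f x ≟ v) then y₀ else f x

      a b : Fin n → ℕ
      a x = off x * μ x (first x)
      b x = off (second x) * μ (second x) x

      charge : ∀ x → 1 ≤ [ x ≡ᶠ v ] + [ x ≡ᶠ y₀ ] + (a x + b x)
      charge x = by-cases (x ≟ v) (x ≟ y₀) refl refl
        where
        contest : x ≢ v → x ≢ y₀ → 1 ≤ a x + b x
        contest x≢v x≢y₀ with f x ≟ v
        ... | yes fx≡v rewrite off-≢ x≢v | off-≢ y₀≢v
              | +-identityʳ (μ x y₀) | +-identityʳ (μ y₀ x) =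
                same-centre (proj₁ (star x x≢v)) (proj₁ (star y₀ y₀≢v))
                  (trans fx≡v (sym (into-v x≢v fx≡v))) x≢y₀
        ... | no  fx≢v rewrite off-≢ x≢v | off-≢ fx≢v
              | +-identityʳ (μ x (f (f x))) | +-identityʳ (μ (f x) x) =
                consecutive (proj₁ (star x x≢v)) (proj₁ (star (f x) fx≢v))
                  (λ ffx≡x → no-two-cycle (x , x≢v , fx≢v , ffx≡x))
        by-cases : ∀ {i j} → Dec (x ≡ v) → Dec (x ≡ y₀) → [ x ≡ᶠ v ] ≡ i → [ x ≡ᶠ y₀ ] ≡ j →
          1 ≤ i + j + (a x + b x)
        by-cases (yes refl) _ eq _ rewrite trans (sym eq) (≡ᶠ-refl x) = s≤s z≤n
        by-cases {i} (no _) (yes refl) _ eq rewrite trans (sym eq) (≡ᶠ-refl x) =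
          ≤-trans (m≤n+m 1 i) (m≤m+n (i + 1) _)
        by-cases {i} {j} (no x≢v) (no x≢y₀) _ _ = ≤-trans (contest x≢v x≢y₀) (m≤n+m _ (i + j))

      -- `a` charges at most one pair in each row and `b` at most one in each column, so each of the
      -- two sums is at most `R`.
      Σa≤R : sum a ≤ R
      Σa≤R = sum-mono λ x → *-monoʳ-≤ (off x) (term≤sum (μ x) (first x))

      Σb≤R : sum b ≤ R
      Σb≤R = begin
        sum b                                 ≤⟨ sum-mono (λ x → term≤sum (λ y → off y * μ y x) (second x)) ⟩
        sum (λ x → sum λ y → off y * μ y x)   ≡⟨ sum-swap (λ x y → off y * μ y x) ⟩
        sum (λ y → sum λ x → off y * μ y x)   ≡⟨ sum-cong (λ y → sum-*ˡ (off y) (μ y)) ⟩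
        R ∎
        where open ≤-Reasoning

      charge-case : 4 ≤ R
      -- From 9 ≤ n ≤ 2 + 2R it follows that 2R ≥ 7, hence R > 3.
      charge-case = *-cancelˡ-< 2 3 R (+-cancelˡ-≤ 2 _ _ (begin
        9                                 ≤⟨ 9≤n ⟩
        n                                 ≡⟨ trans (sum-const n 1) (*-identityʳ n) ⟨
        sum {n} (λ _ → 1)                 ≤⟨ sum-mono charge ⟩
        sum (λ x → [ x ≡ᶠ v ] + [ x ≡ᶠ y₀ ] + (a x + b x))
                                          ≡⟨ trans (sum-+ _ _) (cong₂ _+_ (sum-+ _ _) (sum-+ a b)) ⟩
        sum (λ x → [ x ≡ᶠ v ]) + sum (λ x → [ x ≡ᶠ y₀ ]) + (sum a + sum b)
                                          ≡⟨ cong (_+ (sum a + sum b)) (cong₂ _+_ (sum-indicator v) (sum-indicator y₀)) ⟩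
        2 + (sum a + sum b)               ≤⟨ +-monoʳ-≤ 2 (+-mono-≤ Σa≤R Σb≤R) ⟩
        2 + (R + R)                       ≡⟨ cong (λ t → 2 + (R + t)) (+-identityʳ R) ⟨
        2 + 2 * R ∎))
        where open ≤-Reasoning

  4≤loss-off : 4 ≤ R
  4≤loss-off with any? (λ x → ¬? (x ≟ v) ×-dec (¬? (f x ≟ v) ×-dec (f (f x) ≟ x)))
  ... | yes (x , x≢v , fx≢v , ffx≡x) = two-cycle-case x≢v fx≢v ffx≡x
  ... | no  none with any? (λ y → ¬? (y ≟ v) ×-dec (f y ≟ v))
  ...   | yes (y₀ , y₀≢v , fy₀≡v) = charge-case none y₀≢v (λ _ _ → fy₀≡v)
  -- No vertex other than `v` has centre `v`, so any `y₀` other than `v` will do: the condition on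
  -- it is vacuous.
  ...   | no  none′ = let y₀ , y₀∉ = fresh (v ∷ []) (≤-trans (s≤s (s≤s z≤n)) 9≤n) in
    charge-case none {y₀} (y₀∉ ∘ here) λ {x} x≢v fx≡v → ⊥-elim (none′ (x , x≢v , fx≡v))

module _ {n} {H : Graph n} (oriented : Oriented H) (free : Free I₀ H) (9≤n : 9 ≤ n) where

  private
    2≤n : 2 ≤ n
    2≤n = ≤-trans (s≤s (s≤s z≤n)) 9≤n

    tails+4≤ : ∀ x → tails H x + 4 ≤ 2 * n
    tails+4≤ x with star-or-few {H = H} free 2≤n x
    ... | inj₂ few = ≤-trans (+-monoˡ-≤ 4 few) (≤-trans (m≤m+n 10 8) (18≤2n {H = H} 9≤n))
    ... | inj₁ (z , c) = subst (tails H x + 4 ≤_) (Missing.tails-loss H (λ _ → z) x c) (m≤m+n _ _)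

  few-tails : ∀ v → tails H v ≤ 6 → edgeCount H + 3 * n ≤ n * n + 1
  few-tails v few with any? (λ x → ¬? (x ≟ v) ×-dec (tails H x ≤? 6))
  -- A second low row can be credited with a loss of 4, because 6 + 4 + 2 · 4 = 18 ≤ 2n.
  ... | yes (x₀ , x₀≢v , few₀) = low-row {H = H} 9≤n (λ x → [ x ≡ᶠ x₀ ] * 4) few
    (cong (_* 4) (≡ᶠ-≢ (x₀≢v ∘ sym))) (λ x _ → row x) (≤-reflexive (sym (sum-pick x₀ λ _ → 4)))
    where
    row : ∀ x → tails H x + 4 + 2 * ([ x ≡ᶠ x₀ ] * 4) ≤ 2 * n
    row x with x ≟ x₀
    ... | yes refl = ≤-trans (+-monoˡ-≤ 8 (+-monoˡ-≤ 4 few₀)) (18≤2n {H = H} 9≤n)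
    ... | no  _    = subst (_≤ 2 * n) (sym (+-identityʳ _)) (tails+4≤ x)
  ... | no none = low-row {H = H} 9≤n D.loss-off few D.loss-off-at row D.4≤loss-off
    where
    -- The default value `x` can occur only at `v`, every other row being a star in this case.
    f : Fin n → Fin n
    f x with star-or-few {H = H} free 2≤n x
    ... | inj₁ (z , _) = z
    ... | inj₂ _       = x
    star : ∀ x → x ≢ v → Centre H (f x) x
    star x x≢v with star-or-few {H = H} free 2≤n x
    ... | inj₁ (_ , c) = c
    ... | inj₂ few′    = ⊥-elim (none (x , x≢v , few′))
    module D = Discount H oriented 9≤n f v star
    row : ∀ x → x ≢ v → tails H x + 4 + 2 * D.loss-off x ≤ 2 * n
    row x x≢v = ≤-reflexive (trans
      (cong (λ t → tails H x + 4 + 2 * t) (D.loss-off-≢ x≢v))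
      (Missing.tails-loss H f x (star x x≢v)))

  module _ {f : Fin n → Fin n} (star : ∀ x → Centre H (f x) x) where

    open Missing H f
    open Contests oriented

    private
      third-loss : ∀ {v z} → z ≢ v → z ≢ f v → v ≢ f v → 1 ≤ loss z → loss v + loss (f v) + 1 ≤ sum loss
      third-loss {v} {z} z≢v z≢fv v≢fv 1≤loss = begin
        loss v + loss (f v) + 1
          ≡⟨ cong₂ _+_ (cong₂ _+_ (sum-pick v loss) (sum-pick (f v) loss)) (sum-pick z λ _ → 1) ⟨
        sum (λ i → [ i ≡ᶠ v ] * loss i) + sum (λ i → [ i ≡ᶠ f v ] * loss i) + sum (λ i → [ i ≡ᶠ z ] * 1)
          ≡⟨ trans (sum-+ _ _) (cong (_+ sum (λ i → [ i ≡ᶠ z ] * 1)) (sum-+ _ _)) ⟨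
        sum (λ i → [ i ≡ᶠ v ] * loss i + [ i ≡ᶠ f v ] * loss i + [ i ≡ᶠ z ] * 1)
          ≤⟨ sum-mono pointwise ⟩
        sum loss ∎
        where
        open ≤-Reasoning
        pointwise : ∀ i → [ i ≡ᶠ v ] * loss i + [ i ≡ᶠ f v ] * loss i + [ i ≡ᶠ z ] * 1 ≤ loss i
        pointwise i with i ≟ v | i ≟ f v | i ≟ z
        ... | yes refl | yes p    | _        = ⊥-elim (v≢fv p)
        ... | yes refl | no _     | yes refl = ⊥-elim (z≢v refl)
        ... | yes refl | no _     | no _     = ≤-reflexive (trans (+-identityʳ _) (trans (+-identityʳ _) (+-identityʳ _)))
        ... | no _     | yes refl | yes refl = ⊥-elim (z≢fv refl)
        ... | no _     | yes refl | no _     = ≤-reflexive (trans (+-identityʳ _) (+-identityʳ _))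
        ... | no _     | no _     | yes refl = 1≤loss
        ... | no _     | no _     | no _     = z≤n

      -- If the other rows lost nothing, f would map the other vertices
      -- injectively into {v, f v}.
      some-loss : ∀ {v} → f (f v) ≡ v → ¬ (∀ z → z ≢ v → z ≢ f v → loss z ≡ 0)
      some-loss {v} ffv≡v lossless with fresh (v ∷ f v ∷ []) (≤-trans (m≤m+n 3 6) 9≤n)
      ... | z₁ , z₁∉ with fresh (z₁ ∷ v ∷ f v ∷ []) (≤-trans (m≤m+n 4 5) 9≤n)
      ...   | z₂ , z₂∉ with fresh (z₂ ∷ z₁ ∷ v ∷ f v ∷ []) (≤-trans (m≤m+n 5 4) 9≤n)
      ...     | z₃ , z₃∉ = pigeons (into z₁ (z₁∉ ∘ here) (z₁∉ ∘ there ∘ here))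
                                   (into z₂ z₂≢v z₂≢fv) (into z₃ z₃≢v z₃≢fv)
        where
        z₂≢v  = z₂∉ ∘ there ∘ here
        z₂≢fv = z₂∉ ∘ there ∘ there ∘ here
        z₃≢v  = z₃∉ ∘ there ∘ there ∘ here
        z₃≢fv = z₃∉ ∘ there ∘ there ∘ there ∘ here
        μ≡0 : ∀ {z} b → z ≢ v → z ≢ f v → μ z b ≡ 0
        μ≡0 {z} b z≢v z≢fv = n≤0⇒n≡0 (subst (μ z b ≤_) (lossless z z≢v z≢fv) (term≤sum (μ z) b))
        lossless-pair : ∀ {z w} b c → z ≢ v → z ≢ f v → w ≢ v → w ≢ f v → ¬ (1 ≤ μ z b + μ w c)
        lossless-pair b c p q r s 1≤ =
          1+n≰n (subst (1 ≤_) (cong₂ _+_ (μ≡0 b p q) (μ≡0 c r s)) 1≤)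
        into : ∀ z → z ≢ v → z ≢ f v → f z ≡ v ⊎ f z ≡ f v
        into z z≢v z≢fv with f z ≟ v | f z ≟ f v
        ... | yes p | _     = inj₁ p
        ... | no _  | yes q = inj₂ q
        ... | no p  | no q  with f (f z) ≟ z
        ...   | yes ffz≡z = ⊥-elim (lossless-pair v v z≢v z≢fv p q (two-cycle {b = v} ffz≡z (z≢v ∘ sym) (p ∘ sym)))
        ...   | no  ffz≢z = ⊥-elim (lossless-pair (f (f z)) z z≢v z≢fv p q
                (consecutive (proj₁ (star z)) (proj₁ (star (f z))) ffz≢z))
        clash : ∀ {z w} → z ≢ v → z ≢ f v → w ≢ v → w ≢ f v → f z ≡ f w → z ≢ w → ⊥
        clash {z} {w} p q r s fz≡fw z≢w =
          lossless-pair w z p q r s (same-centre (proj₁ (star z)) (proj₁ (star w)) fz≡fw z≢w)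
        pigeons : f z₁ ≡ v ⊎ f z₁ ≡ f v → f z₂ ≡ v ⊎ f z₂ ≡ f v → f z₃ ≡ v ⊎ f z₃ ≡ f v → ⊥
        pigeons (inj₁ p) (inj₁ q) _ = clash z₂≢v z₂≢fv (z₁∉ ∘ here) (z₁∉ ∘ there ∘ here) (trans q (sym p)) (z₂∉ ∘ here)
        pigeons (inj₂ p) (inj₂ q) _ = clash z₂≢v z₂≢fv (z₁∉ ∘ here) (z₁∉ ∘ there ∘ here) (trans q (sym p)) (z₂∉ ∘ here)
        pigeons (inj₁ p) _ (inj₁ q) = clash z₃≢v z₃≢fv (z₁∉ ∘ here) (z₁∉ ∘ there ∘ here) (trans q (sym p)) (z₃∉ ∘ there ∘ here)
        pigeons (inj₂ p) _ (inj₂ q) = clash z₃≢v z₃≢fv (z₁∉ ∘ here) (z₁∉ ∘ there ∘ here) (trans q (sym p)) (z₃∉ ∘ there ∘ here)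
        pigeons _ (inj₁ p) (inj₁ q) = clash z₃≢v z₃≢fv z₂≢v z₂≢fv (trans q (sym p)) (z₃∉ ∘ here)
        pigeons _ (inj₂ p) (inj₂ q) = clash z₃≢v z₃≢fv z₂≢v z₂≢fv (trans q (sym p)) (z₃∉ ∘ here)

    -- The 2-cycle itself costs n - 2, and some third row must lose one pair more. This last unit
    -- matters: n - 2 alone would allow n(n - 3) + 2 edges, which is the extremal value for n = 10
    -- and n = 11.
    two-cycle-bound : ∀ v → f (f v) ≡ v → edgeCount H + 3 * n ≤ n * n + 1
    two-cycle-bound v ffv≡v = subst (λ m → edgeCount H + 3 * n ≤ m + 1) (edgeCount-loss star)
      (by-identity 0 (+-mono-≤ (two-cycle-loss ffv≡v) extra)
        (arith (edgeCount H) n (sum loss) (loss v) (loss (f v))))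
      where
      arith : ∀ e n L a b → e + 3 * n + (a + b + 2 + L) + 0 ≡ e + L + 2 * n + 1 + (n + (a + b + 1))
      arith = solve-∀
      extra : loss v + loss (f v) + 1 ≤ sum loss
      extra with any? (λ z → ¬? (z ≟ v) ×-dec (¬? (z ≟ f v) ×-dec (1 ≤? loss z)))
      ... | yes (z , z≢v , z≢fv , 1≤loss) = third-loss z≢v z≢fv (proj₁ (star v) ∘ sym) 1≤loss
      ... | no  none = ⊥-elim (some-loss ffv≡v λ z z≢v z≢fv →
              n≤0⇒n≡0 (≤-pred (≰⇒> λ 1≤loss → none (z , z≢v , z≢fv , 1≤loss))))

-- Charging missing pairs to vertices

private
  lt : ∀ {n} → Fin n → Fin n → Bool
  lt i j = does (i Fin.<? j)

  lt-cases : ∀ {n} {i j : Fin n} → i ≢ j →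
    (i Fin.< j × lt i j ≡ true × lt j i ≡ false) ⊎ (j Fin.< i × lt i j ≡ false × lt j i ≡ true)
  lt-cases {i = i} {j} i≢j with Finₚ.<-cmp i j
  ... | tri< i<j _ j≮i = inj₁ (i<j , dec-true (i Fin.<? j) i<j , dec-false (j Fin.<? i) j≮i)
  ... | tri≈ _ i≡j _   = ⊥-elim (i≢j i≡j)
  ... | tri> i≮j _ j<i = inj₂ (j<i , dec-false (i Fin.<? j) i≮j , dec-true (j Fin.<? i) j<i)

  one-minimum : ∀ {n} {i j k : Fin n} → i ≢ j → j ≢ k → k ≢ i →
    𝟙 (lt i j ∧ lt i k) + 𝟙 (lt j k ∧ lt j i) + 𝟙 (lt k i ∧ lt k j) ≡ 1
  one-minimum i≢j j≢k k≢i with lt-cases i≢j | lt-cases j≢k | lt-cases k≢i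
  ... | inj₁ (p , a , b) | inj₁ (q , c , d) | inj₁ (r , e , g) = ⊥-elim (<-asym (<-trans p q) r)
  ... | inj₁ (p , a , b) | inj₁ (q , c , d) | inj₂ (r , e , g) rewrite a | b | c | d | e | g = refl
  ... | inj₁ (p , a , b) | inj₂ (q , c , d) | inj₁ (r , e , g) rewrite a | b | c | d | e | g = refl
  ... | inj₁ (p , a , b) | inj₂ (q , c , d) | inj₂ (r , e , g) rewrite a | b | c | d | e | g = refl
  ... | inj₂ (p , a , b) | inj₁ (q , c , d) | inj₁ (r , e , g) rewrite a | b | c | d | e = refl
  ... | inj₂ (p , a , b) | inj₁ (q , c , d) | inj₂ (r , e , g) rewrite a | b | c | d | e = refl
  ... | inj₂ (p , a , b) | inj₂ (q , c , d) | inj₁ (r , e , g) rewrite a | b | c | d | e = refl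
  ... | inj₂ (p , a , b) | inj₂ (q , c , d) | inj₂ (r , e , g) = ⊥-elim (<-asym (<-trans q p) r)

  two-of-three : ∀ a b c → 1 ≤ 𝟙 a + 𝟙 b → 1 ≤ 𝟙 b + 𝟙 c → 1 ≤ 𝟙 c + 𝟙 a → 2 ≤ 𝟙 a + 𝟙 b + 𝟙 c
  two-of-three true  true  _     _ _ _ = s≤s (s≤s z≤n)
  two-of-three true  false true  _ _ _ = s≤s (s≤s z≤n)
  two-of-three true  false false _ () _
  two-of-three false true  true  _ _ _ = s≤s (s≤s z≤n)
  two-of-three false true  false _ _ ()
  two-of-three false false _     () _ _

module Cycles {n} (f : Fin n → Fin n) where

  -- Once `f` has no fixed point, this says that `x` lies on a 3-cycle, 3 being prime.
  Cyclic : Fin n → Set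
  Cyclic x = f (f (f x)) ≡ x

  cyclic? : ∀ x → Dec (Cyclic x)
  cyclic? x = f (f (f x)) ≟ x

  C S : Fin n → Bool
  C x = does (cyclic? x)
  S x = not (C x)

  #S : ℕ
  #S = sum (𝟙 ∘ S)

  #C : ℕ
  #C = sum (𝟙 ∘ C)

  ⇒C : ∀ {x} → Cyclic x → C x ≡ true
  ⇒C {x} = dec-true (cyclic? x)

  S⇒ : ∀ {x} → T (S x) → ¬ Cyclic x
  S⇒ {x} t with no p ← cyclic? x = p

  ⇒S : ∀ {x} → ¬ Cyclic x → T (S x)
  ⇒S {x} ¬c rewrite dec-false (cyclic? x) ¬c = _

  #C+#S : #C + #S ≡ n
  #C+#S = trans (sym (sum-+ (𝟙 ∘ C) (𝟙 ∘ S)))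
    (trans (sum-cong λ x → one (C x)) (trans (sum-const n 1) (*-identityʳ n)))
    where
    one : ∀ c → 𝟙 c + 𝟙 (not c) ≡ 1
    one true  = refl
    one false = refl

  cyclic-f : ∀ {x} → Cyclic x → Cyclic (f x)
  cyclic-f = cong f

  private
    -- `f` need not be a bijection, but on the cyclic vertices it is one; completed by the identity
    -- it becomes a permutation of all vertices, to which `sum-permute` applies.
    step back : Fin n → Fin n
    step x = if C x then f x else x
    back x = if C x then f (f x) else x

    step-cyclic : ∀ {x} → Cyclic x → step x ≡ f x
    step-cyclic c rewrite ⇒C c = refl

    step∘back : ∀ x → step (back x) ≡ x
    step∘back x with cyclic? x
    ... | yes c = trans (step-cyclic (cyclic-f (cyclic-f c))) c
    ... | no ¬c = cong (λ b → if b then f x else x) (dec-false (cyclic? x) ¬c)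

    back∘step : ∀ x → back (step x) ≡ x
    back∘step x with cyclic? x
    ... | yes c = trans (cong (λ b → if b then f (f (f x)) else f x) (⇒C (cyclic-f c))) c
    ... | no ¬c = cong (λ b → if b then f (f x) else x) (dec-false (cyclic? x) ¬c)

  rotate : ∀ (g : Fin n → ℕ) → sum (λ x → 𝟙 (C x) * g (f x)) ≡ sum (λ x → 𝟙 (C x) * g x)
  rotate g = sym (trans
    (sum-permute (λ x → 𝟙 (C x) * g x) (permutation step back step∘back back∘step))
    (sum-cong pointwise))
    where
    pointwise : ∀ x → 𝟙 (C (step x)) * g (step x) ≡ 𝟙 (C x) * g (f x)
    pointwise x with cyclic? x
    ... | yes c = cong (λ b → 𝟙 b * g (f x)) (⇒C (cyclic-f c))
    ... | no ¬c = cong (λ b → 𝟙 b * g x) (dec-false (cyclic? x) ¬c)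

  sum-cycles : ∀ (g : Fin n → ℕ) → sum (λ x → 𝟙 (C x) * (g x + g (f x) + g (f (f x)))) ≡ 3 * sum (λ x → 𝟙 (C x) * g x)
  sum-cycles g = begin
    sum (λ x → 𝟙 (C x) * (g x + g (f x) + g (f (f x))))
      ≡⟨ sum-cong (λ x → trans (*-distribˡ-+ (𝟙 (C x)) _ _) (cong (_+ c₂ x) (*-distribˡ-+ (𝟙 (C x)) _ _))) ⟩
    sum (λ x → c₀ x + c₁ x + c₂ x)
      ≡⟨ trans (sum-+ _ c₂) (cong (_+ sum c₂) (sum-+ c₀ c₁)) ⟩
    sum c₀ + sum c₁ + sum c₂
      ≡⟨ cong₂ (λ u v → sum c₀ + u + v) (rotate g) (trans (rotate (g ∘ f)) (rotate g)) ⟩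
    sum c₀ + sum c₀ + sum c₀
      ≡⟨ arith (sum c₀) ⟩
    3 * sum c₀ ∎
    where
    open ≡-Reasoning
    c₀ c₁ c₂ : Fin n → ℕ
    c₀ x = 𝟙 (C x) * g x
    c₁ x = 𝟙 (C x) * g (f x)
    c₂ x = 𝟙 (C x) * g (f (f x))
    arith : ∀ s → s + s + s ≡ 3 * s
    arith = solve-∀

  module _ (no-fix : ∀ x → f x ≢ x) where

    -- The quotient counts the 3-cycles by their least vertices.
    3∣#C : ∃[ c ] #C ≡ c * 3
    3∣#C = sum (λ x → 𝟙 (C x) * 𝟙 (least x)) , trans (sum-cong pointwise) (trans (sum-cycles (𝟙 ∘ least)) (*-comm 3 (sum (λ x → 𝟙 (C x) * 𝟙 (least x)))))
      where
      least : Fin n → Bool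
      least x = lt x (f x) ∧ lt x (f (f x))
      pointwise : ∀ x → 𝟙 (C x) ≡ 𝟙 (C x) * (𝟙 (least x) + 𝟙 (least (f x)) + 𝟙 (least (f (f x))))
      pointwise x with cyclic? x
      ... | no  _ = refl
      ... | yes c rewrite c = sym (trans (+-identityʳ _)
        (one-minimum (no-fix x ∘ sym) (no-fix (f x) ∘ sym) (λ ffx≡x → no-fix x (trans (cong f (sym ffx≡x)) c))))

    #S%3 : #S % 3 ≡ n % 3
    #S%3 with 3∣#C
    ... | c , #C≡ = begin
      #S % 3              ≡⟨ [m+kn]%n≡m%n #S c 3 ⟨
      (#S + c * 3) % 3    ≡⟨ cong (_% 3) (trans (+-comm #S _) (trans (cong (_+ #S) (sym #C≡)) #C+#S)) ⟩
      n % 3               ∎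
      where open ≡-Reasoning

module Charging {n} (H : Graph n) (oriented : Oriented H) (f : Fin n → Fin n)
                (star : ∀ x → Centre H (f x) x) (no2 : ∀ x → f (f x) ≢ x) where

  open Missing H f
  open Contests oriented
  open Cycles f

  no-fix : ∀ x → f x ≢ x
  no-fix x = proj₁ (star x)

  -- The triple {x, f x, f (f x)} is contested by x and by f x.
  α β : Fin n → ℕ
  α x = μ x (f (f x))
  β x = μ (f x) x

  chargeable : Fin n → Fin n → Bool
  chargeable x b = does (b ≟ f (f x)) ∨ (does (x ≟ f b) ∧ S b)

  -- The missing pairs that α and β do not count; those at b on a 3-cycle are
  -- dropped from β, since there β b = α (f b).
  γ : Fin n → Fin n → ℕ
  γ x b = if chargeable x b then 0 else μ x b

  Γ : ℕ
  Γ = sum₂ γ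

  private
    pad : ∀ m → m + 0 + 0 + 0 ≡ m
    pad = solve-∀

  -- Nothing is counted twice: if both `b ≡ f (f x)` and `x ≡ f b`, then `b` is cyclic and the
  -- factor `𝟙 (S b)` vanishes.
  μ-split : ∀ x b → μ x b ≡ [ b ≡ᶠ f (f x) ] * μ x b + 𝟙 (S b) * ([ x ≡ᶠ f b ] * μ x b) + γ x b
  μ-split x b with b ≟ f (f x) | x ≟ f b
  ... | yes b≡ffx | yes x≡fb
      rewrite ⇒C {b} (trans (cong (f ∘ f) (sym x≡fb)) (sym b≡ffx)) = sym (pad (μ x b))
  ... | yes _ | no _ with S b
  ...   | true  = sym (pad (μ x b))
  ...   | false = sym (pad (μ x b))
  μ-split x b | no _ | yes _ with S b
  ...   | true  = sym (pad (μ x b))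
  ...   | false = refl
  μ-split x b | no _ | no _ with S b
  ...   | true  = refl
  ...   | false = refl

  loss-split : sum loss ≡ sum α + sum (λ b → 𝟙 (S b) * β b) + Γ
  loss-split = begin
    sum₂ μ
      ≡⟨ sum₂-cong μ-split ⟩
    sum₂ (λ x b → A x b + B x b + γ x b)
      ≡⟨ trans (sum₂-+ _ γ) (cong (_+ Γ) (sum₂-+ A B)) ⟩
    sum₂ A + sum₂ B + Γ
      ≡⟨ cong₂ (λ a b → a + b + Γ) (sum-cong λ x → sum-pick (f (f x)) (μ x))
           (trans (sum-swap B) (sum-cong λ b →
             trans (sum-*ˡ (𝟙 (S b)) _) (cong (𝟙 (S b) *_) (sum-pick (f b) λ x → μ x b)))) ⟩
    sum α + sum (λ b → 𝟙 (S b) * β b) + Γ ∎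
    where
    open ≡-Reasoning
    A B : Fin n → Fin n → ℕ
    A x b = [ b ≡ᶠ f (f x) ] * μ x b
    B x b = 𝟙 (S b) * ([ x ≡ᶠ f b ] * μ x b)

  -- 3 * loss is spread evenly over the vertices of each 3-cycle.
  ψ floor : Fin n → ℕ
  ψ x = 𝟙 (C x) * (α x + α (f x) + α (f (f x))) + 𝟙 (S x) * (3 * (α x + β x))
  floor x = 𝟙 (C x) * 2 + 𝟙 (S x) * 3

  3*loss : 3 * sum loss ≡ sum ψ + 3 * Γ
  3*loss = begin
    3 * sum loss
      ≡⟨ cong (3 *_) loss-split ⟩
    3 * (sum α + sum Sβ + Γ)
      ≡⟨ cong (λ a → 3 * (a + sum Sβ + Γ)) (trans (sum-cong λ x → part (C x) (α x)) (sum-+ Cα Sα)) ⟩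
    3 * (sum Cα + sum Sα + sum Sβ + Γ)
      ≡⟨ arith (sum Cα) (sum Sα) (sum Sβ) Γ ⟩
    3 * sum Cα + 3 * (sum Sα + sum Sβ) + 3 * Γ
      ≡⟨ cong₂ (λ a b → a + b + 3 * Γ) (sum-cycles α)
           (trans (sum-*ˡ 3 _) (cong (3 *_) (sum-+ Sα Sβ))) ⟨
    sum ψC + sum (λ x → 3 * (Sα x + Sβ x)) + 3 * Γ
      ≡⟨ cong (λ b → sum ψC + b + 3 * Γ) (sum-cong λ x → arith′ (𝟙 (S x)) (α x) (β x)) ⟩
    sum ψC + sum ψS + 3 * Γ
      ≡⟨ cong (_+ 3 * Γ) (sum-+ ψC ψS) ⟨
    sum ψ + 3 * Γ ∎
    where
    open ≡-Reasoning
    Cα Sα Sβ ψC ψS : Fin n → ℕ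
    Cα x = 𝟙 (C x) * α x
    Sα x = 𝟙 (S x) * α x
    Sβ x = 𝟙 (S x) * β x
    ψC x = 𝟙 (C x) * (α x + α (f x) + α (f (f x)))
    ψS x = 𝟙 (S x) * (3 * (α x + β x))
    part : ∀ c a → a ≡ 𝟙 c * a + 𝟙 (not c) * a
    part true  a = sym (trans (+-identityʳ _) (+-identityʳ a))
    part false a = sym (+-identityʳ a)
    arith : ∀ a b c d → 3 * (a + b + c + d) ≡ 3 * a + 3 * (b + c) + 3 * d
    arith = solve-∀
    arith′ : ∀ i a b → 3 * (i * a + i * b) ≡ i * (3 * (a + b))
    arith′ = solve-∀

  1≤α+β : ∀ x → 1 ≤ α x + β x
  1≤α+β x = consecutive (no-fix x) (no-fix (f x)) (no2 x)

  β-cyclic : ∀ {x} → Cyclic x → β x ≡ α (f x)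
  β-cyclic {x} c = cong (μ (f x)) (sym c)

  1≤α+αf : ∀ {x} → Cyclic x → 1 ≤ α x + α (f x)
  1≤α+αf {x} c = subst (λ t → 1 ≤ α x + t) (β-cyclic c) (1≤α+β x)

  floor≤ψ : ∀ x → floor x ≤ ψ x
  floor≤ψ x with cyclic? x
  ... | yes c = +-monoˡ-≤ 0 (*-monoʳ-≤ 1 (two-of-three
        (missing x (f (f x))) (missing (f x) (f (f (f x)))) (missing (f (f x)) (f (f (f (f x)))))
        (1≤α+αf c) (1≤α+αf (cyclic-f c))
        (subst (λ y → 1 ≤ α (f (f x)) + α y) c (1≤α+αf (cyclic-f (cyclic-f c))))))
  ... | no  _ = *-monoʳ-≤ 1 (*-monoʳ-≤ 3 (1≤α+β x))

  sum-floor : sum floor ≡ 2 * n + #S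
  sum-floor = begin
    sum floor                                                 ≡⟨ sum-+ _ _ ⟩
    sum (λ x → 𝟙 (C x) * 2) + sum (λ x → 𝟙 (S x) * 3)
      ≡⟨ cong₂ _+_ (trans (sum-cong λ x → *-comm (𝟙 (C x)) 2) (sum-*ˡ 2 (𝟙 ∘ C)))
                   (trans (sum-cong λ x → *-comm (𝟙 (S x)) 3) (sum-*ˡ 3 (𝟙 ∘ S))) ⟩
    2 * #C + 3 * #S                                           ≡⟨ arith #C #S ⟩
    2 * (#C + #S) + #S                                        ≡⟨ cong (λ m → 2 * m + #S) #C+#S ⟩
    2 * n + #S                                                ∎
    where
    open ≡-Reasoning
    arith : ∀ c s → 2 * c + 3 * s ≡ 2 * (c + s) + s
    arith = solve-∀

  module _ {w} (w∉C : ¬ Cyclic w) (fw∈C : Cyclic (f w)) where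

    -- The predecessor of f w on its 3-cycle.
    rival : Fin n
    rival = f (f (f w))

    f-rival : f rival ≡ f w
    f-rival = fw∈C

    rival-cyclic : Cyclic rival
    rival-cyclic = cong (f ∘ f) fw∈C

    rival≢ : w ≢ rival
    rival≢ = w∉C ∘ sym

    γ-w-rival : γ w rival ≡ μ w rival
    γ-w-rival rewrite dec-false (rival ≟ f (f w)) (no-fix (f (f w)))
      | ⇒C rival-cyclic | Boolₚ.∧-zeroʳ (does (w ≟ f rival)) = refl

    γ-rival-w : γ rival w ≡ μ rival w
    γ-rival-w rewrite dec-false (w ≟ f (f rival)) (λ w≡ → w∉C (subst Cyclic (sym w≡) (cyclic-f (cyclic-f rival-cyclic))))
      | dec-false (rival ≟ f w) (λ eq → no-fix (f w) (trans (cong f (sym eq)) f-rival)) = refl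

    1≤γ+γ : 1 ≤ γ w rival + γ rival w
    1≤γ+γ = subst (1 ≤_) (sym (cong₂ _+_ γ-w-rival γ-rival-w))
      (same-centre (no-fix w) (no-fix rival) (sym f-rival) rival≢)

    -- The part of `γ` that lies on the two pairs of the contest between `w` and `rival`. It already
    -- has total at least 1, so it is all of `γ` when `Γ ≤ 1`.
    only : Fin n → Fin n → ℕ
    only x b = [ x ≡ᶠ w ] * ([ b ≡ᶠ rival ] * γ w rival) + [ x ≡ᶠ rival ] * ([ b ≡ᶠ w ] * γ rival w)

    only≤γ : ∀ x b → only x b ≤ γ x b
    only≤γ x b = by-cases (x ≟ w) (b ≟ rival) (x ≟ rival) (b ≟ w)
      where
      by-cases : (d₁ : Dec (x ≡ w)) (d₂ : Dec (b ≡ rival)) (d₃ : Dec (x ≡ rival)) (d₄ : Dec (b ≡ w)) →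
        𝟙 (does d₁) * (𝟙 (does d₂) * γ w rival) + 𝟙 (does d₃) * (𝟙 (does d₄) * γ rival w) ≤ γ x b
      by-cases (yes refl) _ (yes eq) _ = ⊥-elim (rival≢ eq)
      by-cases (yes refl) (yes refl) (no _) _ = ≤-reflexive (trans (+-identityʳ _) (trans (+-identityʳ _) (+-identityʳ _)))
      by-cases (yes refl) (no _) (no _) _ = z≤n
      by-cases (no _) _ (yes refl) (yes refl) = ≤-reflexive (trans (+-identityʳ _) (+-identityʳ _))
      by-cases (no _) _ (yes refl) (no _) = z≤n
      by-cases (no _) _ (no _) _ = z≤n

    sum-only : sum₂ only ≡ γ w rival + γ rival w
    sum-only = trans (sum₂-+ _ _) (cong₂ _+_ (sum₂-pick w rival _) (sum₂-pick rival w _))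

    1≤Γ : 1 ≤ Γ
    1≤Γ = ≤-trans 1≤γ+γ (≤-trans (≤-reflexive (sym sum-only)) (sum₂-mono only≤γ))

    only≡γ : Γ ≤ 1 → ∀ x b → only x b ≡ γ x b
    only≡γ Γ≤1 = sum₂-tight only≤γ (≤-trans Γ≤1 (≤-trans 1≤γ+γ (≤-reflexive (sym sum-only))))

    γ+γ≡1 : Γ ≤ 1 → γ w rival + γ rival w ≡ 1
    γ+γ≡1 Γ≤1 = ≤-antisym (≤-trans (≤-trans (≤-reflexive (sym sum-only)) (sum₂-mono only≤γ)) Γ≤1) 1≤γ+γ

  distinct₃ : ∀ {x} → ¬ Cyclic x → All (x ≢_) (f x ∷ f (f x) ∷ f (f (f x)) ∷ [])
  distinct₃ {x} x∉C = (no-fix x ∘ sym) ∷ (no2 x ∘ sym) ∷ (x∉C ∘ sym) ∷ []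

  -- Otherwise a vertex `w` off the 3-cycles would have both `f w` and `f (f w)` off them as well:
  -- three distinct vertices counted by `#S`.
  exit : 1 ≤ #S → #S ≤ 2 → ∃[ w ] (¬ Cyclic w × Cyclic (f w))
  exit 1≤S S≤2 with find-outside S [] 1≤S
  ... | w , Sw , _ with cyclic? (f w) | cyclic? (f (f w))
  ...   | yes c | _     = w , S⇒ Sw , c
  ...   | no ¬c | yes c = f w , ¬c , c
  ...   | no ¬c | no ¬d = ⊥-elim (<⇒≱ {2} ≤-refl (≤-trans (unique-length≤ S
          (((no-fix w ∘ sym) ∷ (no2 w ∘ sym) ∷ []) ∷ ((no-fix (f w) ∘ sym) ∷ []) ∷ [] ∷ [])
          (Sw ∷ ⇒S ¬c ∷ ⇒S ¬d ∷ [])) S≤2))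

  -- The pointwise floors give 3 · loss ≥ 2n + `#S` + 3`Γ`. With n = σ + 3k, the right side is at
  -- least 3(2k + σ) exactly when `#S` + 3`Γ` ≥ σ.
  module Excess (k σ : ℕ) (n≡ : n ≡ σ + k * 3) (σ≤ : σ ≤ #S + 3 * Γ) where

    loss≥ : 2 * k + σ ≤ sum loss
    loss≥ = *-cancelˡ-≤ 3 (by-identity 0
      (+-mono-≤ (+-mono-≤ (sum-mono floor≤ψ) (≤-reflexive (trans (cong (λ m → 2 * m + #S) (sym n≡)) (sym sum-floor)))) (+-mono-≤ σ≤ (≤-reflexive (sym 3*loss))))
      (arith k σ (sum floor) (sum ψ) #S Γ (sum loss)))
      where
      arith : ∀ k σ F P s g N →
        3 * (2 * k + σ) + (P + F + (s + 3 * g + 3 * N)) + 0 ≡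
        3 * N + (F + (2 * (σ + k * 3) + s) + (σ + (P + 3 * g)))
      arith = solve-∀

    module Tight (loss≤ : sum loss ≤ 2 * k + σ) where

      excess≤ : #S + 3 * Γ ≤ σ
      excess≤ = by-identity 0
        (+-mono-≤ (+-mono-≤ (sum-mono floor≤ψ) (≤-reflexive (trans (cong (λ m → 2 * m + #S) (sym n≡)) (sym sum-floor)))) (+-mono-≤ (*-monoʳ-≤ 3 loss≤) (≤-reflexive (sym 3*loss))))
        (arith k σ (sum floor) (sum ψ) #S Γ (sum loss))
        where
        arith : ∀ k σ F P s g N →
          s + 3 * g + (P + F + (3 * (2 * k + σ) + 3 * N)) + 0 ≡
          σ + (F + (2 * (σ + k * 3) + s) + (3 * N + (P + 3 * g)))
        arith = solve-∀

      -- The estimates behind `loss≥` have no slack left, so no single vertex can exceed its floor.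
      floor≡ψ : ∀ x → floor x ≡ ψ x
      floor≡ψ = sum-tight floor≤ψ (by-identity 0
        (+-mono-≤ (+-mono-≤ σ≤ (≤-reflexive (trans (cong (λ m → 2 * m + #S) (sym n≡)) (sym sum-floor)))) (+-mono-≤ (*-monoʳ-≤ 3 loss≤) (≤-reflexive (sym 3*loss))))
        (arith k σ (sum floor) (sum ψ) #S Γ (sum loss)))
        where
        arith : ∀ k σ F P s g N →
          P + (s + 3 * g + F + (3 * (2 * k + σ) + 3 * N)) + 0 ≡
          F + (σ + (2 * (σ + k * 3) + s) + (3 * N + (P + 3 * g)))
        arith = solve-∀

      cycle-tight : ∀ {x} → Cyclic x → α x + α (f x) + α (f (f x)) ≡ 2
      cycle-tight {x} c with cyclic? x | floor≡ψ x
      ... | yes _ | eq = sym (trans eq (trans (+-identityʳ _) (+-identityʳ _)))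
      ... | no ¬c | _  = ⊥-elim (¬c c)

      tail-tight : ∀ {x} → ¬ Cyclic x → α x + β x ≡ 1
      tail-tight {x} ¬c with cyclic? x | floor≡ψ x
      ... | yes c | _  = ⊥-elim (¬c c)
      ... | no _  | eq = *-cancelˡ-≡ _ _ 3 (sym (trans eq (+-identityʳ _)))

-- Star graphs and models

T-∨ : ∀ {a b} → T (a ∨ b) → T a ⊎ T b
T-∨ {true}  t = inj₁ _
T-∨ {false} t = inj₂ t

T-∧ : ∀ {a b} → T (a ∧ b) → T a × T b
T-∧ {true} t = _ , t

∨-T : ∀ {a b} → T a ⊎ T b → T (a ∨ b)
∨-T {true}          _        = _
∨-T {false} {true}  _        = _
∨-T {false} {false} (inj₁ ())
∨-T {false} {false} (inj₂ ())

∧-T : ∀ {a b} → T a → T b → T (a ∧ b)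
∧-T {true} {true} _ _ = _

T-does : ∀ {A : Set} (d : Dec A) → T (does d) → A
T-does (yes a) _ = a

does-T : ∀ {A : Set} (d : Dec A) → A → T (does d)
does-T d a rewrite dec-true d a = _

T-not : ∀ {A : Set} (d : Dec A) → T (not (does d)) → ¬ A
T-not (no ¬a) _ = ¬a

not-T : ∀ {A : Set} (d : Dec A) → ¬ A → T (not (does d))
not-T d ¬a rewrite dec-false d ¬a = _

T-¬not : ∀ {b} → T (not b) → T b → ⊥
T-¬not {false} _ ()

module _ {n} (f : Fin n → Fin n) (no-fix : ∀ x → f x ≢ x) (gone : Fin n → Fin n → Bool) where

  present : Fin n → Fin n → Bool
  present x b = not (does (b ≟ x)) ∧ (not (does (b ≟ f x)) ∧ not (gone x b))

  present⇒ : ∀ {x b} → T (present x b) → b ≢ x × b ≢ f x × T (not (gone x b))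
  present⇒ {x} {b} t =
    let t₁ , t₂ = T-∧ t ; t₃ , t₄ = T-∧ t₂ in T-not (b ≟ x) t₁ , T-not (b ≟ f x) t₃ , t₄

  present-≢ : ∀ {x b} → b ≢ x → b ≢ f x → present x b ≡ not (gone x b)
  present-≢ {x} {b} b≢x b≢fx rewrite dec-false (b ≟ x) b≢x | dec-false (b ≟ f x) b≢fx = refl

  present-self : ∀ x → present x x ≡ false
  present-self x = cong (λ d → not d ∧ (not (does (x ≟ f x)) ∧ not (gone x x))) (dec-true (x ≟ x) refl)

  starGraph : Graph n
  starGraph = record
    { edge     = λ a b x → (does (a ≟ f x) ∧ present x b) ∨ (does (b ≟ f x) ∧ present x a)
    ; tail-sym = λ a b x → Boolₚ.∨-comm (does (a ≟ f x) ∧ present x b) (does (b ≟ f x) ∧ present x a)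
    ; distinct = λ a b x t → by-cases a b x (T-∨ t)
    }
    where
    by-cases : ∀ a b x → T (does (a ≟ f x) ∧ present x b) ⊎ T (does (b ≟ f x) ∧ present x a) →
      a ≢ b × a ≢ x × b ≢ x
    by-cases a b x (inj₁ t) with T-∧ t
    ... | t₁ , t₂ with T-does (a ≟ f x) t₁ | present⇒ t₂
    ...   | refl | b≢x , b≢fx , _ = (b≢fx ∘ sym) , no-fix x , b≢x
    by-cases a b x (inj₂ t) with T-∧ t
    ... | t₁ , t₂ with T-does (b ≟ f x) t₁ | present⇒ t₂
    ...   | refl | a≢x , a≢fx , _ = a≢fx , a≢x , no-fix x

  present-centre : ∀ x → present x (f x) ≡ false
  present-centre x = trans
    (cong (λ d → not (does (f x ≟ x)) ∧ (not d ∧ not (gone x (f x)))) (dec-true (f x ≟ f x) refl))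
    (Boolₚ.∧-zeroʳ _)

  starGraph-edge : ∀ x b → edge starGraph (f x) b x ≡ present x b
  starGraph-edge x b = trans
    (cong₂ (λ d p → (d ∧ present x b) ∨ (does (b ≟ f x) ∧ p)) (dec-true (f x ≟ f x) refl) (present-centre x))
    (trans (cong (present x b ∨_) (Boolₚ.∧-zeroʳ _)) (Boolₚ.∨-identityʳ _))

  starGraph-centre : ∀ x → Centre starGraph (f x) x
  starGraph-centre x = no-fix x , λ a b t → by-cases a b (T-∨ t)
    where
    by-cases : ∀ a b → T (does (a ≟ f x) ∧ present x b) ⊎ T (does (b ≟ f x) ∧ present x a) →
      a ≡ f x ⊎ b ≡ f x
    by-cases a b (inj₁ t) = inj₁ (T-does (a ≟ f x) (proj₁ (T-∧ t)))
    by-cases a b (inj₂ t) = inj₂ (T-does (b ≟ f x) (proj₁ (T-∧ t)))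

  -- For two edges with heads `b` and `c` on one triple, either both centres are the third vertex,
  -- or one head is the centre of the other, or the heads are centres of each other. The three
  -- hypotheses settle these cases.
  starGraph-oriented : (∀ x → f (f x) ≢ x) →
    (∀ x → T (gone x (f (f x)) ∨ gone (f x) x)) →
    (∀ x y → f x ≡ f y → x ≢ y → T (gone x y ∨ gone y x)) → Oriented starGraph
  starGraph-oriented no2 consecutive same a b c (ab→c , ac→b) = by-cases (T-∨ ab→c) (T-∨ ac→b)
    where
    neither : ∀ {x y z w} → T (present x y) → T (present z w) → T (gone x y ∨ gone z w) → ⊥
    neither p q t with T-∨ t
    ... | inj₁ g = T-¬not (proj₂ (proj₂ (present⇒ p))) g
    ... | inj₂ g = T-¬not (proj₂ (proj₂ (present⇒ q))) g
    by-cases : T (does (a ≟ f c) ∧ present c b) ⊎ T (does (b ≟ f c) ∧ present c a) →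
               T (does (a ≟ f b) ∧ present b c) ⊎ T (does (c ≟ f b) ∧ present b a) → ⊥
    by-cases (inj₁ s) (inj₁ t) =
      let s₁ , s₂ = T-∧ s ; t₁ , t₂ = T-∧ t in
      neither s₂ t₂ (same c b (trans (sym (T-does (a ≟ f c) s₁)) (T-does (a ≟ f b) t₁))
        (proj₁ (present⇒ s₂) ∘ sym))
    by-cases (inj₁ s) (inj₂ t) with T-∧ s | T-∧ t
    ... | s₁ , s₂ | t₁ , t₂ with T-does (a ≟ f c) s₁ | T-does (c ≟ f b) t₁
    ...   | refl | refl = neither t₂ s₂ (consecutive b)
    by-cases (inj₂ s) (inj₁ t) with T-∧ s | T-∧ t
    ... | s₁ , s₂ | t₁ , t₂ with T-does (b ≟ f c) s₁ | T-does (a ≟ f b) t₁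
    ...   | refl | refl = neither s₂ t₂ (consecutive c)
    by-cases (inj₂ s) (inj₂ t) =
      let s₁ , s₂ = T-∧ s ; t₁ , t₂ = T-∧ t in
      no2 b (trans (cong f (sym (T-does (c ≟ f b) t₁))) (sym (T-does (b ≟ f c) s₁)))

  -- An inequality suffices, and `gone` may also mark pairs that could never be edges. For the
  -- models, equality follows in `edgeCount-model` by comparison with the upper bound.
  starGraph-count : n * n ≤ edgeCount starGraph + sum₂ (λ x b → 𝟙 (gone x b)) + 2 * n
  starGraph-count = subst (_≤ edgeCount starGraph + sum₂ (λ x b → 𝟙 (gone x b)) + 2 * n)
    (edgeCount-loss starGraph-centre)
    (+-monoˡ-≤ (2 * n) (+-monoʳ-≤ (edgeCount starGraph) (sum₂-mono μ≤gone)))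
    where
    open Missing starGraph f
    μ≤gone : ∀ x b → μ x b ≤ 𝟙 (gone x b)
    μ≤gone x b = by-cases (b ≟ x) (b ≟ f x)
      where
      by-cases : Dec (b ≡ x) → Dec (b ≡ f x) → μ x b ≤ 𝟙 (gone x b)
      by-cases (yes p) _       = ≤-trans (≤-reflexive (cong 𝟙 (missing-self p))) z≤n
      by-cases (no _)  (yes q) = ≤-trans (≤-reflexive (cong 𝟙 (missing-centre q))) z≤n
      by-cases (no p)  (no q)  = ≤-reflexive (cong 𝟙 (trans (missing-edge p q)
        (trans (cong not (trans (starGraph-edge x b) (present-≢ p q))) (Boolₚ.not-involutive (gone x b)))))

centred⇒free : ∀ {n} {H : Graph n} {f : Fin n → Fin n} → (∀ x → Centre H (f x) x) → Free I₀ H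
centred⇒free {H = H} {f} star (φ , inj , hom) =
  clash (proj₂ (star (φ 4F)) (φ 0F) (φ 1F) (hom 0F 1F 4F _))
        (proj₂ (star (φ 4F)) (φ 2F) (φ 3F) (hom 2F 3F 4F _))
  where
  clash : ∀ {c} → φ 0F ≡ c ⊎ φ 1F ≡ c → φ 2F ≡ c ⊎ φ 3F ≡ c → ⊥
  clash (inj₁ p) (inj₁ q) with () ← inj (trans p (sym q))
  clash (inj₁ p) (inj₂ q) with () ← inj (trans p (sym q))
  clash (inj₂ p) (inj₁ q) with () ← inj (trans p (sym q))
  clash (inj₂ p) (inj₂ q) with () ← inj (trans p (sym q))

-- Up to the order of the tail, every edge of `H` has the form `f x ∙ b ⟶ x`, so it is enough to
-- compare these.
≅-starGraph : ∀ {n} {H : Graph n} {f f′ : Fin n → Fin n} {no-fix gone} → (∀ x → Centre H (f x) x) →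
  (π : Permutation′ n) → (∀ x → π ⟨$⟩ʳ f x ≡ f′ (π ⟨$⟩ʳ x)) →
  (∀ x b → edge H (f x) b x ≡ present f′ no-fix gone (π ⟨$⟩ʳ x) (π ⟨$⟩ʳ b)) →
  H ≅ starGraph f′ no-fix gone
≅-starGraph {H = H} {f} {f′} {no-fix} {gone} star π comm same = π , λ a b x → mk⇔ (to a b x) (from a b x)
  where
  to : ∀ a b x → H ∋ a ∙ b ⟶ x → starGraph f′ no-fix gone ∋ (π ⟨$⟩ʳ a) ∙ (π ⟨$⟩ʳ b) ⟶ (π ⟨$⟩ʳ x)
  to a b x abx with proj₂ (star x) a b abx
  ... | inj₁ refl = ∨-T (inj₁ (∧-T (does-T (_ ≟ _) (comm x)) (subst T (same x b) abx)))
  ... | inj₂ refl = ∨-T (inj₂ (∧-T (does-T (_ ≟ _) (comm x)) (subst T (same x a) (flip-tail H abx))))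
  cancel : ∀ {a x} → π ⟨$⟩ʳ a ≡ f′ (π ⟨$⟩ʳ x) → a ≡ f x
  cancel {a} {x} eq = trans (sym (inverseˡ π))
    (trans (cong (π ⟨$⟩ˡ_) (trans eq (sym (comm x)))) (inverseˡ π))
  from : ∀ a b x → starGraph f′ no-fix gone ∋ (π ⟨$⟩ʳ a) ∙ (π ⟨$⟩ʳ b) ⟶ (π ⟨$⟩ʳ x) → H ∋ a ∙ b ⟶ x
  from a b x t with T-∨ t
  ... | inj₁ s with T-∧ s
  ...   | s₁ , s₂ with refl ← cancel {a} {x} (T-does (_ ≟ _) s₁) = subst T (sym (same x b)) s₂
  from a b x t | inj₂ s with T-∧ s
  ...   | s₁ , s₂ with refl ← cancel {b} {x} (T-does (_ ≟ _) s₁) = flip-tail H (subst T (sym (same x a)) s₂)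

rot : Fin 3 → Fin 3
rot 0F = 1F
rot 1F = 2F
rot 2F = 0F

rot³ : ∀ a → rot (rot (rot a)) ≡ a
rot³ 0F = refl
rot³ 1F = refl
rot³ 2F = refl

-- In a 3-cycle 0 → 1 → 2 → 0 the vertex 0 receives the triple.
away : Fin 3 → Fin 3 → Bool
away 1F 0F = true
away 2F 1F = true
away _  _  = false

-- What remains of an extremal graph when its isolated 3-cycles are removed. The bound `total`,
-- together with two pairs for each of k isolated 3-cycles, makes up the budget 2k + σ.
record Gadget (σ : ℕ) : Set where
  field
    next        : Fin σ → Fin σ
    gone        : Fin σ → Fin σ → Bool
    no-fix      : ∀ a → next a ≢ a
    no-2        : ∀ a → next (next a) ≢ a
    consecutive : ∀ a → T (gone a (next (next a)) ∨ gone (next a) a)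
    same-next   : ∀ a b → next a ≡ next b → a ≢ b → T (gone a b ∨ gone b a)
    total       : sum₂ (λ a b → 𝟙 (gone a b)) ≤ σ

module Model {σ} (g : Gadget σ) (k : ℕ) where

  open Gadget g

  V : Set
  V = Fin σ ⊎ (Fin k × Fin 3)

  encode : V → Fin (σ + k * 3)
  encode v = join σ (k * 3) (Sum⊎.map₂ (uncurry combine) v)

  decode : Fin (σ + k * 3) → V
  decode x = Sum⊎.map₂ (remQuot {k} 3) (splitAt σ x)

  decode-encode : ∀ v → decode (encode v) ≡ v
  decode-encode (inj₁ a) rewrite splitAt-↑ˡ σ a (k * 3) = refl
  decode-encode (inj₂ (i , a)) rewrite splitAt-↑ʳ σ (k * 3) (combine i a) = cong inj₂ (remQuot-combine i a)

  encode-decode : ∀ x → encode (decode x) ≡ x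
  encode-decode x = trans (lemma (splitAt σ x)) (join-splitAt σ (k * 3) x)
    where
    lemma : ∀ s → encode (Sum⊎.map₂ (remQuot {k} 3) s) ≡ join σ (k * 3) s
    lemma (inj₁ a) = refl
    lemma (inj₂ y) = cong (σ ↑ʳ_) (combine-remQuot {k} 3 y)

  nextV : V → V
  nextV (inj₁ a)       = inj₁ (next a)
  nextV (inj₂ (i , a)) = inj₂ (i , rot a)

  goneV : V → V → Bool
  goneV (inj₁ a)       (inj₁ b)       = gone a b
  goneV (inj₂ (i , a)) (inj₂ (j , b)) = does (i ≟ j) ∧ away a b
  goneV _              _              = false

  f : Fin (σ + k * 3) → Fin (σ + k * 3)
  f x = encode (nextV (decode x))

  goneM : Fin (σ + k * 3) → Fin (σ + k * 3) → Bool
  goneM x b = goneV (decode x) (decode b)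

  decode-f : ∀ x → decode (f x) ≡ nextV (decode x)
  decode-f x = decode-encode (nextV (decode x))

  private
    rot-≢ : ∀ a → rot a ≢ a
    rot-≢ 0F ()
    rot-≢ 1F ()
    rot-≢ 2F ()

    rot²-≢ : ∀ a → rot (rot a) ≢ a
    rot²-≢ 0F ()
    rot²-≢ 1F ()
    rot²-≢ 2F ()

    rot-away : ∀ a → T (away a (rot (rot a)) ∨ away (rot a) a)
    rot-away 0F = _
    rot-away 1F = _
    rot-away 2F = _

    rot-injective : ∀ {a b} → rot a ≡ rot b → a ≡ b
    rot-injective {a} {b} eq = trans (sym (rot³ a)) (trans (cong (rot ∘ rot) eq) (rot³ b))

    inj₂-injective : ∀ {i j : Fin k} {a b : Fin 3} → _≡_ {A = V} (inj₂ (i , a)) (inj₂ (j , b)) → i ≡ j × a ≡ b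
    inj₂-injective refl = refl , refl

  nextV-no-fix : ∀ v → nextV v ≢ v
  nextV-no-fix (inj₁ a)       eq = no-fix a (inj₁-injective eq)
  nextV-no-fix (inj₂ (i , a)) eq = rot-≢ a (proj₂ (inj₂-injective eq))

  nextV-no-2 : ∀ v → nextV (nextV v) ≢ v
  nextV-no-2 (inj₁ a)       eq = no-2 a (inj₁-injective eq)
  nextV-no-2 (inj₂ (i , a)) eq = rot²-≢ a (proj₂ (inj₂-injective eq))

  f-no-fix : ∀ x → f x ≢ x
  f-no-fix x eq = nextV-no-fix (decode x) (trans (sym (decode-f x)) (cong decode eq))

  f-no-2 : ∀ x → f (f x) ≢ x
  f-no-2 x eq = nextV-no-2 (decode x)
    (trans (cong nextV (sym (decode-f x))) (trans (sym (decode-f (f x))) (cong decode eq)))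

  consecutiveV : ∀ v → T (goneV v (nextV (nextV v)) ∨ goneV (nextV v) v)
  consecutiveV (inj₁ a) = consecutive a
  consecutiveV (inj₂ (i , a)) rewrite dec-true (i ≟ i) refl = rot-away a

  same-nextV : ∀ v u → nextV v ≡ nextV u → v ≢ u → T (goneV v u ∨ goneV u v)
  same-nextV (inj₁ a) (inj₁ b) eq v≢u = same-next a b (inj₁-injective eq) (v≢u ∘ cong inj₁)
  same-nextV (inj₂ (i , a)) (inj₂ (j , b)) eq v≢u with inj₂-injective eq
  ... | i≡j , ra≡rb = ⊥-elim (v≢u (cong₂ (λ i a → inj₂ (i , a)) i≡j (rot-injective ra≡rb)))

  graph : Graph (σ + k * 3)
  graph = starGraph f f-no-fix goneM

  graph-centre : ∀ x → Centre graph (f x) x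
  graph-centre = starGraph-centre f f-no-fix goneM

  graph-oriented : Oriented graph
  graph-oriented = starGraph-oriented f f-no-fix goneM f-no-2
    (λ x → subst₂ (λ u w → T (goneV (decode x) u ∨ goneV w (decode x)))
      (sym (trans (decode-f (f x)) (cong nextV (decode-f x)))) (sym (decode-f x)) (consecutiveV (decode x)))
    (λ x y eq x≢y → same-nextV (decode x) (decode y)
      (trans (sym (decode-f x)) (trans (cong decode eq) (decode-f y)))
      (λ eq → x≢y (trans (sym (encode-decode x)) (trans (cong encode eq) (encode-decode y)))))

  graph-free : Free I₀ graph
  graph-free = centred⇒free {H = graph} graph-centre

  private
    sum-encode : (h : Fin (σ + k * 3) → ℕ) →
      sum h ≡ sum (λ a → h (encode (inj₁ a))) + sum (λ i → sum λ a → h (encode (inj₂ (i , a))))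
    sum-encode h = trans (sum-++ σ h) (cong (sum (λ a → h (encode (inj₁ a))) +_) (sum-combine k (h ∘ (σ ↑ʳ_))))

    row₁ : ∀ a → sum (λ b → 𝟙 (goneM (encode (inj₁ a)) b)) ≡ sum λ b → 𝟙 (gone a b)
    row₁ a rewrite decode-encode (inj₁ a) = trans (sum-encode _) (trans
      (cong₂ _+_ (sum-cong λ b → cong (𝟙 ∘ goneV (inj₁ a)) (decode-encode (inj₁ b)))
                 (sum-zero λ j → sum-zero λ b → cong (𝟙 ∘ goneV (inj₁ a)) (decode-encode (inj₂ (j , b)))))
      (+-identityʳ _))

    row₂ : ∀ i a → sum (λ b → 𝟙 (goneM (encode (inj₂ (i , a))) b)) ≡ sum λ b → 𝟙 (away a b)
    row₂ i a rewrite decode-encode (inj₂ (i , a)) = trans (sum-encode _) (cong₂ _+_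
      (sum-zero λ b → cong (𝟙 ∘ goneV (inj₂ (i , a))) (decode-encode (inj₁ b)))
      (trans (sum-cong λ j → trans (sum-cong λ b →
                trans (cong (𝟙 ∘ goneV (inj₂ (i , a))) (decode-encode (inj₂ (j , b)))) (indicator j b))
                (sum-*ˡ [ j ≡ᶠ i ] _))
             (sum-pick i λ _ → sum λ b → 𝟙 (away a b))))
      where
      indicator : ∀ j b → 𝟙 (does (i ≟ j) ∧ away a b) ≡ [ j ≡ᶠ i ] * 𝟙 (away a b)
      indicator j b = by-cases (i ≟ j)
        where
        by-cases : (d : Dec (i ≡ j)) → 𝟙 (does d ∧ away a b) ≡ [ j ≡ᶠ i ] * 𝟙 (away a b)
        by-cases (yes refl) = trans (sym (+-identityʳ _)) (cong (_* 𝟙 (away a b)) (sym (≡ᶠ-refl i)))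
        by-cases (no i≢j)   = cong (_* 𝟙 (away a b)) (sym (≡ᶠ-≢ (i≢j ∘ sym)))

    sum-away : (sum λ a → sum λ b → 𝟙 (away a b)) ≡ 2
    sum-away = trans (sum-cong λ a → sum≡ _) (sum≡ _)

  total-goneM : sum₂ (λ x b → 𝟙 (goneM x b)) ≤ 2 * k + σ
  total-goneM = begin
    sum₂ (λ x b → 𝟙 (goneM x b))
      ≡⟨ sum-encode _ ⟩
    sum (λ a → sum λ b → 𝟙 (goneM (encode (inj₁ a)) b)) +
    sum (λ i → sum λ a → sum λ b → 𝟙 (goneM (encode (inj₂ (i , a))) b))
      ≡⟨ cong₂ _+_ (sum-cong row₁) (sum-cong λ i → trans (sum-cong (row₂ i)) sum-away) ⟩
    sum₂ (λ a b → 𝟙 (gone a b)) + sum {k} (λ _ → 2)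
      ≤⟨ +-mono-≤ total (≤-reflexive (trans (sum-const k 2) (*-comm k 2))) ⟩
    σ + 2 * k
      ≡⟨ +-comm σ (2 * k) ⟩
    2 * k + σ ∎
    where open ≤-Reasoning

  graph-count : (σ + k * 3) * (σ + k * 3) ≤ edgeCount graph + (2 * k + σ) + 2 * (σ + k * 3)
  graph-count = ≤-trans (starGraph-count f f-no-fix goneM)
    (+-monoˡ-≤ (2 * (σ + k * 3)) (+-monoʳ-≤ (edgeCount graph) total-goneM))

-- Recognising a model

record Enumeration {n} (P : Fin n → Bool) (k : ℕ) : Set where
  field
    elem      : Fin k → Fin n
    injective : ∀ {i j} → elem i ≡ elem j → i ≡ j
    sound     : ∀ i → T (P (elem i))
    find      : ∀ {x} → T (P x) → ∃[ i ] elem i ≡ x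

enumerate : ∀ {n} (P : Fin n → Bool) → ∃[ k ] Enumeration P k
enumerate {n} P = length members , record
  { elem      = lookup members
  ; injective = lookup-injective (filter⁺ (T? ∘ P) (allFin⁺ n))
  ; sound     = λ i → proj₂ (∈-filter⁻ (T? ∘ P) {xs = allFin n} (∈-lookup i))
  ; find      = λ {x} Px → let x∈ = ∈-filter⁺ (T? ∘ P) (∈-allFin x) Px in index x∈ , sym (lookup-index x∈)
  }
  where
  members : List (Fin n)
  members = filter (T? ∘ P) (allFin n)

private
  one-absent : ∀ a b c → 𝟙 a + 𝟙 b + 𝟙 c ≡ 2 → T (not a) ⊎ T (not b) ⊎ T (not c)
  one-absent true  true  true  ()
  one-absent true  true  false _ = inj₂ (inj₂ _)
  one-absent true  false _     _ = inj₂ (inj₁ _)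
  one-absent false _     _     _ = inj₁ _

  others-missing : ∀ {a b c} → 𝟙 a + 𝟙 b + 𝟙 c ≡ 2 → T (not a) → b ≡ true × c ≡ true
  others-missing {false} {true}  {true}  _ _ = refl , refl
  others-missing {false} {true}  {false} () _
  others-missing {false} {false} {true}  () _
  others-missing {false} {false} {false} () _

-- The representatives of the 3-cycles outside the orbit o are the vertices
-- that receive the triple of their 3-cycle.
module Match {σ k} (H : Graph (σ + k * 3)) {f : Fin (σ + k * 3) → Fin (σ + k * 3)}
  (star : ∀ x → Centre H (f x) x) (g : Gadget σ)
  (o : Fin σ → Fin (σ + k * 3)) (o-injective : ∀ {a b} → o a ≡ o b → a ≡ b)
  (o-next : ∀ a → o (Gadget.next g a) ≡ f (o a)) where

  open Missing H f
  open Cycles f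
  open Gadget g using (next; gone)

  Outside : Fin (σ + k * 3) → Set
  Outside x = ∀ a → o a ≢ x

  module _ (cyclic : ∀ x → Outside x → Cyclic x)
    (tight : ∀ x → Outside x → μ x (f (f x)) + μ (f x) (f (f (f x))) + μ (f (f x)) (f (f (f (f x)))) ≡ 2)
    (edges-outside : ∀ x b → Outside x ⊎ Outside b → b ≢ x → b ≢ f x → b ≢ f (f x) → missing x b ≡ false)
    (edges-inside : ∀ a b → b ≢ a → b ≢ next a → missing (o a) (o b) ≡ gone a b) where

    private
      n = σ + k * 3

      no-fix : ∀ x → f x ≢ x
      no-fix x = proj₁ (star x)

      outside? : ∀ x → (∃[ a ] o a ≡ x) ⊎ Outside x
      outside? x with any? (λ a → o a ≟ x)
      ... | yes found = inj₁ found
      ... | no  none  = inj₂ λ a eq → none (a , eq)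

      isOutside : Fin n → Bool
      isOutside x = not (does (any? (λ a → o a ≟ x)))

      isOutside⇒ : ∀ {x} → T (isOutside x) → Outside x
      isOutside⇒ {x} t a eq = T-not (any? (λ a → o a ≟ x)) t (a , eq)

      ⇒isOutside : ∀ {x} → Outside x → T (isOutside x)
      ⇒isOutside {x} out = not-T (any? (λ a → o a ≟ x)) λ (a , eq) → out a eq

      outside-f : ∀ {x} → Outside x → Outside (f x)
      outside-f {x} out a eq = out (next (next a)) (trans (o-next (next a))
        (trans (cong f (trans (o-next a) (cong f eq))) (cyclic x out)))

      Rep : Fin n → Bool
      Rep x = isOutside x ∧ not (missing x (f (f x)))

      rep : ∀ {x} → Outside x → T (not (missing x (f (f x)))) → T (Rep x)
      rep out t = ∧-T (⇒isOutside out) t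

      rep-outside : ∀ {x} → T (Rep x) → Outside x
      rep-outside t = isOutside⇒ (proj₁ (T-∧ t))

      rep-cyclic : ∀ {x} → T (Rep x) → Cyclic x
      rep-cyclic t = cyclic _ (rep-outside t)

      rep-missing : ∀ {x} → T (Rep x) → missing (f x) (f (f (f x))) ≡ true × missing (f (f x)) (f (f (f (f x)))) ≡ true
      rep-missing {x} t = others-missing (tight x (rep-outside t)) (proj₂ (T-∧ {isOutside x} t))

      not-rep-f : ∀ {x} → T (Rep x) → ¬ T (Rep (f x))
      not-rep-f {x} t s = T-¬not (proj₂ (T-∧ {isOutside (f x)} s)) (subst T (sym (proj₁ (rep-missing t))) _)

      not-rep-ff : ∀ {x} → T (Rep x) → ¬ T (Rep (f (f x)))
      not-rep-ff {x} t s = T-¬not (proj₂ (T-∧ {isOutside (f (f x))} s)) (subst T (sym (proj₂ (rep-missing t))) _)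

      cancel : ∀ {x y} → Cyclic x → Cyclic y → f x ≡ f y → x ≡ y
      cancel cx cy eq = trans (sym cx) (trans (cong (f ∘ f) eq) cy)

    module _ {k′} (reps : Enumeration Rep k′) where

      open Enumeration reps
      module M = Model g k′

      place : M.V → Fin n
      place (inj₁ a)        = o a
      place (inj₂ (i , 0F)) = elem i
      place (inj₂ (i , 1F)) = f (elem i)
      place (inj₂ (i , 2F)) = f (f (elem i))

      place-next : ∀ v → place (M.nextV v) ≡ f (place v)
      place-next (inj₁ a)        = o-next a
      place-next (inj₂ (i , 0F)) = refl
      place-next (inj₂ (i , 1F)) = refl
      place-next (inj₂ (i , 2F)) = sym (rep-cyclic (sound i))

      place-outside : ∀ i a → Outside (place (inj₂ (i , a)))
      place-outside i 0F = rep-outside (sound i)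
      place-outside i 1F = outside-f (rep-outside (sound i))
      place-outside i 2F = outside-f (outside-f (rep-outside (sound i)))

      place-injective : ∀ v u → place v ≡ place u → v ≡ u
      place-injective (inj₁ a) (inj₁ b) eq = cong inj₁ (o-injective eq)
      place-injective (inj₁ a) (inj₂ (j , b)) eq = ⊥-elim (place-outside j b a eq)
      place-injective (inj₂ (i , a)) (inj₁ b) eq = ⊥-elim (place-outside i a b (sym eq))
      place-injective (inj₂ (i , 0F)) (inj₂ (j , 0F)) eq = cong (λ i → inj₂ (i , 0F)) (injective eq)
      place-injective (inj₂ (i , 1F)) (inj₂ (j , 1F)) eq = cong (λ i → inj₂ (i , 1F))
        (injective (cancel (rep-cyclic (sound i)) (rep-cyclic (sound j)) eq))
      place-injective (inj₂ (i , 2F)) (inj₂ (j , 2F)) eq = cong (λ i → inj₂ (i , 2F))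
        (injective (cancel (rep-cyclic (sound i)) (rep-cyclic (sound j))
          (cancel (cyclic-f (rep-cyclic (sound i))) (cyclic-f (rep-cyclic (sound j))) eq)))
      -- The two successors of a representative do not receive the triple, so they are not
      -- representatives.
      place-injective (inj₂ (i , 0F)) (inj₂ (j , 1F)) eq = ⊥-elim (not-rep-f (sound j) (subst (T ∘ Rep) eq (sound i)))
      place-injective (inj₂ (i , 1F)) (inj₂ (j , 0F)) eq = ⊥-elim (not-rep-f (sound i) (subst (T ∘ Rep) (sym eq) (sound j)))
      place-injective (inj₂ (i , 0F)) (inj₂ (j , 2F)) eq = ⊥-elim (not-rep-ff (sound j) (subst (T ∘ Rep) eq (sound i)))
      place-injective (inj₂ (i , 2F)) (inj₂ (j , 0F)) eq = ⊥-elim (not-rep-ff (sound i) (subst (T ∘ Rep) (sym eq) (sound j)))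
      place-injective (inj₂ (i , 1F)) (inj₂ (j , 2F)) eq = ⊥-elim (not-rep-f (sound j)
        (subst (T ∘ Rep) (cancel (rep-cyclic (sound i)) (cyclic-f (rep-cyclic (sound j))) eq) (sound i)))
      place-injective (inj₂ (i , 2F)) (inj₂ (j , 1F)) eq = ⊥-elim (not-rep-f (sound i)
        (subst (T ∘ Rep) (cancel (rep-cyclic (sound j)) (cyclic-f (rep-cyclic (sound i))) (sym eq)) (sound j)))

      locate : ∀ x → ∃[ v ] place v ≡ x
      locate x with outside? x
      ... | inj₁ (a , eq) = inj₁ a , eq
      ... | inj₂ out with one-absent (missing x (f (f x))) (missing (f x) (f (f (f x)))) (missing (f (f x)) (f (f (f (f x))))) (tight x out)
      ...   | inj₁ t with find (rep out t)
      ...     | i , eq = inj₂ (i , 0F) , eq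
      -- If `f x` is the representative, `x` is its second successor; if `f (f x)` is, `x` is its
      -- first.
      locate x | inj₂ out | inj₂ (inj₁ t) with find (rep (outside-f out) t)
      ...     | i , eq = inj₂ (i , 2F) , trans (cong (f ∘ f) eq) (cyclic x out)
      locate x | inj₂ out | inj₂ (inj₂ t) with find (rep (outside-f (outside-f out)) t)
      ...     | i , eq = inj₂ (i , 1F) , trans (cong f eq) (cyclic x out)

      unplace : Fin n → M.V
      unplace x = proj₁ (locate x)

      place-unplace : ∀ x → place (unplace x) ≡ x
      place-unplace x = proj₂ (locate x)

      unplace-place : ∀ v → unplace (place v) ≡ v
      unplace-place v = place-injective _ v (place-unplace (place v))

      relabel : Permutation n (σ + k′ * 3)
      relabel = permutation (M.encode ∘ unplace) (place ∘ M.decode)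
        (λ y → trans (cong M.encode (unplace-place (M.decode y))) (M.encode-decode y))
        (λ x → trans (cong place (M.decode-encode (unplace x))) (place-unplace x))

      gone-place : ∀ v u → u ≢ v → u ≢ M.nextV v → missing (place v) (place u) ≡ M.goneV v u
      gone-place (inj₁ a) (inj₁ b) u≢v u≢fv = edges-inside a b (u≢v ∘ cong inj₁) (u≢fv ∘ cong inj₁)
      gone-place v@(inj₁ a) u@(inj₂ (j , b)) u≢v u≢fv =
        edges-outside (o a) (place u) (inj₂ (place-outside j b)) (u≢v ∘ place-injective u v)
          (λ eq → place-outside j b (next a) (trans (o-next a) (sym eq)))
          (λ eq → place-outside j b (next (next a)) (trans (o-next (next a)) (trans (cong f (o-next a)) (sym eq))))
      gone-place v@(inj₂ (i , a)) u@(inj₁ b) u≢v u≢fv =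
        edges-outside (place v) (o b) (inj₁ (place-outside i a)) (u≢v ∘ place-injective u v)
          (λ eq → u≢fv (place-injective u (M.nextV v) (trans eq (sym (place-next v)))))
          (λ eq → outside-f (outside-f (place-outside i a)) b eq)
      gone-place v@(inj₂ (i , a)) u@(inj₂ (j , b)) u≢v u≢fv with i ≟ j
      ... | yes refl = same a b (u≢v ∘ cong (λ c → inj₂ (i , c))) (u≢fv ∘ cong (λ c → inj₂ (i , c)))
        where
        -- α vanishes at the representative and is 1 at its two successors.
        same : ∀ a b → b ≢ a → b ≢ rot a → missing (place (inj₂ (i , a))) (place (inj₂ (i , b))) ≡ away a b
        same 0F 0F p q = ⊥-elim (p refl)
        same 0F 1F p q = ⊥-elim (q refl)
        same 0F 2F p q with missing (elem i) (f (f (elem i))) | proj₂ (T-∧ {isOutside (elem i)} (sound i))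
        ... | false | _ = refl
        same 1F 0F p q = trans (cong (missing (f (elem i))) (sym (rep-cyclic (sound i)))) (proj₁ (rep-missing (sound i)))
        same 1F 1F p q = ⊥-elim (p refl)
        same 1F 2F p q = ⊥-elim (q refl)
        same 2F 0F p q = ⊥-elim (q refl)
        same 2F 1F p q = trans (cong (missing (f (f (elem i)))) (cong f (sym (rep-cyclic (sound i))))) (proj₂ (rep-missing (sound i)))
        same 2F 2F p q = ⊥-elim (p refl)
      ... | no i≢j = edges-outside (place v) (place u) (inj₁ (place-outside i a)) (u≢v ∘ place-injective u v)
          (λ eq → u≢fv (place-injective u (M.nextV v) (trans eq (sym (place-next v)))))
          (λ eq → i≢j (sym (first (place-injective u (M.nextV (M.nextV v))
            (trans eq (sym (trans (place-next (M.nextV v)) (cong f (place-next v)))))))))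
        where
        first : ∀ {j i : Fin k′} {b c : Fin 3} → _≡_ {A = M.V} (inj₂ (j , b)) (inj₂ (i , c)) → j ≡ i
        first refl = refl

      matched : k′ ≡ k → H ≅ Model.graph g k
      matched refl = ≅-starGraph {H = H} {f′ = M.f} {M.f-no-fix} {M.goneM} star relabel comm same
        where
        π = relabel
        comm : ∀ x → π ⟨$⟩ʳ f x ≡ M.f (π ⟨$⟩ʳ x)
        comm x = cong M.encode (place-injective (unplace (f x)) (M.nextV (M.decode (M.encode (unplace x)))) (begin
          place (unplace (f x))                                 ≡⟨ place-unplace (f x) ⟩
          f x                                                   ≡⟨ cong f (place-unplace x) ⟨
          f (place (unplace x))                                 ≡⟨ place-next (unplace x) ⟨
          place (M.nextV (unplace x))                           ≡⟨ cong (place ∘ M.nextV) (M.decode-encode (unplace x)) ⟨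
          place (M.nextV (M.decode (M.encode (unplace x))))     ∎))
          where open ≡-Reasoning
        π-injective : ∀ {x y} → π ⟨$⟩ʳ x ≡ π ⟨$⟩ʳ y → x ≡ y
        π-injective {x} {y} eq = trans (sym (place-unplace x)) (trans (cong place
          (trans (sym (M.decode-encode (unplace x))) (trans (cong M.decode eq) (M.decode-encode (unplace y))))) (place-unplace y))
        same : ∀ x b → edge H (f x) b x ≡ present M.f M.f-no-fix M.goneM (π ⟨$⟩ʳ x) (π ⟨$⟩ʳ b)
        same x b = by-cases (b ≟ x) (b ≟ f x)
          where
          open ≡-Reasoning
          loopless : ∀ {a b c} → ¬ (H ∋ a ∙ b ⟶ c) → edge H a b c ≡ false
          loopless {a} {b} {c} ¬e with edge H a b c
          ... | true  = ⊥-elim (¬e _)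
          ... | false = refl
          by-cases : Dec (b ≡ x) → Dec (b ≡ f x) → edge H (f x) b x ≡ present M.f M.f-no-fix M.goneM (π ⟨$⟩ʳ x) (π ⟨$⟩ʳ b)
          by-cases (yes refl) _ = trans (loopless λ e → proj₂ (proj₂ (distinct H _ _ _ e)) refl)
            (sym (present-self M.f M.f-no-fix M.goneM (π ⟨$⟩ʳ x)))
          by-cases (no _) (yes refl) = trans (loopless λ e → proj₁ (distinct H _ _ _ e) refl)
            (sym (trans (cong (present M.f M.f-no-fix M.goneM (π ⟨$⟩ʳ x)) (comm x)) (present-centre M.f M.f-no-fix M.goneM (π ⟨$⟩ʳ x))))
          by-cases (no b≢x) (no b≢fx) = begin
            edge H (f x) b x
              ≡⟨ Boolₚ.not-involutive _ ⟨
            not (not (edge H (f x) b x))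
              ≡⟨ cong not (missing-edge b≢x b≢fx) ⟨
            not (missing x b)
              ≡⟨ cong₂ (λ x b → not (missing x b)) (place-unplace x) (place-unplace b) ⟨
            not (missing (place (unplace x)) (place (unplace b)))
              ≡⟨ cong not (gone-place (unplace x) (unplace b)
                   (λ eq → b≢x (trans (sym (place-unplace b)) (trans (cong place eq) (place-unplace x))))
                   (λ eq → b≢fx (trans (sym (place-unplace b)) (trans (cong place eq)
                     (trans (place-next (unplace x)) (cong f (place-unplace x))))))) ⟩
            not (M.goneV (unplace x) (unplace b))
              ≡⟨ cong₂ (λ v u → not (M.goneV v u)) (M.decode-encode (unplace x)) (M.decode-encode (unplace b)) ⟨
            not (M.goneM (π ⟨$⟩ʳ x) (π ⟨$⟩ʳ b))
              ≡⟨ present-≢ M.f M.f-no-fix M.goneM (b≢x ∘ π-injective) (λ eq → b≢fx (π-injective (trans eq (sym (comm x))))) ⟨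
            present M.f M.f-no-fix M.goneM (π ⟨$⟩ʳ x) (π ⟨$⟩ʳ b) ∎

    -- The number `k′` of representatives is not known in advance. The bijection `relabel` onto
    -- `σ + k′ * 3` vertices forces it to be `k`.
    match : H ≅ Model.graph g k
    match = let k′ , reps = enumerate Rep in
      matched reps (sym (*-cancelʳ-≡ k k′ 3 (+-cancelˡ-≡ σ (k * 3) (k′ * 3) (↔⇒≡ (relabel reps)))))

-- Gadgets on four and five vertices

-- The part of an extremal graph that is not made of isolated 3-cycles of f is
-- the f-orbit of a single vertex: 0 → 1 → ⋯ → σ - 1, closed up either to a ring
-- or to a lasso ending in a 3-cycle.
record Shape (σ : ℕ) : Set where
  field
    next  : Fin σ → Fin σ
    tail  : Fin σ → Bool
    extra : Bool → Fin σ → Fin σ → Bool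

  -- The bit w a tells whether the triple {a, next a, next (next a)} is not
  -- assigned to a; extra decides the triple contested by the last tail vertex
  -- of a lasso and its rival in the 3-cycle.
  table : (Fin σ → Bool) → Bool → Fin σ → Fin σ → Bool
  table w g a b =
    if does (b ≟ next (next a)) then w a
    else if does (a ≟ next b) ∧ tail b then not (w b)
    else extra g a b

open Shape

ring₄ lasso₄ : Shape 4
ring₄ .next 0F = 1F
ring₄ .next 1F = 2F
ring₄ .next 2F = 3F
ring₄ .next 3F = 0F
ring₄ .tail  _     = true
ring₄ .extra _ _ _ = false

lasso₄ .next 0F = 1F
lasso₄ .next 1F = 2F
lasso₄ .next 2F = 3F
lasso₄ .next 3F = 1F
lasso₄ .tail 0F = true
lasso₄ .tail _  = false
lasso₄ .extra g 0F 3F = g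
lasso₄ .extra g 3F 0F = not g
lasso₄ .extra g _  _  = false

ring₅ lasso₅ : Shape 5
ring₅ .next 0F = 1F
ring₅ .next 1F = 2F
ring₅ .next 2F = 3F
ring₅ .next 3F = 4F
ring₅ .next 4F = 0F
ring₅ .tail  _     = true
ring₅ .extra _ _ _ = false

lasso₅ .next 0F = 1F
lasso₅ .next 1F = 2F
lasso₅ .next 2F = 3F
lasso₅ .next 3F = 4F
lasso₅ .next 4F = 2F
lasso₅ .tail 0F = true
lasso₅ .tail 1F = true
lasso₅ .tail _  = false
lasso₅ .extra g 1F 4F = g
lasso₅ .extra g 4F 1F = not g
lasso₅ .extra g _  _  = false

-- A code (r , w , g) selects the ring or the lasso by r.
Code : ℕ → Set
Code σ = Bool × Vec Bool σ × Bool

_≟ᶜ_ : ∀ {σ} → DecidableEquality (Code σ)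
_≟ᶜ_ = Productₚ.≡-dec Boolₚ._≟_ (Productₚ.≡-dec (Vecₚ.≡-dec Boolₚ._≟_) Boolₚ._≟_)

allBool? : {P : Bool → Set} → (∀ b → Dec (P b)) → Dec (∀ b → P b)
allBool? {P} P? with P? true | P? false
... | yes p | yes q = yes λ { true → p ; false → q }
... | no ¬p | _     = no λ f → ¬p (f true)
... | yes _ | no ¬q = no λ f → ¬q (f false)

allVec? : ∀ {m} {P : Vec Bool m → Set} → (∀ v → Dec (P v)) → Dec (∀ v → P v)
allVec? {zero} P? with P? []
... | yes p = yes λ { [] → p }
... | no ¬p = no λ f → ¬p (f [])
allVec? {suc m} P? with allBool? (λ b → allVec? (λ v → P? (b ∷ v)))
... | yes p = yes λ { (b ∷ v) → p b v }
... | no ¬p = no λ f → ¬p (λ b v → f (b ∷ v))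

iterate : ∀ {A : Set} → (A → A) → ℕ → A → A
iterate f zero    a = a
iterate f (suc m) a = f (iterate f m a)

module Family {σ N} (ring lasso : Shape (suc σ)) (codes : Vec (Code (suc σ)) N) where

  shape : Bool → Shape (suc σ)
  shape r = if r then ring else lasso

  code : Fin N → Code (suc σ)
  code = Vec.lookup codes

  nextᶜ : Code (suc σ) → Fin (suc σ) → Fin (suc σ)
  nextᶜ (r , _ , _) = next (shape r)

  goneᶜ : Code (suc σ) → Fin (suc σ) → Fin (suc σ) → Bool
  goneᶜ (r , w , g) = table (shape r) (Vec.lookup w) g

  presentᶜ : Code (suc σ) → Fin (suc σ) → Fin (suc σ) → Bool
  presentᶜ c a b = not (does (b ≟ a)) ∧ (not (does (b ≟ nextᶜ c a)) ∧ not (goneᶜ c a b))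

  -- The first five conditions are the fields of `Gadget`, with the transparent `Sum.sum` so that
  -- they can be decided by evaluation. The last two say that vertex 0 reaches `a` in `a` steps and
  -- is not on a 3-cycle; they serve to separate the models.
  Valid : Code (suc σ) → Set
  Valid c = (∀ a → nextᶜ c a ≢ a) × (∀ a → nextᶜ c (nextᶜ c a) ≢ a) ×
    (∀ a → T (goneᶜ c a (nextᶜ c (nextᶜ c a)) ∨ goneᶜ c (nextᶜ c a) a)) ×
    (∀ a b → nextᶜ c a ≡ nextᶜ c b → a ≢ b → T (goneᶜ c a b ∨ goneᶜ c b a)) ×
    (Sum.sum λ a → Sum.sum λ b → 𝟙 (goneᶜ c a b)) ≤ suc σ ×
    (∀ a → iterate (nextᶜ c) (toℕ a) zero ≡ a) × nextᶜ c (nextᶜ c (nextᶜ c zero)) ≢ zero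

  valid? : ∀ c → Dec (Valid c)
  valid? c = all? (λ a → ¬? (_ ≟ _)) ×-dec (all? (λ a → ¬? (_ ≟ _)) ×-dec (all? (λ a → T? _) ×-dec
    (all? (λ a → all? λ b → (_ ≟ _) →-dec (¬? (a ≟ b) →-dec T? _)) ×-dec ((_ ≤? _) ×-dec
    (all? (λ a → _ ≟ _) ×-dec ¬? (_ ≟ _))))))

  -- Vertex 0 generates its orbit, so an isomorphism is determined by its image j.
  Isomorphic : Code (suc σ) → Code (suc σ) → Fin (suc σ) → Set
  Isomorphic c d j =
    (∀ a → h (nextᶜ c a) ≡ nextᶜ d (h a)) × (∀ a b → presentᶜ c a b ≡ presentᶜ d (h a) (h b))
    where
    h : Fin (suc σ) → Fin (suc σ)
    h a = iterate (nextᶜ d) (toℕ a) j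

  isomorphic? : ∀ c d j → Dec (Isomorphic c d j)
  isomorphic? c d j = all? (λ a → _ ≟ _) ×-dec all? λ a → all? λ b → _ Boolₚ.≟ _

  turn : Fin (suc σ) → Fin (suc σ) → Fin (suc σ)
  turn j = iterate (next ring) (toℕ j)

  Turning : Set
  Turning = ∀ j → (∀ a b → turn j a ≡ turn j b → a ≡ b) × (∀ a → ∃[ b ] turn j b ≡ a)

  turning? : Dec Turning
  turning? = all? λ j →
    all? (λ a → all? λ b → (turn j a ≟ turn j b) →-dec (a ≟ b)) ×-dec all? λ a → any? λ b → turn j b ≟ a

  -- A ring has no distinguished starting vertex, so its bits matter only up to rotation.
  RingsCovered : Set
  RingsCovered = ∀ w → ∃[ j ] ∃[ i ] code i ≡ (true , tabulate (Vec.lookup w ∘ turn j) , false)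

  ringsCovered? : Dec RingsCovered
  ringsCovered? = allVec? λ w → any? λ j → any? λ i →
    code i ≟ᶜ (true , tabulate (Vec.lookup w ∘ turn j) , false)

  -- Exactly two bits set among the three of the 3-cycle is what tightness leaves: one vertex of it
  -- receives the triple.
  LassosCovered : Fin (suc σ) → Set
  LassosCovered t = ∀ g w →
    𝟙 (Vec.lookup w t) + 𝟙 (Vec.lookup w (next lasso t)) + 𝟙 (Vec.lookup w (next lasso (next lasso t))) ≡ 2 →
    ∃[ i ] code i ≡ (false , w , g)

  lassosCovered? : ∀ t → Dec (LassosCovered t)
  lassosCovered? t = allBool? λ g → allVec? λ w →
    (𝟙 (Vec.lookup w t) + 𝟙 (Vec.lookup w (next lasso t)) + 𝟙 (Vec.lookup w (next lasso (next lasso t))) ≟ℕ 2)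
      →-dec any? λ i → code i ≟ᶜ (false , w , g)

  -- t is the first vertex of the 3-cycle of the lasso.
  record Complete (t : Fin (suc σ)) : Set where
    field
      valid         : ∀ i → Valid (code i)
      separated     : ∀ i i′ j → Isomorphic (code i) (code i′) j → i ≡ i′
      turning       : Turning
      ringsCovered  : RingsCovered
      lassosCovered : LassosCovered t

-- The rings are the 6 binary necklaces of length 4, normalised to end in `false`. For the lassos,
-- one of the three vertices of the 3-cycle receives its triple, and the bit of the tail vertex and
-- the bit of the extra contest are free: 3 · 2 · 2 = 12.
codes₄ : Vec (Code 4) 18
codes₄ =
  (true , true ∷ true ∷ true ∷ true ∷ [] , false) ∷
  (true , true ∷ true ∷ true ∷ false ∷ [] , false) ∷
  (true , true ∷ true ∷ false ∷ false ∷ [] , false) ∷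
  (true , true ∷ false ∷ true ∷ false ∷ [] , false) ∷
  (true , true ∷ false ∷ false ∷ false ∷ [] , false) ∷
  (true , false ∷ false ∷ false ∷ false ∷ [] , false) ∷
  Vec.concat (Vec.map (λ w →
    (false , true  ∷ w , true)  ∷ (false , true  ∷ w , false) ∷
    (false , false ∷ w , true)  ∷ (false , false ∷ w , false) ∷ [])
    ((false ∷ true ∷ true ∷ []) ∷ (true ∷ false ∷ true ∷ []) ∷ (true ∷ true ∷ false ∷ []) ∷ []))

-- There are 8 binary necklaces of length 5. A lasso has two tail bits here, which gives 3 · 2 · 2 ·
-- 2 = 24.
codes₅ : Vec (Code 5) 32
codes₅ =
  (true , true ∷ true ∷ true ∷ true ∷ true ∷ [] , false) ∷
  (true , true ∷ true ∷ true ∷ true ∷ false ∷ [] , false) ∷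
  (true , true ∷ true ∷ true ∷ false ∷ false ∷ [] , false) ∷
  (true , true ∷ true ∷ false ∷ true ∷ false ∷ [] , false) ∷
  (true , true ∷ true ∷ false ∷ false ∷ false ∷ [] , false) ∷
  (true , true ∷ false ∷ true ∷ false ∷ false ∷ [] , false) ∷
  (true , true ∷ false ∷ false ∷ false ∷ false ∷ [] , false) ∷
  (true , false ∷ false ∷ false ∷ false ∷ false ∷ [] , false) ∷
  Vec.concat (Vec.map (λ w →
    (false , true  ∷ true  ∷ w , true)  ∷ (false , true  ∷ true  ∷ w , false) ∷
    (false , true  ∷ false ∷ w , true)  ∷ (false , true  ∷ false ∷ w , false) ∷
    (false , false ∷ true  ∷ w , true)  ∷ (false , false ∷ true  ∷ w , false) ∷
    (false , false ∷ false ∷ w , true)  ∷ (false , false ∷ false ∷ w , false) ∷ [])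
    ((false ∷ true ∷ true ∷ []) ∷ (true ∷ false ∷ true ∷ []) ∷ (true ∷ true ∷ false ∷ []) ∷ []))

module Family₄ = Family ring₄ lasso₄ codes₄
module Family₅ = Family ring₅ lasso₅ codes₅

opaque
  -- Exhaustive evaluation; opacity keeps these large proofs from being unfolded again.
  complete₄ : Family₄.Complete 1F
  complete₄ = record
    { valid         = from-yes (all? λ i → valid? (code i))
    ; separated     = from-yes (all? λ i → all? λ i′ → all? λ j → isomorphic? (code i) (code i′) j →-dec (i ≟ i′))
    ; turning       = from-yes turning?
    ; ringsCovered  = from-yes ringsCovered?
    ; lassosCovered = from-yes (lassosCovered? 1F)
    }
    where open Family₄

  complete₅ : Family₅.Complete 2F
  complete₅ = record
    { valid         = from-yes (all? λ i → valid? (code i))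
    ; separated     = from-yes (all? λ i → all? λ i′ → all? λ j → isomorphic? (code i) (code i′) j →-dec (i ≟ i′))
    ; turning       = from-yes turning?
    ; ringsCovered  = from-yes ringsCovered?
    ; lassosCovered = from-yes (lassosCovered? 2F)
    }
    where open Family₅

-- Isomorphisms between models

T-ext : ∀ {a b} → (T a → T b) → (T b → T a) → a ≡ b
T-ext {true}  {true}  f g = refl
T-ext {true}  {false} f g = ⊥-elim (f _)
T-ext {false} {true}  f g = ⊥-elim (g _)
T-ext {false} {false} f g = refl

module Comparison {σ k} (g g′ : Gadget σ)
  (iso : Model.graph g (suc (suc k)) ≅ Model.graph g′ (suc (suc k))) where

  private
    module M  = Model g (suc (suc k))
    module M′ = Model g′ (suc (suc k))
    module G  = Gadget g
    module G′ = Gadget g′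

    π = proj₁ iso

    hom : ∀ a b c → M.graph ∋ a ∙ b ⟶ c → M′.graph ∋ (π ⟨$⟩ʳ a) ∙ (π ⟨$⟩ʳ b) ⟶ (π ⟨$⟩ʳ c)
    hom a b c = Equivalence.to (proj₂ iso a b c)

    hom⁻ : ∀ a b c → M′.graph ∋ (π ⟨$⟩ʳ a) ∙ (π ⟨$⟩ʳ b) ⟶ (π ⟨$⟩ʳ c) → M.graph ∋ a ∙ b ⟶ c
    hom⁻ a b c = Equivalence.from (proj₂ iso a b c)

    present-M present-M′ : Fin (σ + suc (suc k) * 3) → Fin (σ + suc (suc k) * 3) → Bool
    present-M  = present M.f M.f-no-fix M.goneM
    present-M′ = present M′.f M′.f-no-fix M′.goneM

    π-injective : ∀ {x y} → π ⟨$⟩ʳ x ≡ π ⟨$⟩ʳ y → x ≡ y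
    π-injective eq = trans (sym (inverseˡ π)) (trans (cong (π ⟨$⟩ˡ_) eq) (inverseˡ π))

    -- Picks an isolated 3-cycle that avoids the given vertex. Each of its vertices forms a tail
    -- with the centre there, which supplies the two tails that pin the centre down.
    elsewhere : M.V → Fin (suc (suc k))
    elsewhere (inj₁ _)             = zero
    elsewhere (inj₂ (zero , _))    = suc zero
    elsewhere (inj₂ (suc _ , _))   = zero

    spare : ∀ v c → T (present-M (M.encode v) (M.encode (inj₂ (elsewhere v , c))))
    spare v c = ∧-T (not-T (_ ≟ _) (λ eq → off v (code-injective eq)))
      (∧-T (not-T (_ ≟ _) (λ eq → off-next v (trans (code-injective eq) (cong M.nextV (M.decode-encode v)))))
        (subst₂ (λ v u → T (not (M.goneV v u))) (sym (M.decode-encode v))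
          (sym (M.decode-encode (inj₂ (elsewhere v , c)))) (kept v)))
      where
      code-injective : ∀ {u w} → M.encode u ≡ M.encode w → u ≡ w
      code-injective {u} {w} eq = trans (sym (M.decode-encode u)) (trans (cong M.decode eq) (M.decode-encode w))
      off : ∀ v → inj₂ (elsewhere v , c) ≢ v
      off (inj₂ (zero , _))  ()
      off (inj₂ (suc _ , _)) ()
      off-next : ∀ v → inj₂ (elsewhere v , c) ≢ M.nextV v
      off-next (inj₂ (zero , _))  ()
      off-next (inj₂ (suc _ , _)) ()
      kept : ∀ v → T (not (M.goneV v (inj₂ (elsewhere v , c))))
      kept (inj₁ _)           = _
      kept (inj₂ (zero , _))  = _
      kept (inj₂ (suc _ , _)) = _

    -- The centre of x is determined by the edges, since x has two tails.
    commutes : ∀ x → π ⟨$⟩ʳ M.f x ≡ M′.f (π ⟨$⟩ʳ x)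
    commutes x = by-cases (hit zero) (hit (suc zero))
      where
      b : Fin 3 → Fin _
      b c = M.encode (inj₂ (elsewhere (M.decode x) , c))
      hit : ∀ c → π ⟨$⟩ʳ M.f x ≡ M′.f (π ⟨$⟩ʳ x) ⊎ π ⟨$⟩ʳ b c ≡ M′.f (π ⟨$⟩ʳ x)
      hit c = proj₂ (M′.graph-centre (π ⟨$⟩ʳ x)) _ _ (hom (M.f x) (b c) x
        (subst T (sym (starGraph-edge M.f M.f-no-fix M.goneM x (b c)))
          (subst (λ y → T (present-M y (b c))) (M.encode-decode x) (spare (M.decode x) c))))
      by-cases : π ⟨$⟩ʳ M.f x ≡ M′.f (π ⟨$⟩ʳ x) ⊎ π ⟨$⟩ʳ b zero ≡ M′.f (π ⟨$⟩ʳ x) →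
                 π ⟨$⟩ʳ M.f x ≡ M′.f (π ⟨$⟩ʳ x) ⊎ π ⟨$⟩ʳ b (suc zero) ≡ M′.f (π ⟨$⟩ʳ x) →
                 π ⟨$⟩ʳ M.f x ≡ M′.f (π ⟨$⟩ʳ x)
      by-cases (inj₁ p) _        = p
      by-cases (inj₂ _) (inj₁ q) = q
      by-cases (inj₂ p) (inj₂ q) with trans (sym (M.decode-encode (inj₂ (elsewhere (M.decode x) , zero))))
        (trans (cong M.decode (π-injective (trans p (sym q)))) (M.decode-encode (inj₂ (elsewhere (M.decode x) , suc zero))))
      ... | ()

  present-π : ∀ x b → present-M x b ≡ present-M′ (π ⟨$⟩ʳ x) (π ⟨$⟩ʳ b)
  present-π x b = begin
      present-M x b                                   ≡⟨ starGraph-edge M.f M.f-no-fix M.goneM x b ⟨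
      edge M.graph (M.f x) b x                        ≡⟨ T-ext (hom _ _ _) (hom⁻ _ _ _) ⟩
      edge M′.graph (π ⟨$⟩ʳ M.f x) (π ⟨$⟩ʳ b) (π ⟨$⟩ʳ x) ≡⟨ cong (λ y → edge M′.graph y (π ⟨$⟩ʳ b) (π ⟨$⟩ʳ x)) (commutes x) ⟩
      edge M′.graph (M′.f (π ⟨$⟩ʳ x)) (π ⟨$⟩ʳ b) (π ⟨$⟩ʳ x) ≡⟨ starGraph-edge M′.f M′.f-no-fix M′.goneM (π ⟨$⟩ʳ x) (π ⟨$⟩ʳ b) ⟩
      present-M′ (π ⟨$⟩ʳ x) (π ⟨$⟩ʳ b)                ∎
      where open ≡-Reasoning

  private
    f-encode : ∀ a → M.f (M.encode (inj₁ a)) ≡ M.encode (inj₁ (G.next a))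
    f-encode a = cong (M.encode ∘ M.nextV) (M.decode-encode (inj₁ a))

  -- The isomorphism commutes with the centre maps, hence preserves being fixed by the third
  -- iterate; all vertices of the isolated 3-cycles of the target are so fixed.
  root-image : ∀ {a} → G.next (G.next (G.next a)) ≢ a →
    ∃[ j ] π ⟨$⟩ʳ M.encode (inj₁ a) ≡ M′.encode (inj₁ j)
  root-image {a} acyclic with M′.decode (π ⟨$⟩ʳ M.encode (inj₁ a)) in eq
  ... | inj₁ j = j , trans (sym (M′.encode-decode _)) (cong M′.encode eq)
  ... | inj₂ (i , c) = ⊥-elim (acyclic (inj₁-injective
      (trans (sym (M.decode-encode _)) (trans (cong M.decode (π-injective cube)) (M.decode-encode _)))))
    where
    x = M.encode (inj₁ a)
    cube : π ⟨$⟩ʳ M.encode (inj₁ (G.next (G.next (G.next a)))) ≡ π ⟨$⟩ʳ x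
    cube = begin
      π ⟨$⟩ʳ M.encode (inj₁ (G.next (G.next (G.next a))))
        ≡⟨ cong (π ⟨$⟩ʳ_) (trans (cong (M.f ∘ M.f) (f-encode a)) (trans (cong M.f (f-encode (G.next a))) (f-encode _))) ⟨
      π ⟨$⟩ʳ M.f (M.f (M.f x))
        ≡⟨ trans (commutes _) (cong M′.f (trans (commutes _) (cong M′.f (commutes x)))) ⟩
      M′.f (M′.f (M′.f (π ⟨$⟩ʳ x)))
        ≡⟨ M′.encode-decode _ ⟨
      M′.encode (M′.decode (M′.f (M′.f (M′.f (π ⟨$⟩ʳ x)))))
        ≡⟨ cong M′.encode (trans (M′.decode-f _) (cong M′.nextV (trans (M′.decode-f _) (cong M′.nextV (M′.decode-f _))))) ⟩
      M′.encode (M′.nextV (M′.nextV (M′.nextV (M′.decode (π ⟨$⟩ʳ x)))))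
        ≡⟨ cong (M′.encode ∘ M′.nextV ∘ M′.nextV ∘ M′.nextV) eq ⟩
      M′.encode (inj₂ (i , rot (rot (rot c))))
        ≡⟨ cong (λ c → M′.encode (inj₂ (i , c))) (rot³ c) ⟩
      M′.encode (inj₂ (i , c))
        ≡⟨ cong M′.encode eq ⟨
      M′.encode (M′.decode (π ⟨$⟩ʳ x))
        ≡⟨ M′.encode-decode _ ⟩
      π ⟨$⟩ʳ x ∎
      where open ≡-Reasoning

  Carries : (Fin σ → Fin σ) → Set
  Carries h = ∀ a → π ⟨$⟩ʳ M.encode (inj₁ a) ≡ M′.encode (inj₁ (h a))

  private
    step : ∀ {a j} → π ⟨$⟩ʳ M.encode (inj₁ a) ≡ M′.encode (inj₁ j) →
      π ⟨$⟩ʳ M.encode (inj₁ (G.next a)) ≡ M′.encode (inj₁ (G′.next j))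
    step {a} {j} eq = trans (cong (π ⟨$⟩ʳ_) (sym (f-encode a))) (trans (commutes _)
      (trans (cong M′.f eq) (cong (M′.encode ∘ M′.nextV) (M′.decode-encode (inj₁ j)))))

    encode-injective : ∀ {a b} → M′.encode (inj₁ a) ≡ M′.encode (inj₁ b) → a ≡ b
    encode-injective eq = inj₁-injective
      (trans (sym (M′.decode-encode _)) (trans (cong M′.decode eq) (M′.decode-encode _)))

  carries-iterate : ∀ {r j} → π ⟨$⟩ʳ M.encode (inj₁ r) ≡ M′.encode (inj₁ j) →
    ∀ m → π ⟨$⟩ʳ M.encode (inj₁ (iterate G.next m r)) ≡ M′.encode (inj₁ (iterate G′.next m j))
  carries-iterate eq zero    = eq
  carries-iterate eq (suc m) = step (carries-iterate eq m)

  carries-next : ∀ {h} → Carries h → ∀ a → h (G.next a) ≡ G′.next (h a)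
  carries-next carries a = encode-injective (trans (sym (carries (G.next a))) (step (carries a)))

present-encode : ∀ {σ} (g : Gadget σ) k a b →
  present (Model.f g k) (Model.f-no-fix g k) (Model.goneM g k)
    (Model.encode g k (inj₁ a)) (Model.encode g k (inj₁ b)) ≡
  not (does (b ≟ a)) ∧ (not (does (b ≟ Gadget.next g a)) ∧ not (Gadget.gone g a b))
present-encode g k a b = cong₂ _∧_ (cong not (same b a))
  (cong₂ _∧_ (cong not (trans
      (cong (λ y → does (encode (inj₁ b) ≟ y)) (cong (encode ∘ nextV) (decode-encode (inj₁ a)))) (same b (Gadget.next g a))))
    (cong not (cong₂ goneV (decode-encode (inj₁ a)) (decode-encode (inj₁ b)))))
  where
  open Model g k
  same : ∀ a b → does (encode (inj₁ a) ≟ encode (inj₁ b)) ≡ does (a ≟ b)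
  same a b = does-⇔ (mk⇔ (λ eq → inj₁-injective (trans (sym (decode-encode _)) (trans (cong decode eq) (decode-encode _))))
    (cong (λ a → encode (inj₁ a)))) (_ ≟ _) (a ≟ b)

module Represent {σ N} {ring lasso : Shape (suc σ)} {codes : Vec (Code (suc σ)) N} {t}
  (complete : Family.Complete ring lasso codes t) where

  open Family ring lasso codes
  open Complete complete

  gadget : Fin N → Gadget (suc σ)
  gadget i = let v₁ , v₂ , v₃ , v₄ , v₅ , _ = valid i in record
    { next        = nextᶜ (code i)
    ; gone        = goneᶜ (code i)
    ; no-fix      = v₁
    ; no-2        = v₂
    ; consecutive = v₃
    ; same-next   = v₄
    ; total       = ≤-trans (≤-reflexive (trans (sum-cong λ a → sum≡ _) (sum≡ _))) v₅
    }

  model : ∀ k → Fin N → Graph (suc σ + k * 3)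
  model k i = Model.graph (gadget i) k

  -- Vertex 0 goes to some gadget vertex `j`, and then `a`, its a-th successor, goes to the a-th
  -- successor of `j`. The check `separated` has gone through all `j`.
  model-distinct : ∀ {k} i i′ → model (suc (suc k)) i ≅ model (suc (suc k)) i′ → i ≡ i′
  model-distinct {k} i i′ iso = let _ , _ , _ , _ , _ , generated , acyclic = valid i in
    by-root generated (C.root-image acyclic)
    where
    module C = Comparison {k = k} (gadget i) (gadget i′) iso
    module M = Model (gadget i) (suc (suc k))
    module M′ = Model (gadget i′) (suc (suc k))
    by-root : (∀ a → iterate (nextᶜ (code i)) (toℕ a) zero ≡ a) →
      (∃[ j ] proj₁ iso ⟨$⟩ʳ M.encode (inj₁ zero) ≡ M′.encode (inj₁ j)) → i ≡ i′
    by-root generated (j , eq) = separated i i′ j (C.carries-next carries , λ a b → begin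
      presentᶜ (code i) a b
        ≡⟨ present-encode (gadget i) (suc (suc k)) a b ⟨
      present M.f M.f-no-fix M.goneM (M.encode (inj₁ a)) (M.encode (inj₁ b))
        ≡⟨ C.present-π _ _ ⟩
      present M′.f M′.f-no-fix M′.goneM (π ⟨$⟩ʳ M.encode (inj₁ a)) (π ⟨$⟩ʳ M.encode (inj₁ b))
        ≡⟨ cong₂ (present M′.f M′.f-no-fix M′.goneM) (carries a) (carries b) ⟩
      present M′.f M′.f-no-fix M′.goneM (M′.encode (inj₁ (h a))) (M′.encode (inj₁ (h b)))
        ≡⟨ present-encode (gadget i′) (suc (suc k)) (h a) (h b) ⟩
      presentᶜ (code i′) (h a) (h b) ∎)
      where
      open ≡-Reasoning
      π = proj₁ iso
      h : Fin (suc σ) → Fin (suc σ)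
      h a = iterate (nextᶜ (code i′)) (toℕ a) j
      carries : C.Carries h
      carries a = subst (λ c → π ⟨$⟩ʳ M.encode (inj₁ c) ≡ M′.encode (inj₁ (h a))) (generated a)
        (C.carries-iterate eq (toℕ a))

-- Orbits in extremal graphs

≡ᶠ-injective : ∀ {m n} {o : Fin m → Fin n} → (∀ {a b} → o a ≡ o b → a ≡ b) →
  ∀ a b → [ o a ≡ᶠ o b ] ≡ [ a ≡ᶠ b ]
≡ᶠ-injective {o = o} inj a b = cong 𝟙 (does-⇔ (mk⇔ inj (cong o)) (o a ≟ o b) (a ≟ b))

𝟙-injective : ∀ {a b} → 𝟙 a ≡ 𝟙 b → a ≡ b
𝟙-injective {true}  {true}  _ = refl
𝟙-injective {false} {false} _ = refl

𝟙-complement : ∀ {a m} → 𝟙 a + m ≡ 1 → m ≡ 𝟙 (not a)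
𝟙-complement {true}  eq = suc-injective eq
𝟙-complement {false} eq = eq

T⇒≡ : ∀ {b} → T b → b ≡ true
T⇒≡ {true} _ = refl

table-cong : ∀ {σ} (sh : Shape σ) {w w′} g → (∀ a → w a ≡ w′ a) → ∀ a b → table sh w g a b ≡ table sh w′ g a b
table-cong sh g w≗w′ a b with does (b ≟ next sh (next sh a)) | does (a ≟ next sh b) ∧ tail sh b
... | true  | _     = w≗w′ a
... | false | true  = cong not (w≗w′ b)
... | false | false = refl

module Orbits {σ k} (H : Graph (σ + k * 3)) (oriented : Oriented H)
  (f : Fin (σ + k * 3) → Fin (σ + k * 3)) (star : ∀ x → Centre H (f x) x) (no2 : ∀ x → f (f x) ≢ x) where

  open Missing H f
  open Cycles f
  open Charging H oriented f star no2

  -- What the recognition of a model requires: the shape embedded in `f`, all vertices off the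
  -- 3-cycles covered, and `γ` reduced to the contest described by `extra`.
  record Orbit (sh : Shape σ) (g : Bool) : Set where
    field
      o           : Fin σ → Fin (σ + k * 3)
      o-injective : ∀ {a b} → o a ≡ o b → a ≡ b
      o-next      : ∀ a → o (next sh a) ≡ f (o a)
      covers      : ∀ x → (∀ a → o a ≢ x) → Cyclic x
      on-tail     : ∀ a → S (o a) ≡ tail sh a
      inside      : ∀ a b → γ (o a) (o b) ≡ 𝟙 (extra sh g a b)
      outside     : ∀ x b → (∀ a → o a ≢ x) ⊎ (∀ a → o a ≢ b) → γ x b ≡ 0

    bits : Fin σ → Bool
    bits a = missing (o a) (f (f (o a)))

  open Orbit

  -- Serves to rotate a ring until its bits form one of the listed necklaces; nothing but the bits
  -- distinguishes the vertices of a ring.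
  reindex : ∀ {sh g} → (∀ a b → extra sh g a b ≡ false) → (∀ a → tail sh a ≡ true) →
    (τ : Fin σ → Fin σ) → (∀ a b → τ a ≡ τ b → a ≡ b) → (∀ a → ∃[ b ] τ b ≡ a) →
    (∀ a → τ (next sh a) ≡ next sh (τ a)) → Orbit sh g → Orbit sh g
  reindex no-extra all-tail τ inj onto comm orb = record
    { o           = o orb ∘ τ
    ; o-injective = λ eq → inj _ _ (o-injective orb eq)
    ; o-next      = λ a → trans (cong (o orb) (comm a)) (o-next orb (τ a))
    ; covers      = λ x out → covers orb x (transport out)
    ; on-tail     = λ a → trans (on-tail orb (τ a)) (trans (all-tail (τ a)) (sym (all-tail a)))
    ; inside      = λ a b → trans (inside orb (τ a) (τ b)) (cong 𝟙 (trans (no-extra (τ a) (τ b)) (sym (no-extra a b))))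
    ; outside     = λ { x b (inj₁ out) → outside orb x b (inj₁ (transport out))
                      ; x b (inj₂ out) → outside orb x b (inj₂ (transport out)) }
    }
    where
    transport : ∀ {x} → (∀ a → o orb (τ a) ≢ x) → ∀ a → o orb a ≢ x
    transport out a eq with onto a
    ... | b , refl = out b eq

  module _ (cycle-tight : ∀ {x} → Cyclic x → α x + α (f x) + α (f (f x)) ≡ 2)
           (tail-tight : ∀ {x} → ¬ Cyclic x → α x + β x ≡ 1) where

    -- `α` is given by the bits, `β` at a tail vertex is the complementary bit by `tail-tight`, and
    -- every other missing pair is seen by `γ`, which the orbit prescribes.
    orbit-match : ∀ {sh g} (orb : Orbit sh g) (gd : Gadget σ) →
      (∀ a → Gadget.next gd a ≡ next sh a) →
      (∀ a b → Gadget.gone gd a b ≡ table sh (bits orb) g a b) → H ≅ Model.graph gd k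
    orbit-match {sh} {g} orb gd next≡ gone≡ = Match.match H star gd (o orb) (o-injective orb)
      (λ a → trans (cong (o orb) (next≡ a)) (o-next orb a))
      (covers orb) (λ x out → cycle-tight (covers orb x out)) edges-outside edges-inside
      where
      γ≡μ : ∀ x b → chargeable x b ≡ false → γ x b ≡ μ x b
      γ≡μ x b eq rewrite eq = refl
      edges-outside : ∀ x b → (∀ a → o orb a ≢ x) ⊎ (∀ a → o orb a ≢ b) →
        b ≢ x → b ≢ f x → b ≢ f (f x) → missing x b ≡ false
      edges-outside x b out _ _ b≢ffx = 𝟙-injective (trans (sym (γ≡μ x b uncharged)) (outside orb x b out))
        where
        -- A pair charged by `β` has `b` off the 3-cycles, so `b` lies in the orbit, and `x`, being
        -- `f b`, does too.
        in-orbit : (∀ a → o orb a ≢ x) ⊎ (∀ a → o orb a ≢ b) → x ≡ f b → ¬ Cyclic b → ⊥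
        in-orbit (inj₂ out) _ ¬c = ¬c (covers orb b out)
        in-orbit (inj₁ out) x≡fb ¬c with any? (λ a → o orb a ≟ b)
        ... | yes (a , eq) = out (next sh a) (trans (o-next orb a) (trans (cong f eq) (sym x≡fb)))
        ... | no  none     = ¬c (covers orb b λ a eq → none (a , eq))
        uncharged : chargeable x b ≡ false
        uncharged = cong₂ _∨_ (dec-false (b ≟ f (f x)) b≢ffx)
          (T-ext {does (x ≟ f b) ∧ S b} (λ t → in-orbit out (T-does (x ≟ f b) (proj₁ (T-∧ t))) (S⇒ (proj₂ (T-∧ {does (x ≟ f b)} t)))) λ ())
      edges-inside : ∀ a b → b ≢ a → b ≢ Gadget.next gd a → missing (o orb a) (o orb b) ≡ Gadget.gone gd a b
      edges-inside a b _ _ = trans (by-cases (b ≟ next sh (next sh a)) (a ≟ next sh b) (T? (tail sh b))) (sym (gone≡ a b))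
        where
        o-next² : o orb (next sh (next sh a)) ≡ f (f (o orb a))
        o-next² = trans (o-next orb (next sh a)) (cong f (o-next orb a))
        rest : b ≢ next sh (next sh a) → (does (a ≟ next sh b) ∧ tail sh b) ≡ false →
          missing (o orb a) (o orb b) ≡ table sh (bits orb) g a b
        rest b≢ no-β rewrite dec-false (b ≟ next sh (next sh a)) b≢ | no-β =
          𝟙-injective (trans (sym (γ≡μ (o orb a) (o orb b) (cong₂ _∨_
            (dec-false (o orb b ≟ f (f (o orb a))) (λ eq → b≢ (o-injective orb (trans eq (sym o-next²)))))
            (trans (cong₂ _∧_
              (does-⇔ (mk⇔ (λ eq → o-injective orb (trans eq (sym (o-next orb b)))) (λ eq → trans (cong (o orb) eq) (o-next orb b)))
                (o orb a ≟ f (o orb b)) (a ≟ next sh b)) (on-tail orb b)) no-β)))) (inside orb a b))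
        by-cases : Dec (b ≡ next sh (next sh a)) → Dec (a ≡ next sh b) → Dec (T (tail sh b)) →
          missing (o orb a) (o orb b) ≡ table sh (bits orb) g a b
        by-cases (yes refl) _ _ rewrite dec-true (b ≟ b) refl = cong (missing (o orb a)) o-next²
        by-cases (no b≢) (yes refl) (yes t) rewrite dec-false (b ≟ next sh (next sh a)) b≢ | dec-true (a ≟ a) refl | T⇒≡ t =
          trans (cong (λ y → missing y (o orb b)) (o-next orb b))
            (𝟙-injective (𝟙-complement (tail-tight (S⇒ (subst T (sym (on-tail orb b)) t)))))
        by-cases (no b≢) (yes refl) (no ¬t) = rest b≢ (trans (cong (does (a ≟ a) ∧_) (T-ext ¬t λ ())) (Boolₚ.∧-zeroʳ _))
        by-cases (no b≢) (no a≢)    _       = rest b≢ (cong (_∧ tail sh b) (dec-false (a ≟ next sh b) a≢))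

  module _ {w} (w∉C : ¬ Cyclic w) (fw∈C : Cyclic (f w)) (Γ≤1 : Γ ≤ 1) where

    lasso-bit : Bool
    lasso-bit = missing w (rival w∉C fw∈C)

    -- With `Γ ≤ 1` the contest between `w` and its rival exhausts `γ`, so a single bit describes
    -- it.
    lasso-orbit : ∀ (sh : Shape σ) (o : Fin σ → Fin (σ + k * 3)) (i₀ i₁ : Fin σ) →
      o i₀ ≡ w → o i₁ ≡ rival w∉C fw∈C →
      (∀ g a b → [ a ≡ᶠ i₀ ] * ([ b ≡ᶠ i₁ ] * 𝟙 g) + [ a ≡ᶠ i₁ ] * ([ b ≡ᶠ i₀ ] * 𝟙 (not g)) ≡ 𝟙 (extra sh g a b)) →
      (∀ {a b} → o a ≡ o b → a ≡ b) → (∀ a → o (next sh a) ≡ f (o a)) →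
      (∀ x → (∀ a → o a ≢ x) → Cyclic x) → (∀ a → S (o a) ≡ tail sh a) → Orbit sh lasso-bit
    lasso-orbit sh o i₀ i₁ o₀ o₁ extra≡ inj nxt cov tl = record
      { o = o ; o-injective = inj ; o-next = nxt ; covers = cov ; on-tail = tl
      ; inside = inside′ ; outside = outside′ }
      where
      γ₀ : γ w (rival w∉C fw∈C) ≡ 𝟙 lasso-bit
      γ₀ = γ-w-rival w∉C fw∈C
      γ₁ : γ (rival w∉C fw∈C) w ≡ 𝟙 (not lasso-bit)
      γ₁ = 𝟙-complement (trans (cong (_+ γ (rival w∉C fw∈C) w) (sym γ₀)) (γ+γ≡1 w∉C fw∈C Γ≤1))
      at : ∀ a i {y} → o i ≡ y → [ o a ≡ᶠ y ] ≡ [ a ≡ᶠ i ]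
      at a i refl = ≡ᶠ-injective inj a i
      inside′ : ∀ a b → γ (o a) (o b) ≡ 𝟙 (extra sh lasso-bit a b)
      inside′ a b = trans (sym (only≡γ w∉C fw∈C Γ≤1 (o a) (o b))) (trans
        (cong₂ _+_ (cong₂ _*_ (at a i₀ o₀) (cong₂ _*_ (at b i₁ o₁) γ₀))
                   (cong₂ _*_ (at a i₁ o₁) (cong₂ _*_ (at b i₀ o₀) γ₁)))
        (extra≡ lasso-bit a b))
      off : ∀ {x y} i → o i ≡ y → (∀ a → o a ≢ x) → [ x ≡ᶠ y ] ≡ 0
      off i eq out = ≡ᶠ-≢ λ x≡y → out i (trans eq (sym x≡y))
      outside′ : ∀ x b → (∀ a → o a ≢ x) ⊎ (∀ a → o a ≢ b) → γ x b ≡ 0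
      outside′ x b out = trans (sym (only≡γ w∉C fw∈C Γ≤1 x b)) (vanish out)
        where
        vanish : (∀ a → o a ≢ x) ⊎ (∀ a → o a ≢ b) → only w∉C fw∈C x b ≡ 0
        vanish (inj₁ out) = cong₂ (λ i j → i * ([ b ≡ᶠ rival w∉C fw∈C ] * γ w (rival w∉C fw∈C)) + j * ([ b ≡ᶠ w ] * γ (rival w∉C fw∈C) w)) (off i₀ o₀ out) (off i₁ o₁ out)
        vanish (inj₂ out) = trans
          (cong₂ (λ i j → [ x ≡ᶠ w ] * (i * γ w (rival w∉C fw∈C)) + [ x ≡ᶠ rival w∉C fw∈C ] * (j * γ (rival w∉C fw∈C) w)) (off i₁ o₁ out) (off i₀ o₀ out))
          (cong₂ _+_ (*-zeroʳ [ x ≡ᶠ w ]) (*-zeroʳ [ x ≡ᶠ rival w∉C fw∈C ]))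

  S-true : ∀ {x} → ¬ Cyclic x → S x ≡ true
  S-true ¬c = T⇒≡ (⇒S ¬c)

  S-false : ∀ {x} → Cyclic x → S x ≡ false
  S-false c = cong not (⇒C c)

  covers-list : ∀ {ys} → Unique ys → All (T ∘ S) ys → #S ≤ length ys →
    ∀ x → (∀ a → lookup ys a ≢ x) → Cyclic x
  covers-list {ys} uniq Sys #S≤ x out with cyclic? x
  ... | yes c = c
  ... | no ¬c = let x∈ = unique-covers S uniq Sys #S≤ (⇒S ¬c) in
                ⊥-elim (out (index x∈) (sym (lookup-index x∈)))

  module _ (Γ≡0 : Γ ≡ 0) where

    γ≡0 : ∀ x b → γ x b ≡ 0
    γ≡0 x b = n≤0⇒n≡0 (≤-trans (term≤sum (γ x) b) (≤-trans (term≤sum (λ x → sum (γ x)) x) (≤-reflexive Γ≡0)))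

    -- Two vertices with the same centre contest a triple whose two pairs both escape `α` and `β`,
    -- so `Γ` would be positive.
    f-injective : ∀ {x y} → f x ≡ f y → x ≡ y
    f-injective {x} {y} eq with x ≟ y
    ... | yes x≡y = x≡y
    ... | no  x≢y = ⊥-elim (1+n≰n (subst (1 ≤_) (cong₂ _+_ (vanish eq) (vanish (sym eq)))
            (Contests.same-centre oriented (no-fix x) (no-fix y) eq x≢y)))
      where
      vanish : ∀ {x y} → f x ≡ f y → μ x y ≡ 0
      vanish {x} {y} eq = trans (sym uncharged) (γ≡0 x y)
        where
        uncharged : γ x y ≡ μ x y
        uncharged rewrite dec-false (y ≟ f (f x)) (λ y≡ffx → no2 (f x) (sym (trans eq (cong f y≡ffx))))
          | dec-false (x ≟ f y) (λ x≡fy → no-fix x (trans eq (sym x≡fy))) = refl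

    acyclic-f : ∀ {x} → ¬ Cyclic x → ¬ Cyclic (f x)
    acyclic-f ¬c c = ¬c (f-injective c)

    ring-orbit : ∀ (sh : Shape σ) (o : Fin σ → Fin (σ + k * 3)) → (∀ a → tail sh a ≡ true) →
      (∀ a b → extra sh false a b ≡ false) → (∀ {a b} → o a ≡ o b → a ≡ b) →
      (∀ a → o (next sh a) ≡ f (o a)) → (∀ x → (∀ a → o a ≢ x) → Cyclic x) →
      (∀ a → ¬ Cyclic (o a)) → Orbit sh false
    ring-orbit sh o all-tail no-extra inj nxt cov acyclic = record
      { o = o ; o-injective = inj ; o-next = nxt ; covers = cov
      ; on-tail = λ a → trans (S-true (acyclic a)) (sym (all-tail a))
      ; inside  = λ a b → trans (γ≡0 (o a) (o b)) (cong 𝟙 (sym (no-extra a b)))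
      ; outside = λ x b _ → γ≡0 x b }

module Four {k} (H : Graph (4 + k * 3)) (oriented : Oriented H)
  (f : Fin (4 + k * 3) → Fin (4 + k * 3)) (star : ∀ x → Centre H (f x) x) (no2 : ∀ x → f (f x) ≢ x) where

  open Cycles f
  open Charging H oriented f star no2
  open Orbits {4} {k} H oriented f star no2

  lasso : ∀ {w} (w∉C : ¬ Cyclic w) (fw∈C : Cyclic (f w)) (Γ≤1 : Γ ≤ 1) → #S ≤ 1 →
    Σ[ orb ∈ Orbit lasso₄ (lasso-bit w∉C fw∈C Γ≤1) ] Cyclic (Orbit.o orb 1F)
  lasso {w} w∉C fw∈C Γ≤1 #S≤1 = lasso-orbit w∉C fw∈C Γ≤1 lasso₄ (lookup path) 0F 3F refl refl
    (from-yes (allBool? λ g → all? λ a → all? λ b →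
      ([ a ≡ᶠ 0F ] * ([ b ≡ᶠ 3F ] * 𝟙 g) + [ a ≡ᶠ 3F ] * ([ b ≡ᶠ 0F ] * 𝟙 (not g))) ≟ℕ 𝟙 (extra lasso₄ g a b)))
    (lookup-injective uniq) step
    (λ x out → covers-list ([] ∷ []) (⇒S w∉C ∷ []) #S≤1 x (λ { 0F → out 0F }))
    on-tail′ , fw∈C
    where
    path = w ∷ f w ∷ f (f w) ∷ f (f (f w)) ∷ []
    uniq : Unique path
    uniq = distinct₃ w∉C ∷ ((no-fix _ ∘ sym) ∷ (no2 _ ∘ sym) ∷ []) ∷ ((no-fix _ ∘ sym) ∷ []) ∷ [] ∷ []
    step : ∀ a → lookup path (next lasso₄ a) ≡ f (lookup path a)
    step 0F = refl
    step 1F = refl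
    step 2F = refl
    step 3F = sym fw∈C
    on-tail′ : ∀ a → S (lookup path a) ≡ tail lasso₄ a
    on-tail′ 0F = S-true w∉C
    on-tail′ 1F = S-false fw∈C
    on-tail′ 2F = S-false (cyclic-f fw∈C)
    on-tail′ 3F = S-false (cyclic-f (cyclic-f fw∈C))

  -- By injectivity the vertices off the 3-cycles are mapped to such vertices. The path of four
  -- exhausts them, so it must close up, and injectivity allows this only at its start.
  ring : Γ ≡ 0 → 1 ≤ #S → #S ≤ 4 → Orbit ring₄ false
  ring Γ≡0 1≤S S≤4 with find-outside S [] 1≤S
  ... | w , Sw , _ = ring-orbit Γ≡0 ring₄ (lookup path) (λ _ → refl) (λ _ _ → refl) (lookup-injective uniq) step
      (covers-list uniq Spath S≤4) acyclic
    where
    path = w ∷ f w ∷ f (f w) ∷ f (f (f w)) ∷ []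
    inj = f-injective Γ≡0
    c₀ = S⇒ Sw
    c₁ = acyclic-f Γ≡0 c₀
    c₂ = acyclic-f Γ≡0 c₁
    c₃ = acyclic-f Γ≡0 c₂
    uniq : Unique path
    uniq = distinct₃ c₀ ∷ ((no-fix _ ∘ sym) ∷ (no2 _ ∘ sym) ∷ []) ∷ ((no-fix _ ∘ sym) ∷ []) ∷ [] ∷ []
    acyclic : ∀ a → ¬ Cyclic (lookup path a)
    acyclic 0F = c₀
    acyclic 1F = c₁
    acyclic 2F = c₂
    acyclic 3F = c₃
    Spath : All (T ∘ S) path
    Spath = ⇒S c₀ ∷ ⇒S c₁ ∷ ⇒S c₂ ∷ ⇒S c₃ ∷ []
    returns : f (f (f (f w))) ∈ path → f (f (f (f w))) ≡ w
    returns (here eq)                         = eq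
    returns (there (here eq))                 = ⊥-elim (c₀ (inj eq))
    returns (there (there (here eq)))         = ⊥-elim (no2 w (inj (inj eq)))
    returns (there (there (there (here eq)))) = ⊥-elim (no-fix w (inj (inj (inj eq))))
    step : ∀ a → lookup path (next ring₄ a) ≡ f (lookup path a)
    step 0F = refl
    step 1F = refl
    step 2F = refl
    step 3F = sym (returns (unique-covers S uniq Spath S≤4 (⇒S (acyclic-f Γ≡0 c₃))))

module Five {k} (H : Graph (5 + k * 3)) (oriented : Oriented H)
  (f : Fin (5 + k * 3) → Fin (5 + k * 3)) (star : ∀ x → Centre H (f x) x) (no2 : ∀ x → f (f x) ≢ x) where

  open Cycles f
  open Charging H oriented f star no2
  open Orbits {5} {k} H oriented f star no2

  lasso : ∀ {u} → ¬ Cyclic u → (w∉C : ¬ Cyclic (f u)) (fw∈C : Cyclic (f (f u))) (Γ≤1 : Γ ≤ 1) → #S ≤ 2 →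
    Σ[ orb ∈ Orbit lasso₅ (lasso-bit w∉C fw∈C Γ≤1) ] Cyclic (Orbit.o orb 2F)
  lasso {u} u∉C w∉C fw∈C Γ≤1 #S≤2 = lasso-orbit w∉C fw∈C Γ≤1 lasso₅ (lookup path) 1F 4F refl refl
    (from-yes (allBool? λ g → all? λ a → all? λ b →
      ([ a ≡ᶠ 1F ] * ([ b ≡ᶠ 4F ] * 𝟙 g) + [ a ≡ᶠ 4F ] * ([ b ≡ᶠ 1F ] * 𝟙 (not g))) ≟ℕ 𝟙 (extra lasso₅ g a b)))
    (lookup-injective uniq) step
    (λ x out → covers-list (((no-fix u ∘ sym) ∷ []) ∷ [] ∷ []) (⇒S u∉C ∷ ⇒S w∉C ∷ []) #S≤2 x (λ { 0F → out 0F ; 1F → out 1F }))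
    on-tail′ , fw∈C
    where
    w = f u
    path = u ∷ w ∷ f w ∷ f (f w) ∷ f (f (f w)) ∷ []
    uniq : Unique path
    uniq = ((no-fix u ∘ sym) ∷ (no2 u ∘ sym) ∷ (u∉C ∘ sym)
             ∷ (λ eq → u∉C (subst Cyclic (sym eq) (cyclic-f (cyclic-f fw∈C)))) ∷ [])
         ∷ distinct₃ w∉C ∷ ((no-fix _ ∘ sym) ∷ (no2 _ ∘ sym) ∷ []) ∷ ((no-fix _ ∘ sym) ∷ []) ∷ [] ∷ []
    step : ∀ a → lookup path (next lasso₅ a) ≡ f (lookup path a)
    step 0F = refl
    step 1F = refl
    step 2F = refl
    step 3F = refl
    step 4F = sym fw∈C
    on-tail′ : ∀ a → S (lookup path a) ≡ tail lasso₅ a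
    on-tail′ 0F = S-true u∉C
    on-tail′ 1F = S-true w∉C
    on-tail′ 2F = S-false fw∈C
    on-tail′ 3F = S-false (cyclic-f fw∈C)
    on-tail′ 4F = S-false (cyclic-f (cyclic-f fw∈C))

  -- Two tail vertices with centres on 3-cycles would force Γ ≥ 2.
  lasso-root : #S ≡ 2 → Γ ≤ 1 → ∃[ u ] (¬ Cyclic u × ¬ Cyclic (f u) × Cyclic (f (f u)))
  lasso-root #S≡2 Γ≤1 with exit (subst (1 ≤_) (sym #S≡2) (s≤s z≤n)) (≤-reflexive #S≡2)
  ... | w , w∉C , fw∈C with find-outside S (w ∷ []) (subst (2 ≤_) (sym #S≡2) ≤-refl)
  ...   | v , Sv , v∉ with cyclic? (f v)
  ...     | no fv∉C = v , S⇒ Sv , fv∉C , subst Cyclic (cong f (sym fv≡w)) fw∈C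
    where
    tail-pair : f v ∈ w ∷ v ∷ [] → f v ≡ w
    tail-pair (here eq)         = eq
    tail-pair (there (here eq)) = ⊥-elim (no-fix v eq)
    fv≡w : f v ≡ w
    fv≡w = tail-pair (unique-covers S (((λ w≡v → v∉ (here (sym w≡v))) ∷ []) ∷ [] ∷ []) (⇒S w∉C ∷ Sv ∷ []) (≤-reflexive #S≡2) (⇒S fv∉C))
  ...     | yes fv∈C = ⊥-elim (1+n≰n (subst (1 ≤_) (cong₂ _+_ (vanish-row (rival v∉C fv∈C)) (vanish-column (rival v∉C fv∈C))) (1≤γ+γ v∉C fv∈C)))
    where
    v∉C = S⇒ Sv
    v≢w : v ≢ w
    v≢w = v∉ ∘ here
    v≢rw : v ≢ rival w∉C fw∈C
    v≢rw eq = v∉C (subst Cyclic (sym eq) (rival-cyclic w∉C fw∈C))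
    r = rival w∉C fw∈C
    vanish-row : ∀ b → γ v b ≡ 0
    vanish-row b = trans (sym (only≡γ w∉C fw∈C Γ≤1 v b)) (cong₂
      (λ i j → i * ([ b ≡ᶠ r ] * γ w r) + j * ([ b ≡ᶠ w ] * γ r w)) (≡ᶠ-≢ v≢w) (≡ᶠ-≢ v≢rw))
    vanish-column : ∀ x → γ x v ≡ 0
    vanish-column x = trans (sym (only≡γ w∉C fw∈C Γ≤1 x v)) (trans (cong₂
      (λ i j → [ x ≡ᶠ w ] * (i * γ w r) + [ x ≡ᶠ r ] * (j * γ r w)) (≡ᶠ-≢ v≢rw) (≡ᶠ-≢ v≢w))
      (cong₂ _+_ (*-zeroʳ [ x ≡ᶠ w ]) (*-zeroʳ [ x ≡ᶠ r ])))

  ring : Γ ≡ 0 → #S ≡ 5 → Orbit ring₅ false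
  ring Γ≡0 #S≡5 with find-outside S [] (subst (1 ≤_) (sym #S≡5) (s≤s z≤n))
  ... | w , Sw , _ = ring-orbit Γ≡0 ring₅ (lookup path) (λ _ → refl) (λ _ _ → refl) (lookup-injective uniq) step
      (covers-list uniq Spath S≤5) acyclic
    where
    short = w ∷ f w ∷ f (f w) ∷ f (f (f w)) ∷ []
    path = w ∷ f w ∷ f (f w) ∷ f (f (f w)) ∷ f (f (f (f w))) ∷ []
    S≤5 = ≤-reflexive #S≡5
    inj = f-injective Γ≡0
    c₀ = S⇒ Sw
    c₁ = acyclic-f Γ≡0 c₀
    c₂ = acyclic-f Γ≡0 c₁
    c₃ = acyclic-f Γ≡0 c₂
    c₄ = acyclic-f Γ≡0 c₃
    short-uniq : Unique short
    short-uniq = distinct₃ c₀ ∷ ((no-fix _ ∘ sym) ∷ (no2 _ ∘ sym) ∷ []) ∷ ((no-fix _ ∘ sym) ∷ []) ∷ [] ∷ []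
    S-short : All (T ∘ S) short
    S-short = ⇒S c₀ ∷ ⇒S c₁ ∷ ⇒S c₂ ∷ ⇒S c₃ ∷ []
    -- A 4-ring would leave room for only one further tail vertex x, but f x
    -- is a tail vertex outside the ring too.
    not-four : f (f (f (f w))) ≢ w
    not-four f⁴w≡w with find-outside S short (subst (5 ≤_) (sym #S≡5) ≤-refl)
    ... | x , Sx , x∉ = 1+n≰n (subst (6 ≤_) #S≡5 (unique-length≤ S
          (((no-fix x) ∷ ¬Any⇒All¬ short fx∉) ∷ ¬Any⇒All¬ short x∉ ∷ short-uniq)
          (⇒S (acyclic-f Γ≡0 (S⇒ Sx)) ∷ Sx ∷ S-short)))
      where
      fx∉ : f x ∉ short
      fx∉ (here eq)                         = x∉ (there (there (there (here (inj (trans eq (sym f⁴w≡w)))))))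
      fx∉ (there (here eq))                 = x∉ (here (inj eq))
      fx∉ (there (there (here eq)))         = x∉ (there (here (inj eq)))
      fx∉ (there (there (there (here eq)))) = x∉ (there (there (here (inj eq))))
    uniq : Unique path
    uniq = ((no-fix w ∘ sym) ∷ (no2 w ∘ sym) ∷ (c₀ ∘ sym) ∷ (not-four ∘ sym) ∷ [])
         ∷ distinct₃ c₁ ∷ ((no-fix _ ∘ sym) ∷ (no2 _ ∘ sym) ∷ []) ∷ ((no-fix _ ∘ sym) ∷ []) ∷ [] ∷ []
    acyclic : ∀ a → ¬ Cyclic (lookup path a)
    acyclic 0F = c₀
    acyclic 1F = c₁
    acyclic 2F = c₂
    acyclic 3F = c₃
    acyclic 4F = c₄
    Spath : All (T ∘ S) path
    Spath = ⇒S c₀ ∷ ⇒S c₁ ∷ ⇒S c₂ ∷ ⇒S c₃ ∷ ⇒S c₄ ∷ []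
    returns : f (f (f (f (f w)))) ∈ path → f (f (f (f (f w)))) ≡ w
    returns (here eq)                                 = eq
    returns (there (here eq))                         = ⊥-elim (not-four (inj eq))
    returns (there (there (here eq)))                 = ⊥-elim (c₀ (inj (inj eq)))
    returns (there (there (there (here eq))))         = ⊥-elim (no2 w (inj (inj (inj eq))))
    returns (there (there (there (there (here eq))))) = ⊥-elim (no-fix w (inj (inj (inj (inj eq)))))
    step : ∀ a → lookup path (next ring₅ a) ≡ f (lookup path a)
    step 0F = refl
    step 1F = refl
    step 2F = refl
    step 3F = refl
    step 4F = sym (returns (unique-covers S uniq Spath S≤5 (⇒S (acyclic-f Γ≡0 c₄))))

-- Extremal graphs

iterate-comm : ∀ {A : Set} (f : A → A) m a → iterate f m (f a) ≡ f (iterate f m a)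
iterate-comm f zero    a = refl
iterate-comm f (suc m) a = cong f (iterate-comm f m a)

module _ {σ N} {ring lasso : Shape (suc σ)} {codes : Vec (Code (suc σ)) N} {t}
  (complete : Family.Complete ring lasso codes t) {k} (H : Graph (suc σ + k * 3)) (oriented : Oriented H)
  (f : Fin (suc σ + k * 3) → Fin (suc σ + k * 3)) (star : ∀ x → Centre H (f x) x) (no2 : ∀ x → f (f x) ≢ x) where

  open Family ring lasso codes
  open Complete complete
  open Represent complete
  open Cycles f
  open Missing H f
  open Charging H oriented f star no2
  open Orbits {suc σ} {k} H oriented f star no2
  open Orbit

  module _ (cycle-tight : ∀ {x} → Cyclic x → α x + α (f x) + α (f (f x)) ≡ 2)
           (tail-tight : ∀ {x} → ¬ Cyclic x → α x + β x ≡ 1) where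

    ring-classified : (∀ a → tail ring a ≡ true) → (∀ a b → extra ring false a b ≡ false) →
      Orbit ring false → ∃[ i ] H ≅ model k i
    ring-classified all-tail no-extra orb with ringsCovered (tabulate (bits orb))
    ... | j , i , eq = i , orbit-match cycle-tight tail-tight turned (gadget i)
        (λ a → cong (λ c → nextᶜ c a) eq)
        (λ a b → trans (cong (λ c → goneᶜ c a b) eq) (table-cong ring false
          (λ a → trans (lookup∘tabulate (Vec.lookup (tabulate (bits orb)) ∘ turn j) a) (lookup∘tabulate (bits orb) (turn j a))) a b))
      where
      turned = reindex no-extra all-tail (turn j) (proj₁ (turning j)) (proj₂ (turning j))
        (iterate-comm (next ring) (toℕ j)) orb

    lasso-classified : ∀ {g} → Σ[ orb ∈ Orbit lasso g ] Cyclic (o orb t) → ∃[ i ] H ≅ model k i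
    lasso-classified {g} (orb , ct) with lassosCovered g (tabulate (bits orb)) (trans
        (cong₂ _+_ (cong₂ _+_ (bit t refl) (bit (next lasso t) next₁)) (bit (next lasso (next lasso t)) next₂))
        (cycle-tight ct))
      where
      next₁ = o-next orb t
      next₂ = trans (o-next orb (next lasso t)) (cong f next₁)
      bit : ∀ a {y} → o orb a ≡ y → 𝟙 (Vec.lookup (tabulate (bits orb)) a) ≡ α y
      bit a refl = cong 𝟙 (lookup∘tabulate (bits orb) a)
    ... | i , eq = i , orbit-match cycle-tight tail-tight orb (gadget i)
        (λ a → cong (λ c → nextᶜ c a) eq)
        (λ a b → trans (cong (λ c → goneᶜ c a b) eq) (table-cong lasso g (lookup∘tabulate (bits orb)) a b))

centred-or-few : ∀ {n} {H : Graph n} → Oriented H → Free I₀ H → 9 ≤ n →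
  edgeCount H + 3 * n ≤ n * n + 1 ⊎
  Σ[ f ∈ (Fin n → Fin n) ] (∀ x → Centre H (f x) x) × (∀ x → f (f x) ≢ x)
centred-or-few {n} {H} oriented free 9≤n with any? (λ v → tails H v ≤? 6)
... | yes (v , few) = inj₁ (few-tails {H = H} oriented free 9≤n v few)
... | no  none      = by-cases (any? (λ x → f (f x) ≟ x))
  where
  centred : ∀ x → ∃[ z ] Centre H z x
  centred x with star-or-few {H = H} free (≤-trans (s≤s (s≤s z≤n)) 9≤n) x
  ... | inj₁ c   = c
  ... | inj₂ few = ⊥-elim (none (x , few))
  f : Fin n → Fin n
  f x = proj₁ (centred x)
  by-cases : Dec (∃[ x ] f (f x) ≡ x) → edgeCount H + 3 * n ≤ n * n + 1 ⊎
    Σ[ f ∈ (Fin n → Fin n) ] (∀ x → Centre H (f x) x) × (∀ x → f (f x) ≢ x)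
  by-cases (yes (v , ffv≡v)) = inj₁ (two-cycle-bound {H = H} oriented free 9≤n {f} (λ x → proj₂ (centred x)) v ffv≡v)
  by-cases (no none′)        = inj₂ (f , (λ x → proj₂ (centred x)) , λ x ffx≡x → none′ (x , ffx≡x))

module Conclusion {σ k N} (9≤n : 9 ≤ σ + suc (suc k) * 3) (gadget : Fin N → Gadget σ) (i₀ : Fin N)
  (separated : ∀ i i′ → Model.graph (gadget i) (suc (suc k)) ≅ Model.graph (gadget i′) (suc (suc k)) → i ≡ i′)
  (excess : ∀ (H : Graph (σ + suc (suc k) * 3)) (oriented : Oriented H)
    (f : Fin (σ + suc (suc k) * 3) → Fin (σ + suc (suc k) * 3))
    (star : ∀ x → Centre H (f x) x) (no2 : ∀ x → f (f x) ≢ x) →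
    σ ≤ Cycles.#S f + 3 * Charging.Γ H oriented f star no2)
  (classify : ∀ (H : Graph (σ + suc (suc k) * 3)) (oriented : Oriented H)
    (f : Fin (σ + suc (suc k) * 3) → Fin (σ + suc (suc k) * 3))
    (star : ∀ x → Centre H (f x) x) (no2 : ∀ x → f (f x) ≢ x) →
    sum (Missing.loss H f) ≤ 2 * suc (suc k) + σ → ∃[ i ] H ≅ Model.graph (gadget i) (suc (suc k))) where

  private
    -- `deficit` is the extremal number subtracted from n²: 2n for the pairs with `b` equal to `x`
    -- or `f x`, and 2K + σ for the missing ones.
    K n deficit : ℕ
    K = suc (suc k)
    n = σ + K * 3
    deficit = 2 * K + σ + 2 * n

  -- The hypothesis means e ≤ n(n - 3) + 1, while the extremal value is n(n - 3) + K with K = k + 2.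
  few⇒below : ∀ {e} → e + 3 * n ≤ n * n + 1 → e + deficit < n * n
  few⇒below {e} few = by-identity k few (arith e k σ (n * n))
    where
    arith : ∀ e k σ m → 1 + (e + (2 * (2 + k) + σ + 2 * (σ + (2 + k) * 3))) + (m + 1) + k ≡
                        m + (e + 3 * (σ + (2 + k) * 3))
    arith = solve-∀

  edgeCount≤ : ∀ H → Oriented H → Free I₀ H → edgeCount H + deficit ≤ n * n
  edgeCount≤ H oriented free with centred-or-few {H = H} oriented free 9≤n
  ... | inj₁ few = <⇒≤ (few⇒below few)
  ... | inj₂ (f , star , no2) = begin
    edgeCount H + (2 * K + σ + 2 * n)                 ≡⟨ +-assoc (edgeCount H) (2 * K + σ) (2 * n) ⟨
    edgeCount H + (2 * K + σ) + 2 * n                 ≤⟨ +-monoˡ-≤ (2 * n) (+-monoʳ-≤ (edgeCount H)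
      (Charging.Excess.loss≥ H oriented f star no2 K σ refl (excess H oriented f star no2))) ⟩
    edgeCount H + sum (Missing.loss H f) + 2 * n      ≡⟨ Missing.edgeCount-loss H f star ⟩
    n * n                                             ∎
    where open ≤-Reasoning

  edgeCount-model : ∀ i → edgeCount (Model.graph (gadget i) K) + deficit ≡ n * n
  edgeCount-model i = ≤-antisym (edgeCount≤ M.graph M.graph-oriented M.graph-free)
    (subst (n * n ≤_) (+-assoc (edgeCount M.graph) (2 * K + σ) (2 * n)) M.graph-count)
    where module M = Model (gadget i) K

  isEx : ∀ {m} → m + deficit ≡ n * n → IsExₒ n I₀ m
  isEx eq = record
    { attained = M.graph , M.graph-oriented , M.graph-free ,
                 +-cancelʳ-≡ deficit _ _ (trans (edgeCount-model i₀) (sym eq))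
    ; bound    = λ H oriented free → +-cancelʳ-≤ deficit _ _
                   (subst (edgeCount H + deficit ≤_) (sym eq) (edgeCount≤ H oriented free))
    }
    where module M = Model (gadget i₀) K

  extremal-classified : ∀ H → Extremal I₀ H → ∃[ i ] H ≅ Model.graph (gadget i) K
  extremal-classified H (oriented , free , ex) = by-cases (centred-or-few {H = H} oriented free 9≤n)
    where
    module M = Model (gadget i₀) K
    -- Comparison with a model turns extremality into the bound 2K + σ on the loss.
    n*n≤ : n * n ≤ edgeCount H + deficit
    n*n≤ = subst (_≤ edgeCount H + deficit) (edgeCount-model i₀)
      (+-monoˡ-≤ deficit (IsExₒ.bound ex M.graph M.graph-oriented M.graph-free))
    by-cases : edgeCount H + 3 * n ≤ n * n + 1 ⊎
      Σ[ f ∈ (Fin n → Fin n) ] (∀ x → Centre H (f x) x) × (∀ x → f (f x) ≢ x) →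
      ∃[ i ] H ≅ Model.graph (gadget i) K
    by-cases (inj₁ few) = ⊥-elim (<⇒≱ (few⇒below few) n*n≤)
    by-cases (inj₂ (f , star , no2)) = classify H oriented f star no2
      (+-cancelˡ-≤ (edgeCount H) _ _ (+-cancelʳ-≤ (2 * n) _ _ (subst₂ _≤_
        (sym (Missing.edgeCount-loss H f star)) (sym (+-assoc (edgeCount H) (2 * K + σ) (2 * n))) n*n≤)))

  count-extremal : CountUpToIso {n} (Extremal I₀) N
  count-extremal = record
    { rep        = λ i → Model.graph (gadget i) K
    ; satisfies  = λ i → Model.graph-oriented (gadget i) K , Model.graph-free (gadget i) K , isEx (edgeCount-model i)
    ; distinct-≅ = separated
    ; complete   = extremal-classified
    }

  conclusion : ∀ {m} → m + deficit ≡ n * n → IsExₒ n I₀ m × CountUpToIso {n} (Extremal I₀) N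
  conclusion eq = isEx eq , count-extremal

-- The three residue classes modulo 3

module Residue₀ {k} (9≤n : 9 ≤ suc (suc k) * 3) where

  private
    K : ℕ
    K = suc (suc k)

  empty : Gadget 0
  empty = record { next = λ () ; gone = λ () ; no-fix = λ () ; no-2 = λ () ; consecutive = λ ()
                 ; same-next = λ () ; total = ≤-reflexive (sum≡ _) }

  classify : ∀ (H : Graph (K * 3)) oriented f star no2 → sum (Missing.loss H f) ≤ 2 * K + 0 →
    Σ[ i ∈ Fin 1 ] H ≅ Model.graph empty K
  classify H oriented f star no2 loss≤ = 0F , orbit-match Tight.cycle-tight Tight.tail-tight orbit empty (λ ()) (λ ())
    where
    open Cycles f
    open Charging H oriented f star no2
    module Tight = Excess.Tight K 0 refl z≤n loss≤
    open Orbits {0} {K} H oriented f star no2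
    Γ≡0 : Γ ≡ 0
    Γ≡0 = n≤0⇒n≡0 (≤-trans (m≤n*m Γ 3) (m+n≤o⇒n≤o #S Tight.excess≤))
    shape : Shape 0
    shape = record { next = λ () ; tail = λ () ; extra = λ _ () }
    orbit : Orbit shape false
    orbit = ring-orbit Γ≡0 shape (lookup []) (λ ()) (λ ()) (λ { {()} }) (λ ())
      (covers-list [] [] (m+n≤o⇒m≤o #S Tight.excess≤)) (λ ())

  gadget : Fin 1 → Gadget 0
  gadget _ = empty

  separated : ∀ (i i′ : Fin 1) → Model.graph (gadget i) K ≅ Model.graph (gadget i′) K → i ≡ i′
  separated 0F 0F _ = refl

  excess : ∀ (H : Graph (K * 3)) oriented f star no2 → 0 ≤ Cycles.#S f + 3 * Charging.Γ H oriented f star no2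
  excess _ _ _ _ _ = z≤n

  open Conclusion {0} {k} {1} 9≤n gadget 0F separated excess classify public
    using (conclusion)

-- The only admissible value below 4 is s = 1, and there the contest at the exit contributes 3.
excess₄ : ∀ s G → s % 3 ≡ 1 → (1 ≤ s → s ≤ 2 → 1 ≤ G) → 4 ≤ s + 3 * G
excess₄ 1 G _ exit = s≤s (*-monoʳ-≤ 3 (exit ≤-refl (s≤s z≤n)))
excess₄ (suc (suc (suc (suc s)))) G _ _ = m≤m+n 4 (s + 3 * G)

excess₅ : ∀ s G → s % 3 ≡ 2 → (1 ≤ s → s ≤ 2 → 1 ≤ G) → 5 ≤ s + 3 * G
excess₅ 2 G _ exit = s≤s (s≤s (*-monoʳ-≤ 3 (exit (s≤s z≤n) ≤-refl)))
excess₅ (suc (suc (suc (suc (suc s))))) G _ _ = m≤m+n 5 (s + 3 * G)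

split₄ : ∀ s G → s % 3 ≡ 1 → s + 3 * G ≤ 4 → (s ≡ 1 × G ≤ 1) ⊎ (s ≡ 4 × G ≡ 0)
split₄ 1 G _ (s≤s le) = inj₁ (refl , *-cancelˡ-≤ 3 le)
split₄ 4 G _ (s≤s (s≤s (s≤s (s≤s le)))) = inj₂ (refl , n≤0⇒n≡0 (≤-trans (m≤n*m G 3) le))
split₄ (suc (suc (suc (suc (suc s))))) G _ (s≤s (s≤s (s≤s (s≤s ()))))

split₅ : ∀ s G → s % 3 ≡ 2 → s + 3 * G ≤ 5 → (s ≡ 2 × G ≤ 1) ⊎ (s ≡ 5 × G ≡ 0)
split₅ 2 G _ (s≤s (s≤s le)) = inj₁ (refl , *-cancelˡ-≤ 3 le)
split₅ 5 G _ (s≤s (s≤s (s≤s (s≤s (s≤s le))))) = inj₂ (refl , n≤0⇒n≡0 (≤-trans (m≤n*m G 3) le))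
split₅ (suc (suc (suc (suc (suc (suc s)))))) G _ (s≤s (s≤s (s≤s (s≤s (s≤s ())))))

module Residue₁ {k} (9≤n : 9 ≤ 4 + suc (suc k) * 3) where

  private
    K : ℕ
    K = suc (suc k)

  module _ (H : Graph (4 + K * 3)) (oriented : Oriented H) (f : Fin (4 + K * 3) → Fin (4 + K * 3))
           (star : ∀ x → Centre H (f x) x) (no2 : ∀ x → f (f x) ≢ x) where

    open Cycles f
    open Charging H oriented f star no2

    #S%3≡1 : #S % 3 ≡ 1
    #S%3≡1 = trans (#S%3 no-fix) ([m+kn]%n≡m%n 4 K 3)

    excess : 4 ≤ #S + 3 * Γ
    excess = excess₄ #S Γ #S%3≡1 λ 1≤S S≤2 → let w , w∉C , fw∈C = exit 1≤S S≤2 in 1≤Γ w∉C fw∈C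

    classify : sum (Missing.loss H f) ≤ 2 * K + 4 → ∃[ i ] H ≅ Represent.model complete₄ K i
    classify loss≤ = by-cases (split₄ #S Γ #S%3≡1 T.excess≤)
      where
      module T = Excess.Tight K 4 refl excess loss≤
      by-cases : (#S ≡ 1 × Γ ≤ 1) ⊎ (#S ≡ 4 × Γ ≡ 0) → ∃[ i ] H ≅ Represent.model complete₄ K i
      by-cases (inj₁ (#S≡1 , Γ≤1)) =
        let w , w∉C , fw∈C = exit (≤-reflexive (sym #S≡1)) (≤-trans (≤-reflexive #S≡1) (s≤s z≤n))
        in lasso-classified complete₄ {K} H oriented f star no2 T.cycle-tight T.tail-tight
             (Four.lasso {K} H oriented f star no2 w∉C fw∈C Γ≤1 (≤-reflexive #S≡1))
      by-cases (inj₂ (#S≡4 , Γ≡0)) = ring-classified complete₄ {K} H oriented f star no2 T.cycle-tight T.tail-tight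
        (λ _ → refl) (λ _ _ → refl)
        (Four.ring {K} H oriented f star no2 Γ≡0 (≤-trans (s≤s z≤n) (≤-reflexive (sym #S≡4))) (≤-reflexive #S≡4))

  open Conclusion {4} {k} {18} 9≤n (Represent.gadget complete₄) 0F (Represent.model-distinct complete₄ {k})
    excess classify public using (conclusion)

module Residue₂ {k} (9≤n : 9 ≤ 5 + suc (suc k) * 3) where

  private
    K : ℕ
    K = suc (suc k)

  module _ (H : Graph (5 + K * 3)) (oriented : Oriented H) (f : Fin (5 + K * 3) → Fin (5 + K * 3))
           (star : ∀ x → Centre H (f x) x) (no2 : ∀ x → f (f x) ≢ x) where

    open Cycles f
    open Charging H oriented f star no2

    #S%3≡2 : #S % 3 ≡ 2
    #S%3≡2 = trans (#S%3 no-fix) ([m+kn]%n≡m%n 5 K 3)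

    excess : 5 ≤ #S + 3 * Γ
    excess = excess₅ #S Γ #S%3≡2 λ 1≤S S≤2 → let w , w∉C , fw∈C = exit 1≤S S≤2 in 1≤Γ w∉C fw∈C

    classify : sum (Missing.loss H f) ≤ 2 * K + 5 → ∃[ i ] H ≅ Represent.model complete₅ K i
    classify loss≤ = by-cases (split₅ #S Γ #S%3≡2 T.excess≤)
      where
      module T = Excess.Tight K 5 refl excess loss≤
      by-cases : (#S ≡ 2 × Γ ≤ 1) ⊎ (#S ≡ 5 × Γ ≡ 0) → ∃[ i ] H ≅ Represent.model complete₅ K i
      by-cases (inj₁ (#S≡2 , Γ≤1)) =
        let u , u∉C , w∉C , fw∈C = Five.lasso-root {K} H oriented f star no2 #S≡2 Γ≤1
        in lasso-classified complete₅ {K} H oriented f star no2 T.cycle-tight T.tail-tight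
             (Five.lasso {K} H oriented f star no2 u∉C w∉C fw∈C Γ≤1 (≤-reflexive #S≡2))
      by-cases (inj₂ (#S≡5 , Γ≡0)) = ring-classified complete₅ {K} H oriented f star no2 T.cycle-tight T.tail-tight
        (λ _ → refl) (λ _ _ → refl) (Five.ring {K} H oriented f star no2 Γ≡0 #S≡5)

  open Conclusion {5} {k} {32} 9≤n (Represent.gadget complete₅) 0F (Represent.model-distinct complete₅ {k})
    excess classify public using (conclusion)

-- In each residue class the quotient in the claimed value is the number K of isolated 3-cycles, so
-- the value is n(n - 3) + K.
formula₀ : ∀ k → let n = suc (suc k) * 3 in
  (n * (n ∸ 3) + n / 3) + (2 * suc (suc k) + 0 + 2 * n) ≡ n * n
formula₀ k = trans (cong (λ q → (n * (n ∸ 3) + q) + (2 * suc (suc k) + 0 + 2 * n)) (m*n/n≡m (suc (suc k)) 3)) (arith k)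
  where
  n = suc (suc k) * 3
  arith : ∀ k → ((2 + k) * 3 * (3 + k * 3) + (2 + k)) + (2 * (2 + k) + 0 + 2 * ((2 + k) * 3)) ≡ (2 + k) * 3 * ((2 + k) * 3)
  arith = solve-∀

formula₁ : ∀ k → let n = 4 + suc (suc k) * 3 in
  (n * (n ∸ 3) + (n ∸ 4) / 3) + (2 * suc (suc k) + 4 + 2 * n) ≡ n * n
formula₁ k = trans (cong (λ q → (n * (n ∸ 3) + q) + (2 * suc (suc k) + 4 + 2 * n)) (m*n/n≡m (suc (suc k)) 3)) (arith k)
  where
  n = 4 + suc (suc k) * 3
  arith : ∀ k → ((4 + (2 + k) * 3) * (1 + (2 + k) * 3) + (2 + k)) + (2 * (2 + k) + 4 + 2 * (4 + (2 + k) * 3)) ≡ (4 + (2 + k) * 3) * (4 + (2 + k) * 3)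
  arith = solve-∀

formula₂ : ∀ k → let n = 5 + suc (suc k) * 3 in
  (n * (n ∸ 3) + (n ∸ 5) / 3) + (2 * suc (suc k) + 5 + 2 * n) ≡ n * n
formula₂ k = trans (cong (λ q → (n * (n ∸ 3) + q) + (2 * suc (suc k) + 5 + 2 * n)) (m*n/n≡m (suc (suc k)) 3)) (arith k)
  where
  n = 5 + suc (suc k) * 3
  arith : ∀ k → ((5 + (2 + k) * 3) * (2 + (2 + k) * 3) + (2 + k)) + (2 * (2 + k) + 5 + 2 * (5 + (2 + k) * 3)) ≡ (5 + (2 + k) * 3) * (5 + (2 + k) * 3)
  arith = solve-∀

by-quotient : ∀ {n r} → 9 ≤ n → n % 3 ≡ r → ∃[ k ] n ≡ r + (3 + k) * 3
by-quotient {n} {r} 9≤n n%3≡r with n / 3 | /-monoˡ-≤ 3 9≤n | m≡m%n+[m/n]*n n 3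
... | suc (suc (suc k)) | _ | eq = k , trans eq (cong (_+ (3 + k) * 3) n%3≡r)
... | suc (suc zero) | s≤s (s≤s ()) | _
... | suc zero | s≤s () | _

theorem2p1 : ∀ (n : ℕ) → 9 ≤ n →
    (n % 3 ≡ 0 → IsExₒ n I₀ (n * (n ∸ 3) + n / 3) × CountUpToIso {n} (Extremal I₀) 1) ×
    (n % 3 ≡ 1 → IsExₒ n I₀ (n * (n ∸ 3) + (n ∸ 4) / 3) × CountUpToIso {n} (Extremal I₀) 18) ×
    (n % 3 ≡ 2 → IsExₒ n I₀ (n * (n ∸ 3) + (n ∸ 5) / 3) × CountUpToIso {n} (Extremal I₀) 32)
theorem2p1 n 9≤n = residue₀ , residue₁ , residue₂
  where
  residue₀ : n % 3 ≡ 0 → IsExₒ n I₀ (n * (n ∸ 3) + n / 3) × CountUpToIso {n} (Extremal I₀) 1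
  residue₀ r with by-quotient 9≤n r
  -- Without a remainder all 3 + k triples of vertices are isolated 3-cycles.
  ... | k , refl = Residue₀.conclusion {suc k} 9≤n (formula₀ (suc k))
  residue₁ : n % 3 ≡ 1 → IsExₒ n I₀ (n * (n ∸ 3) + (n ∸ 4) / 3) × CountUpToIso {n} (Extremal I₀) 18
  residue₁ r with by-quotient 9≤n r
  -- One of the 3 + k triples joins the remainder to form the gadget, so 2 + k isolated 3-cycles are
  -- left; likewise for remainder 2.
  ... | k , refl = Residue₁.conclusion {k} 9≤n (formula₁ k)
  residue₂ : n % 3 ≡ 2 → IsExₒ n I₀ (n * (n ∸ 3) + (n ∸ 5) / 3) × CountUpToIso {n} (Extremal I₀) 32
  residue₂ r with by-quotient 9≤n r
  ... | k , refl = Residue₂.conclusion {k} 9≤n (formula₂ k)
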